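{- Let $n$ be a positive integer. Then $$t(1,1,2,8;n)=\begin{cases}4\sigma(2n+3)&\text{if } 2\mid n,\\ 4\sigma(2n+3)+4(-1)^{\frac{n-1}2}\sum\limits_{\substack{(r,s)\in\mathbb Z^2,\ 4\mid r-1\\ 2n+3=r^2+4s^2}} r&\text{if } 2\nmid n.\end{cases}$$
   Context: $\sigma(n)=\sum_{d\mid n,\,d\ge1}d$. For positive integers $a,b,c,d$ and a nonnegative integer $n$, $t(a,b,c,d;n)$ denotes the number of $(x,y,z,w)\in\mathbb Z^4$ with $n=a\frac{x(x-1)}2+b\frac{y(y-1)}2+c\frac{z(z-1)}2+d\frac{w(w-1)}2$. -}

module Defs where

open import Data.Nat as ℕ using (ℕ; zero; suc)
import Data.Nat.Divisibility as ℕD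
open import Data.Nat.DivMod using (_/_)
open import Data.Integer as ℤ using (ℤ; +_; -_; ∣_∣)
import Data.Integer.Divisibility.Signed as ℤD
open import Data.List using (List; []; _∷_; map; filter; length; concatMap; upTo; foldr)
open import Data.Nat.ListAction using (sum)
open import Data.Product using (_×_; _,_)
open import Relation.Nullary using (Dec; yes; no)
open import Relation.Nullary.Decidable using (_×-dec_)
open import Relation.Binary.PropositionalEquality using (_≡_)

σ : ℕ → ℕ
σ m = sum (filter (λ d → d ℕD.∣? m) (map suc (upTo m)))

range : ℕ → List ℤ
range N = map (λ k → + k ℤ.- + N) (upTo (suc (2 ℕ.* N)))

-- x(x-1)/2 for x ∈ ℤ (x(x-1) ≥ 0, so taking the absolute value changes nothing)
tri : ℤ → ℕ
tri x = ∣ x ℤ.* (x ℤ.- ℤ.1ℤ) ∣ / 2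

-- t(a,b,c,d;n): number of (x,y,z,w) ∈ ℤ⁴ with
-- n = a·x(x-1)/2 + b·y(y-1)/2 + c·z(z-1)/2 + d·w(w-1)/2.
-- Every solution has |x|,|y|,|z|,|w| ≤ n+1 (if |x| ≥ n+2 then x(x-1)/2 ≥ (n+1)(n+2)/2 > n),
-- so enumerating the box [-(n+1), n+1]⁴ counts all of them, each exactly once.
quads : ℕ → List (ℤ × ℤ × ℤ × ℤ)
quads N = concatMap (λ x → concatMap (λ y → concatMap (λ z → map (λ w → (x , y , z , w))
            (range N)) (range N)) (range N)) (range N)

t : ℕ → ℕ → ℕ → ℕ → ℕ → ℕ
t a b c d n = length (filter (λ { (x , y , z , w) →
    n ℕ.≟ (a ℕ.* tri x ℕ.+ b ℕ.* tri y ℕ.+ c ℕ.* tri z ℕ.+ d ℕ.* tri w) })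
  (quads (suc n)))

negOnePow : ℕ → ℤ
negOnePow zero = ℤ.1ℤ
negOnePow (suc k) = ℤ.- negOnePow k

sumℤ : List ℤ → ℤ
sumℤ = foldr ℤ._+_ ℤ.0ℤ

-- Σ r over (r,s) ∈ ℤ² with 4 ∣ r-1 and m = r² + 4s².
-- Any such pair has |r|,|s| ≤ m, so the box [-m,m]² contains all of them.
pairs : ℕ → List (ℤ × ℤ)
pairs N = concatMap (λ r → map (λ s → (r , s)) (range N)) (range N)

repSum : ℕ → ℤ
repSum m = sumℤ (map (λ { (r , s) → r })
  (filter (λ { (r , s) → ((+ 4) ℤD.∣? (r ℤ.- ℤ.1ℤ)) ×-dec ((+ m) ℤ.≟ (r ℤ.* r ℤ.+ + 4 ℤ.* (s ℤ.* s))) })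
    (pairs m)))

{-# OPTIONS --safe #-}
module Submission where

-- Put m = 2n + 3. Completing squares shows that t(1,1,2,8;n) is twice the number of solutions of
-- p² + q² + 2u² + 2w² = m with w odd, hence equals the number of all solutions minus D, the sum of (-1)ʷ over them.
-- As m is odd, the number of all solutions is r₄(m)/2 = 4σ(m).
--
-- If n is even, m ≡ 3 mod 4 forces u and w to have opposite parities, so D = 0. If n is odd, D becomes, up to an explicit
-- sign, twice the sum of (-1)ᶜ over p² + 4(a² + b² + c²) = m. The sum of (-1)ᶜ over b² + c² = k is cos(πk/2) r₂(k), a divisor sum,
-- and summing it over p² + 4k = M for M = m - 4a² gives, in the form of Jacobi's identity
-- Σ (-1)ᵏ(2k + 1)q^{k(k+1)/2} = ψ(q)φ(-q)², the sum of p χ(p) over p² = M.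
--
-- The formulas for r₂ and r₄ and Jacobi's identity all come from one involution. In the variables (a, b, c) = (d, -e, p + d - e)
-- the form p² + 4de is symmetric, so over its representations with d, e > 0 the sum of an antisymmetric function h(a, b, c)
-- collapses to the terms with c = 0. Suitable h turn this into Jacobi's identity, and into the statement that the divisor sums for
-- r₂ and r₄ satisfy the recurrences coming from the logarithmic derivative of powers of θ.

import Data.Nat as ℕ
import Data.Nat.Divisibility as ℕD
import Data.Nat.Properties as ℕP
import Data.Integer.Divisibility.Signed as ℤD
import Data.Integer.Properties as ℤP
open import Data.Bool using (if_then_else_)
open import Data.Integer.Tactic.RingSolver using (solve-∀)
open import Data.List using (List; []; _∷_; map; filter; length; concatMap; upTo; applyUpTo; _++_)
open import Data.Nat using (zero; suc)
open import Data.Nat.DivMod using (m*n/n≡m)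
open import Data.Nat.Induction using (<-rec)
open import Data.Nat.ListAction using (sum)
open import Data.Product using (∃; _,_; proj₁; proj₂)
open import Data.Product.Properties using (≡-dec)
open import Data.Sum using (_⊎_; inj₁; inj₂)
open import Function using (_∘_; id)
open import Relation.Binary.Definitions using (DecidableEquality; tri<; tri≈; tri>)
open import Relation.Binary.PropositionalEquality
  using (_≢_; refl; sym; trans; cong; cong₂; subst; module ≡-Reasoning)
open import Relation.Nullary using (Dec; yes; no; does; contradiction)
open import Relation.Nullary.Decidable using (_×-dec_; ¬?)
open import Relation.Unary using (Decidable)

open import Defs
open import Data.Nat.DivMod using (_/_)
open import Data.Product using (_×_)
open import Relation.Nullary using (¬_)
open import Relation.Binary.PropositionalEquality using (_≡_)

-- No power series occur: every theta identity is stated as an identity between finite sums over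
-- boxes `[-N, N]`, with one bound `N` serving all remainders such as `m - 4a²`. Multiplication by θ
-- becomes one more summation variable i.
--
-- The involution acts on p² + 4de, whereas the recurrences involve i² + de = n. Doubling i turns n
-- into 4n; this is where the conditions `4 ℕ.* n ℕ.≤ N` come from.
--
-- Three things are asked of h: it is antisymmetric, its part that is even in p and symmetric in d,
-- e is the wanted summand, and its values on the plane c = 0 have an elementary sum. A quadratic
-- weighted by χ serves r₂, a Vandermonde product with a parity weight serves r₄, and a sum of χ
-- over differences serves Jacobi's identity.
--
-- The sign in the result comes from m = 4k + 1 with k = (n + 1)/2: dividing the equation by 4 gives
-- k ≡ a + b + c mod 2, which trades the sign of b - c for that of a.

module _ where
  open import Data.Nat using (ℕ)
  open import Data.Integer using (ℤ; +_; -[1+_]; ∣_∣; 0ℤ; 1ℤ; _+_; _*_; -_; _-_; _≟_; _<?_; _<_; _≤_; +<+; +≤+; NonZero)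
  open ≡-Reasoning

  private variable
    A B P Q : Set

  -- Finite sums

  when : Dec P → ℤ → ℤ
  when d v = if does d then v else 0ℤ

  when-yes : (d : Dec P) {v : ℤ} → P → when d v ≡ v
  when-yes (yes _) p = refl
  when-yes (no ¬p) p = contradiction p ¬p

  when-no : (d : Dec P) {v : ℤ} → ¬ P → when d v ≡ 0ℤ
  when-no (yes p) ¬p = contradiction p ¬p
  when-no (no _) ¬p = refl

  when-cong : (d : Dec P) (e : Dec Q) {v w : ℤ} →
    (P → Q) → (Q → P) → (P → v ≡ w) → when d v ≡ when e w
  when-cong (yes p) e to from eq = trans (eq p) (sym (when-yes e (to p)))
  when-cong (no ¬p) e to from eq = sym (when-no e (¬p ∘ from))

  when-0 : (d : Dec P) → when d 0ℤ ≡ 0ℤ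
  when-0 (yes _) = refl
  when-0 (no _) = refl

  when-*ˡ : (d : Dec P) (c v : ℤ) → c * when d v ≡ when d (c * v)
  when-*ˡ (yes _) c v = refl
  when-*ˡ (no _) c v = ℤP.*-zeroʳ c

  when-+ : (d : Dec P) (v w : ℤ) → when d (v + w) ≡ when d v + when d w
  when-+ (yes _) v w = refl
  when-+ (no _) v w = refl

  ∑ : List A → (A → ℤ) → ℤ
  ∑ [] f = 0ℤ
  ∑ (x ∷ xs) f = f x + ∑ xs f

  ∑-cong : (xs : List A) {f g : A → ℤ} → (∀ x → f x ≡ g x) → ∑ xs f ≡ ∑ xs g
  ∑-cong [] eq = refl
  ∑-cong (x ∷ xs) eq = cong₂ _+_ (eq x) (∑-cong xs eq)

  ∑-0 : (xs : List A) {f : A → ℤ} → (∀ x → f x ≡ 0ℤ) → ∑ xs f ≡ 0ℤ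
  ∑-0 [] eq = refl
  ∑-0 (x ∷ xs) eq = cong₂ _+_ (eq x) (∑-0 xs eq)

  ∑-+ : (xs : List A) (f g : A → ℤ) → ∑ xs (λ x → f x + g x) ≡ ∑ xs f + ∑ xs g
  ∑-+ [] f g = refl
  ∑-+ (x ∷ xs) f g = trans (cong (_+_ (f x + g x)) (∑-+ xs f g)) (interchange (f x) (g x) (∑ xs f) (∑ xs g))
    where
    interchange : ∀ a b c d → a + b + (c + d) ≡ a + c + (b + d)
    interchange = solve-∀

  ∑-*ˡ : (xs : List A) (c : ℤ) (f : A → ℤ) → c * ∑ xs f ≡ ∑ xs (λ x → c * f x)
  ∑-*ˡ [] c f = ℤP.*-zeroʳ c
  ∑-*ˡ (x ∷ xs) c f = trans (ℤP.*-distribˡ-+ c (f x) (∑ xs f)) (cong (_+_ (c * f x)) (∑-*ˡ xs c f))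

  ∑-swap : (xs : List A) (ys : List B) (f : A → B → ℤ) →
    ∑ xs (λ x → ∑ ys (f x)) ≡ ∑ ys (λ y → ∑ xs (λ x → f x y))
  ∑-swap [] ys f = sym (∑-0 ys (λ _ → refl))
  ∑-swap (x ∷ xs) ys f = trans (cong (_+_ (∑ ys (f x))) (∑-swap xs ys f))
    (sym (∑-+ ys (f x) (λ y → ∑ xs (λ x′ → f x′ y))))

  ∑-++ : (xs ys : List A) (f : A → ℤ) → ∑ (xs ++ ys) f ≡ ∑ xs f + ∑ ys f
  ∑-++ [] ys f = sym (ℤP.+-identityˡ _)
  ∑-++ (x ∷ xs) ys f = trans (cong (_+_ (f x)) (∑-++ xs ys f)) (sym (ℤP.+-assoc (f x) _ _))

  ∑-map : (k : A → B) (xs : List A) (f : B → ℤ) → ∑ (map k xs) f ≡ ∑ xs (f ∘ k)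
  ∑-map k [] f = refl
  ∑-map k (x ∷ xs) f = cong (_+_ (f (k x))) (∑-map k xs f)

  ∑-concatMap : (k : A → List B) (xs : List A) (f : B → ℤ) →
    ∑ (concatMap k xs) f ≡ ∑ xs (λ x → ∑ (k x) f)
  ∑-concatMap k [] f = refl
  ∑-concatMap k (x ∷ xs) f =
    trans (∑-++ (k x) (concatMap k xs) f) (cong (_+_ (∑ (k x) f)) (∑-concatMap k xs f))

  ∑-filter : {P : A → Set} (P? : Decidable P) (xs : List A) (f : A → ℤ) →
    ∑ (filter P? xs) f ≡ ∑ xs (λ x → when (P? x) (f x))
  ∑-filter P? [] f = refl
  ∑-filter P? (x ∷ xs) f with P? x
  ... | yes _ = cong (_+_ (f x)) (∑-filter P? xs f)
  ... | no _ = trans (∑-filter P? xs f) (sym (ℤP.+-identityˡ _))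

  sumℤ≡∑ : (k : A → ℤ) (xs : List A) → sumℤ (map k xs) ≡ ∑ xs k
  sumℤ≡∑ k [] = refl
  sumℤ≡∑ k (x ∷ xs) = cong (_+_ (k x)) (sumℤ≡∑ k xs)

  length≡∑ : (xs : List A) → + length xs ≡ ∑ xs (λ _ → 1ℤ)
  length≡∑ [] = refl
  length≡∑ (x ∷ xs) = cong (_+_ 1ℤ) (length≡∑ xs)

  -- Finite boxes and reindexing of sums

  record Box (A : Set) : Set where
    constructor box
    field
      elems : List A
      _≟ᵇ_ : DecidableEquality A

  open Box

  -- Says that y occurs exactly once.
  infix 4 _∈_
  _∈_ : A → Box A → Set
  y ∈ X = ∀ f → (∀ z → z ≢ y → f z ≡ 0ℤ) → ∑ (elems X) f ≡ f y

  infixr 5 _⊗_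
  _⊗_ : Box A → Box B → Box (A × B)
  X ⊗ Y = box (concatMap (λ x → map (x ,_) (elems Y)) (elems X)) (≡-dec (_≟ᵇ_ X) (_≟ᵇ_ Y))

  ∑-⊗ : (X : Box A) (Y : Box B) (f : A × B → ℤ) →
    ∑ (elems (X ⊗ Y)) f ≡ ∑ (elems X) (λ x → ∑ (elems Y) (λ y → f (x , y)))
  ∑-⊗ X Y f = trans (∑-concatMap _ (elems X) f) (∑-cong (elems X) (λ x → ∑-map (x ,_) (elems Y) f))

  ∈-⊗ : (X : Box A) (Y : Box B) {x : A} {y : B} → x ∈ X → y ∈ Y → (x , y) ∈ X ⊗ Y
  ∈-⊗ X Y {x} {y} x∈ y∈ f f0 = begin
    ∑ (elems (X ⊗ Y)) f
      ≡⟨ ∑-⊗ X Y f ⟩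
    ∑ (elems X) (λ x → ∑ (elems Y) (λ y → f (x , y)))
      ≡⟨ x∈ _ (λ z z≢ → ∑-0 (elems Y) (λ w → f0 (z , w) (z≢ ∘ cong proj₁))) ⟩
    ∑ (elems Y) (λ y → f (x , y))
      ≡⟨ y∈ _ (λ w w≢ → f0 (x , w) (w≢ ∘ cong proj₂)) ⟩
    f (x , y) ∎

  ∑[_∣_] : {P : A → Set} → Box A → Decidable P → (A → ℤ) → ℤ
  ∑[ X ∣ P? ] f = ∑ (elems X) (λ x → when (P? x) (f x))

  -- A Kronecker delta spreads each term over `Y`, the two sums are exchanged, and the delta at
  -- `to x` is read as a delta at `from y`. Membership is asked of solutions only, so the boxes may
  -- differ in size and the maps may be arbitrary off the solutions.
  ∑-reindex : (X : Box A) (Y : Box B) {P : A → Set} {Q : B → Set} (P? : Decidable P) (Q? : Decidable Q)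
    {f : A → ℤ} {h : B → ℤ} (to : A → B) (from : B → A) →
    (∀ x → P x → x ∈ X) → (∀ y → Q y → y ∈ Y) →
    (∀ x → P x → Q (to x) × from (to x) ≡ x × f x ≡ h (to x)) →
    (∀ y → Q y → P (from y) × to (from y) ≡ y) →
    ∑[ X ∣ P? ] f ≡ ∑[ Y ∣ Q? ] h
  ∑-reindex X Y {P} {Q} P? Q? {f} {h} to from P⊆X Q⊆Y toQ fromP = begin
    ∑ (elems X) F
      ≡⟨ ∑-cong (elems X) spreadF ⟩
    ∑ (elems X) (λ x → ∑ (elems Y) (λ y → when (_≟ᵇ_ Y y (to x)) (F x)))
      ≡⟨ ∑-swap (elems X) (elems Y) _ ⟩
    ∑ (elems Y) (λ y → ∑ (elems X) (λ x → when (_≟ᵇ_ Y y (to x)) (F x)))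
      ≡⟨ ∑-cong (elems Y) (λ y → ∑-cong (elems X) (λ x → match x y)) ⟩
    ∑ (elems Y) (λ y → ∑ (elems X) (λ x → when (_≟ᵇ_ X x (from y)) (G y)))
      ≡⟨ ∑-cong (elems Y) spreadG ⟨
    ∑ (elems Y) G ∎
    where
    F : _ → ℤ
    F x = when (P? x) (f x)
    G : _ → ℤ
    G y = when (Q? y) (h y)
    spreadF : ∀ x → F x ≡ ∑ (elems Y) (λ y → when (_≟ᵇ_ Y y (to x)) (F x))
    spreadF x with P? x
    ... | no _ = sym (∑-0 (elems Y) (λ y → when-0 (_≟ᵇ_ Y y (to x))))
    ... | yes p = sym (trans (Q⊆Y (to x) (proj₁ (toQ x p)) _ (λ z z≢ → when-no (_≟ᵇ_ Y z (to x)) z≢))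
                             (when-yes (_≟ᵇ_ Y (to x) (to x)) refl))
    spreadG : ∀ y → G y ≡ ∑ (elems X) (λ x → when (_≟ᵇ_ X x (from y)) (G y))
    spreadG y with Q? y
    ... | no _ = sym (∑-0 (elems X) (λ x → when-0 (_≟ᵇ_ X x (from y))))
    ... | yes q = sym (trans (P⊆X (from y) (proj₁ (fromP y q)) _ (λ z z≢ → when-no (_≟ᵇ_ X z (from y)) z≢))
                             (when-yes (_≟ᵇ_ X (from y) (from y)) refl))
    match : ∀ x y → when (_≟ᵇ_ Y y (to x)) (F x) ≡ when (_≟ᵇ_ X x (from y)) (G y)
    match x y with P? x | Q? y
    ... | no _ | no _ = trans (when-0 (_≟ᵇ_ Y y (to x))) (sym (when-0 (_≟ᵇ_ X x (from y))))
    ... | yes p | no ¬q = trans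
      (when-no (_≟ᵇ_ Y y (to x)) (λ eq → ¬q (subst Q (sym eq) (proj₁ (toQ x p)))))
      (sym (when-0 (_≟ᵇ_ X x (from y))))
    ... | no ¬p | yes q = trans (when-0 (_≟ᵇ_ Y y (to x)))
      (sym (when-no (_≟ᵇ_ X x (from y)) (λ eq → ¬p (subst P (sym eq) (proj₁ (fromP y q))))))
    ... | yes p | yes q = when-cong (_≟ᵇ_ Y y (to x)) (_≟ᵇ_ X x (from y))
      (λ eq → trans (sym (proj₁ (proj₂ (toQ x p)))) (cong from (sym eq)))
      (λ eq → trans (sym (proj₂ (fromP y q))) (cong to (sym eq)))
      (λ eq → trans (proj₂ (proj₂ (toQ x p))) (cong h (sym eq)))

  ∑-split : (X : Box A) {P Q : A → Set} (P? : Decidable P) (Q? : Decidable Q) (f : A → ℤ) →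
    ∑[ X ∣ P? ] f ≡ ∑[ X ∣ (λ x → P? x ×-dec Q? x) ] f + ∑[ X ∣ (λ x → P? x ×-dec ¬? (Q? x)) ] f
  ∑-split X P? Q? f = trans (∑-cong (elems X) split) (∑-+ (elems X) _ _)
    where
    split : ∀ x → when (P? x) (f x) ≡
      when (P? x ×-dec Q? x) (f x) + when (P? x ×-dec ¬? (Q? x)) (f x)
    split x with P? x | Q? x
    ... | no _ | no _ = refl
    ... | no _ | yes _ = refl
    ... | yes _ | no _ = sym (ℤP.+-identityˡ _)
    ... | yes _ | yes _ = sym (ℤP.+-identityʳ _)

  ∑[]-cong : (X : Box A) {P Q : A → Set} (P? : Decidable P) (Q? : Decidable Q) {f g : A → ℤ} →
    (∀ x → P x → Q x) → (∀ x → Q x → P x) → (∀ x → P x → f x ≡ g x) →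
    ∑[ X ∣ P? ] f ≡ ∑[ X ∣ Q? ] g
  ∑[]-cong X P? Q? to from eq = ∑-cong (elems X) (λ x → when-cong (P? x) (Q? x) (to x) (from x) (eq x))

  ∑[]-map : (X : Box A) {P : A → Set} (P? : Decidable P) {f g : A → ℤ} →
    (∀ x → P x → f x ≡ g x) → ∑[ X ∣ P? ] f ≡ ∑[ X ∣ P? ] g
  ∑[]-map X P? = ∑[]-cong X P? P? (λ _ p → p) (λ _ p → p)

  ∑[]-0 : (X : Box A) {P : A → Set} (P? : Decidable P) {f : A → ℤ} →
    (∀ x → P x → f x ≡ 0ℤ) → ∑[ X ∣ P? ] f ≡ 0ℤ
  ∑[]-0 X P? eq = trans (∑[]-map X P? eq) (∑-0 (elems X) (λ x → when-0 (P? x)))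

  ∑[]-+ : (X : Box A) {P : A → Set} (P? : Decidable P) (f g : A → ℤ) →
    ∑[ X ∣ P? ] (λ x → f x + g x) ≡ ∑[ X ∣ P? ] f + ∑[ X ∣ P? ] g
  ∑[]-+ X P? f g = trans (∑-cong (elems X) (λ x → when-+ (P? x) (f x) (g x))) (∑-+ (elems X) _ _)

  ∑[]-*ˡ : (X : Box A) {P : A → Set} (P? : Decidable P) (c : ℤ) (f : A → ℤ) →
    c * ∑[ X ∣ P? ] f ≡ ∑[ X ∣ P? ] (λ x → c * f x)
  ∑[]-*ˡ X P? c f = trans (∑-*ˡ (elems X) c _) (∑-cong (elems X) (λ x → when-*ˡ (P? x) c (f x)))

  -- Sums over initial segments and integer intervals

  ∑< : ℕ → (ℕ → ℤ) → ℤ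
  ∑< zero h = 0ℤ
  ∑< (suc n) h = h 0 + ∑< n (h ∘ suc)

  ∑<-cong : ∀ n {g h : ℕ → ℤ} → (∀ k → g k ≡ h k) → ∑< n g ≡ ∑< n h
  ∑<-cong zero eq = refl
  ∑<-cong (suc n) eq = cong₂ _+_ (eq 0) (∑<-cong n (eq ∘ suc))

  ∑<-0 : ∀ n {h : ℕ → ℤ} → (∀ k → h k ≡ 0ℤ) → ∑< n h ≡ 0ℤ
  ∑<-0 zero eq = refl
  ∑<-0 (suc n) eq = cong₂ _+_ (eq 0) (∑<-0 n (eq ∘ suc))

  ∑<-δ : ∀ {n k} {h : ℕ → ℤ} → k ℕ.< n → (∀ j → j ≢ k → h j ≡ 0ℤ) → ∑< n h ≡ h k
  ∑<-δ {suc n} {zero} {h} k<n h0 =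
    trans (cong (_+_ (h 0)) (∑<-0 n (λ j → h0 (suc j) λ ()))) (ℤP.+-identityʳ _)
  ∑<-δ {suc n} {suc k} (ℕ.s≤s k<n) h0 =
    trans (cong₂ _+_ (h0 0 λ ()) (∑<-δ k<n (λ j j≢ → h0 (suc j) (j≢ ∘ ℕP.suc-injective))))
          (ℤP.+-identityˡ _)

  ∑<-last : ∀ n (h : ℕ → ℤ) → ∑< (suc n) h ≡ ∑< n h + h n
  ∑<-last zero h = ℤP.+-comm (h 0) 0ℤ
  ∑<-last (suc n) h = trans (cong (_+_ (h 0)) (∑<-last n (h ∘ suc))) (sym (ℤP.+-assoc (h 0) _ _))

  ∑<-*ˡ : ∀ n c (h : ℕ → ℤ) → c * ∑< n h ≡ ∑< n (λ k → c * h k)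
  ∑<-*ˡ zero c h = ℤP.*-zeroʳ c
  ∑<-*ˡ (suc n) c h = trans (ℤP.*-distribˡ-+ c (h 0) _) (cong (_+_ (c * h 0)) (∑<-*ˡ n c (h ∘ suc)))

  ∑-applyUpTo : (k : ℕ → A) (n : ℕ) (f : A → ℤ) → ∑ (applyUpTo k n) f ≡ ∑< n (f ∘ k)
  ∑-applyUpTo k zero f = refl
  ∑-applyUpTo k (suc n) f = cong (_+_ (f (k 0))) (∑-applyUpTo (k ∘ suc) n f)

  -- Abstract, as unification would otherwise unfold the lists behind the boxes.
  abstract
    Z : ℕ → Box ℤ
    Z N = box (range N) _≟_

    ∑-Z : ∀ N (f : ℤ → ℤ) → ∑ (elems (Z N)) f ≡ ∑ (range N) f
    ∑-Z N f = refl

  offset : ∀ {N} x → ∣ x ∣ ℕ.≤ N → ∃ λ k → k ℕ.≤ 2 ℕ.* N × + k - + N ≡ x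
  offset {N} (+ y) le = y ℕ.+ N ,
    ℕP.≤-trans (ℕP.+-monoˡ-≤ N le) (ℕP.≤-reflexive (cong (N ℕ.+_) (sym (ℕP.+-identityʳ N)))) ,
    cancel (+ y) (+ N)
    where
    cancel : ∀ a b → a + b - b ≡ a
    cancel = solve-∀
  offset {N} -[1+ y ] le = N ℕ.∸ suc y ,
    ℕP.≤-trans (ℕP.m∸n≤m N (suc y)) (ℕP.m≤m+n N _) ,
    trans (cong (λ z → z - + N) (trans (sym (ℤP.⊖-≥ le)) (sym (ℤP.m-n≡m⊖n N (suc y)))))
          (cancel (+ N) (+ suc y))
    where
    cancel : ∀ a b → a - b - a ≡ - b
    cancel = solve-∀

  ∈-Z : ∀ {N x} → ∣ x ∣ ℕ.≤ N → x ∈ Z N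
  ∈-Z {N} {x} x≤N f f0 = begin
    ∑ (elems (Z N)) f
      ≡⟨ ∑-Z N f ⟩
    ∑ (range N) f
      ≡⟨ ∑-map shift (upTo (suc (2 ℕ.* N))) f ⟩
    ∑ (upTo (suc (2 ℕ.* N))) (f ∘ shift)
      ≡⟨ ∑-applyUpTo id (suc (2 ℕ.* N)) (f ∘ shift) ⟩
    ∑< (suc (2 ℕ.* N)) (f ∘ shift)
      ≡⟨ ∑<-δ {k = proj₁ index} (ℕ.s≤s (proj₁ (proj₂ index))) off ⟩
    f (shift (proj₁ index))
      ≡⟨ cong f (proj₂ (proj₂ index)) ⟩
    f x ∎
    where
    shift : ℕ → ℤ
    shift k = + k - + N
    index : ∃ λ k → k ℕ.≤ 2 ℕ.* N × + k - + N ≡ x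
    index = offset x x≤N
    off : ∀ j → j ≢ proj₁ index → f (shift j) ≡ 0ℤ
    off j j≢ = f0 (shift j) λ eq → j≢ (ℤP.+-injective (begin
      + j ≡⟨ undo (+ j) (+ N) ⟩
      shift j + + N ≡⟨ cong (λ z → z + + N) (trans eq (sym (proj₂ (proj₂ index)))) ⟩
      shift (proj₁ index) + + N ≡⟨ undo (+ proj₁ index) (+ N) ⟨
      + proj₁ index ∎))
      where
      undo : ∀ a b → a ≡ a - b + b
      undo = solve-∀

  -- Characters modulo 4

  -- The mutual recursion is the quarter turn (cos, sin) ↦ (-sin, cos), so the addition formulas
  -- follow by induction.
  κℕ χℕ : ℕ → ℤ
  κℕ zero = 1ℤ
  κℕ (suc n) = - χℕ n
  χℕ zero = 0ℤ
  χℕ (suc n) = κℕ n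

  -- κ x = cos (πx/2) and χ x = sin (πx/2).
  κ χ : ℤ → ℤ
  κ x = κℕ ∣ x ∣
  χ (+ n) = χℕ n
  χ -[1+ n ] = - χℕ (suc n)

  κ-neg : ∀ x → κ (- x) ≡ κ x
  κ-neg x = cong κℕ (ℤP.∣-i∣≡∣i∣ x)

  χ-neg : ∀ x → χ (- x) ≡ - χ x
  χ-neg (+ zero) = refl
  χ-neg (+ suc n) = refl
  χ-neg -[1+ n ] = sym (ℤP.neg-involutive _)

  κ-suc : ∀ x → κ (1ℤ + x) ≡ - χ x
  κ-suc (+ n) = refl
  κ-suc -[1+ zero ] = refl
  κ-suc -[1+ suc n ] = sym (ℤP.neg-involutive _)

  χ-suc : ∀ x → χ (1ℤ + x) ≡ κ x
  χ-suc (+ n) = refl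
  χ-suc -[1+ zero ] = refl
  χ-suc -[1+ suc n ] = refl

  add-pos : ∀ n y → κ (+ n + y) ≡ κℕ n * κ y - χℕ n * χ y × χ (+ n + y) ≡ χℕ n * κ y + κℕ n * χ y
  add-pos zero y = trans (cong κ (ℤP.+-identityˡ y)) (l₁ (κ y) (χ y)) ,
                   trans (cong χ (ℤP.+-identityˡ y)) (l₂ (κ y) (χ y))
    where
    l₁ : ∀ k c → k ≡ 1ℤ * k - 0ℤ * c
    l₁ = solve-∀
    l₂ : ∀ k c → c ≡ 0ℤ * k + 1ℤ * c
    l₂ = solve-∀
  add-pos (suc n) y with add-pos n y
  ... | ih₁ , ih₂ =
    trans (cong κ assoc) (trans (κ-suc (+ n + y)) (trans (cong -_ ih₂) (l₁ (χℕ n) (κℕ n) (κ y) (χ y)))) ,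
    trans (cong χ assoc) (trans (χ-suc (+ n + y)) (trans ih₁ (l₂ (χℕ n) (κℕ n) (κ y) (χ y))))
    where
    assoc : + suc n + y ≡ 1ℤ + (+ n + y)
    assoc = ℤP.+-assoc 1ℤ (+ n) y
    l₁ : ∀ c k κy χy → - (c * κy + k * χy) ≡ - c * κy - k * χy
    l₁ = solve-∀
    l₂ : ∀ c k κy χy → k * κy - c * χy ≡ k * κy + - c * χy
    l₂ = solve-∀

  κ-+ : ∀ x y → κ (x + y) ≡ κ x * κ y - χ x * χ y
  κ-+ (+ n) y = proj₁ (add-pos n y)
  κ-+ -[1+ n ] y = begin
    κ (-[1+ n ] + y)       ≡⟨ cong κ (flip (+ suc n) y) ⟩
    κ (- (+ suc n + - y))  ≡⟨ κ-neg (+ suc n + - y) ⟩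
    κ (+ suc n + - y)      ≡⟨ proj₁ (add-pos (suc n) (- y)) ⟩
    κℕ (suc n) * κ (- y) - χℕ (suc n) * χ (- y)
      ≡⟨ cong₂ (λ k c → κℕ (suc n) * k - χℕ (suc n) * c) (κ-neg y) (χ-neg y) ⟩
    κℕ (suc n) * κ y - χℕ (suc n) * - χ y
      ≡⟨ l (κℕ (suc n)) (χℕ (suc n)) (κ y) (χ y) ⟩
    κℕ (suc n) * κ y - - χℕ (suc n) * χ y ∎
    where
    flip : ∀ a y → - a + y ≡ - (a + - y)
    flip = solve-∀
    l : ∀ a b k c → a * k - b * - c ≡ a * k - - b * c
    l = solve-∀

  χ-+ : ∀ x y → χ (x + y) ≡ χ x * κ y + κ x * χ y
  χ-+ (+ n) y = proj₂ (add-pos n y)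
  χ-+ -[1+ n ] y = begin
    χ (-[1+ n ] + y)       ≡⟨ cong χ (flip (+ suc n) y) ⟩
    χ (- (+ suc n + - y))  ≡⟨ χ-neg (+ suc n + - y) ⟩
    - χ (+ suc n + - y)    ≡⟨ cong -_ (proj₂ (add-pos (suc n) (- y))) ⟩
    - (χℕ (suc n) * κ (- y) + κℕ (suc n) * χ (- y))
      ≡⟨ cong₂ (λ k c → - (χℕ (suc n) * k + κℕ (suc n) * c)) (κ-neg y) (χ-neg y) ⟩
    - (χℕ (suc n) * κ y + κℕ (suc n) * - χ y)
      ≡⟨ l (κℕ (suc n)) (χℕ (suc n)) (κ y) (χ y) ⟩
    - χℕ (suc n) * κ y + κℕ (suc n) * χ y ∎
    where
    flip : ∀ a y → - a + y ≡ - (a + - y)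
    flip = solve-∀
    l : ∀ a b k c → - (b * k + a * - c) ≡ - b * k + a * c
    l = solve-∀

  parityℕ : ∀ n → (∃ λ k → + n ≡ + 2 * k) ⊎ (∃ λ k → + n ≡ + 2 * k + 1ℤ)
  parityℕ zero = inj₁ (0ℤ , refl)
  parityℕ (suc n) with parityℕ n
  ... | inj₁ (k , eq) = inj₂ (k , trans (cong (_+_ 1ℤ) eq) (ℤP.+-comm 1ℤ (+ 2 * k)))
  ... | inj₂ (k , eq) = inj₁ (k + 1ℤ , trans (cong (_+_ 1ℤ) eq) (l k))
    where
    l : ∀ k → 1ℤ + (+ 2 * k + 1ℤ) ≡ + 2 * (k + 1ℤ)
    l = solve-∀

  parity : ∀ x → (∃ λ k → x ≡ + 2 * k) ⊎ (∃ λ k → x ≡ + 2 * k + 1ℤ)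
  parity (+ n) = parityℕ n
  parity -[1+ n ] with parityℕ (suc n)
  ... | inj₁ (k , eq) = inj₁ (- k , trans (cong -_ eq) (l k))
    where
    l : ∀ k → - (+ 2 * k) ≡ + 2 * - k
    l = solve-∀
  ... | inj₂ (k , eq) = inj₂ (- k - 1ℤ , trans (cong -_ eq) (l k))
    where
    l : ∀ k → - (+ 2 * k + 1ℤ) ≡ + 2 * (- k - 1ℤ) + 1ℤ
    l = solve-∀

  κχ≡0 : ∀ x → κ x * χ x ≡ 0ℤ
  κχ≡0 x = nonneg x
    where
    pos : ∀ n → κℕ n * χℕ n ≡ 0ℤ
    pos zero = refl
    pos (suc n) = trans (l (χℕ n) (κℕ n)) (cong -_ (pos n))
      where
      l : ∀ c k → - c * k ≡ - (k * c)
      l = solve-∀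
    nonneg : ∀ x → κ x * χ x ≡ 0ℤ
    nonneg (+ n) = pos n
    nonneg -[1+ n ] = trans (sym (ℤP.neg-distribʳ-* (κℕ (suc n)) (χℕ (suc n)))) (cong -_ (pos (suc n)))

  κ²+χ²≡1 : ∀ x → κ x * κ x + χ x * χ x ≡ 1ℤ
  κ²+χ²≡1 x = trans (sym (trans (κ-+ x (- x))
    (trans (cong₂ (λ k c → κ x * k - χ x * c) (κ-neg x) (χ-neg x)) (l (κ x) (χ x)))))
    (cong κ (ℤP.+-inverseʳ x))
    where
    l : ∀ k c → k * k - c * - c ≡ k * k + c * c
    l = solve-∀

  χ-2* : ∀ x → χ (+ 2 * x) ≡ 0ℤ
  χ-2* x = begin
    χ (+ 2 * x)           ≡⟨ cong χ (double x) ⟩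
    χ (x + x)             ≡⟨ χ-+ x x ⟩
    χ x * κ x + κ x * χ x ≡⟨ cong₂ _+_ (trans (ℤP.*-comm (χ x) (κ x)) (κχ≡0 x)) (κχ≡0 x) ⟩
    0ℤ ∎
    where
    double : ∀ x → + 2 * x ≡ x + x
    double = solve-∀

  κ-2*-+ : ∀ x y → κ (+ 2 * x + y) ≡ κ (+ 2 * x) * κ y
  κ-2*-+ x y = trans (κ-+ (+ 2 * x) y)
    (trans (cong (λ c → κ (+ 2 * x) * κ y - c * χ y) (χ-2* x)) (l _ (χ y)))
    where
    l : ∀ a b → a - 0ℤ * b ≡ a
    l = solve-∀

  χ-2*-+ : ∀ x y → χ (+ 2 * x + y) ≡ κ (+ 2 * x) * χ y
  χ-2*-+ x y = trans (χ-+ (+ 2 * x) y)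
    (trans (cong (λ c → c * κ y + κ (+ 2 * x) * χ y) (χ-2* x)) (ℤP.+-identityˡ _))

  κ-odd : ∀ x → κ (+ 2 * x + 1ℤ) ≡ 0ℤ
  κ-odd x = trans (κ-2*-+ x 1ℤ) (ℤP.*-zeroʳ (κ (+ 2 * x)))

  χ-odd : ∀ x → χ (+ 2 * x + 1ℤ) ≡ κ (+ 2 * x)
  χ-odd x = trans (χ-2*-+ x 1ℤ) (ℤP.*-identityʳ (κ (+ 2 * x)))

  -- This is cos πx = (-1)ˣ. Defined through κ, it is multiplicative because χ vanishes at even
  -- arguments.
  sgn : ℤ → ℤ
  sgn x = κ (+ 2 * x)

  sgn-+ : ∀ x y → sgn (x + y) ≡ sgn x * sgn y
  sgn-+ x y = trans (cong κ (ℤP.*-distribˡ-+ (+ 2) x y)) (κ-2*-+ x (+ 2 * y))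

  sgn²≡1 : ∀ x → sgn x * sgn x ≡ 1ℤ
  sgn²≡1 x = trans (l (sgn x)) (trans (cong (λ c → sgn x * sgn x + c * c) (sym (χ-2* x))) (κ²+χ²≡1 (+ 2 * x)))
    where
    l : ∀ a → a * a ≡ a * a + 0ℤ * 0ℤ
    l = solve-∀

  sgn-2* : ∀ x → sgn (+ 2 * x) ≡ 1ℤ
  sgn-2* x = trans (cong sgn (double x)) (trans (sgn-+ x x) (sgn²≡1 x))
    where
    double : ∀ x → + 2 * x ≡ x + x
    double = solve-∀

  sgn-odd : ∀ x → sgn (+ 2 * x + 1ℤ) ≡ - 1ℤ
  sgn-odd x = trans (sgn-+ (+ 2 * x) 1ℤ) (cong (λ z → z * - 1ℤ) (sgn-2* x))

  -- ev x is 1 for even x and 0 for odd x.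
  ev : ℤ → ℤ
  ev x = κ x * κ x

  ev-2* : ∀ x → ev (+ 2 * x) ≡ 1ℤ
  ev-2* = sgn²≡1

  ev-odd : ∀ x → ev (+ 2 * x + 1ℤ) ≡ 0ℤ
  ev-odd x = cong (λ k → k * k) (κ-odd x)

  sgn≡2ev-1 : ∀ x → sgn x ≡ + 2 * ev x - 1ℤ
  sgn≡2ev-1 x with parity x
  ... | inj₁ (k , refl) = trans (sgn-2* k) (cong (λ z → + 2 * z - 1ℤ) (sym (ev-2* k)))
  ... | inj₂ (k , refl) = trans (sgn-odd k) (cong (λ z → + 2 * z - 1ℤ) (sym (ev-odd k)))

  2k≢2j+1 : ∀ {k j} → + 2 * k ≢ + 2 * j + 1ℤ
  2k≢2j+1 {k} {j} eq with trans (sym (ev-2* k)) (trans (cong ev eq) (ev-odd j))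
  ... | ()

  κ-sq : ∀ x → κ (x * x) ≡ ev x
  κ-sq x with parity x
  ... | inj₁ (k , refl) = trans (cong κ (l k)) (trans (sgn-2* (k * k)) (sym (ev-2* k)))
    where
    l : ∀ k → (+ 2 * k) * (+ 2 * k) ≡ + 2 * (+ 2 * (k * k))
    l = solve-∀
  ... | inj₂ (k , refl) = trans (cong κ (l k)) (trans (κ-odd (+ 2 * (k * k + k))) (sym (ev-odd k)))
    where
    l : ∀ k → (+ 2 * k + 1ℤ) * (+ 2 * k + 1ℤ) ≡ + 2 * (+ 2 * (k * k + k)) + 1ℤ
    l = solve-∀

  χ-sq : ∀ x → χ (x * x) ≡ 1ℤ - ev x
  χ-sq x with parity x
  ... | inj₁ (k , refl) = trans (cong χ (l k)) (trans (χ-2* (+ 2 * (k * k))) (cong (_-_ 1ℤ) (sym (ev-2* k))))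
    where
    l : ∀ k → (+ 2 * k) * (+ 2 * k) ≡ + 2 * (+ 2 * (k * k))
    l = solve-∀
  ... | inj₂ (k , refl) = trans (cong χ (l k)) (trans (χ-odd (+ 2 * (k * k + k)))
    (trans (sgn-2* (k * k + k)) (cong (_-_ 1ℤ) (sym (ev-odd k)))))
    where
    l : ∀ k → (+ 2 * k + 1ℤ) * (+ 2 * k + 1ℤ) ≡ + 2 * (+ 2 * (k * k + k)) + 1ℤ
    l = solve-∀

  -- Modulo 4 a square is 0 or 1 according to parity, so both sides are 2, 0 or -2 for no, one or
  -- two odd entries. A symmetrised sign thereby depends only on the number represented.
  sgn+sgn : ∀ x y → sgn x + sgn y ≡ + 2 * κ (x * x + y * y)
  sgn+sgn x y = begin
    sgn x + sgn y                                     ≡⟨ cong₂ _+_ (sgn≡2ev-1 x) (sgn≡2ev-1 y) ⟩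
    + 2 * ev x - 1ℤ + (+ 2 * ev y - 1ℤ)               ≡⟨ l (ev x) (ev y) ⟩
    + 2 * (ev x * ev y - (1ℤ - ev x) * (1ℤ - ev y))
      ≡⟨ cong (_*_ (+ 2)) (sym (trans (κ-+ (x * x) (y * y))
           (cong₂ _-_ (cong₂ _*_ (κ-sq x) (κ-sq y)) (cong₂ _*_ (χ-sq x) (χ-sq y))))) ⟩
    + 2 * κ (x * x + y * y) ∎
    where
    l : ∀ a b → + 2 * a - 1ℤ + (+ 2 * b - 1ℤ) ≡ + 2 * (a * b - (1ℤ - a) * (1ℤ - b))
    l = solve-∀

  -- χ kills even x. An odd factor x preserves the parity of y and, for even y, also its class
  -- modulo 4.
  χκ-* : ∀ x y → χ x * κ (x * y) ≡ χ x * κ y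
  χκ-* x y with parity x | parity y
  ... | inj₁ (k , refl) | _ = trans (cong (λ c → c * κ (+ 2 * k * y)) (χ-2* k)) (sym (cong (λ c → c * κ y) (χ-2* k)))
  ... | inj₂ (k , refl) | inj₁ (j , refl) = cong (_*_ (χ (+ 2 * k + 1ℤ))) (begin
    κ ((+ 2 * k + 1ℤ) * (+ 2 * j))           ≡⟨ cong κ (l k j) ⟩
    κ (+ 2 * (+ 2 * (k * j)) + + 2 * j)      ≡⟨ κ-2*-+ (+ 2 * (k * j)) (+ 2 * j) ⟩
    sgn (+ 2 * (k * j)) * κ (+ 2 * j)        ≡⟨ cong (λ s → s * κ (+ 2 * j)) (sgn-2* (k * j)) ⟩
    1ℤ * κ (+ 2 * j)                         ≡⟨ ℤP.*-identityˡ _ ⟩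
    κ (+ 2 * j) ∎)
    where
    l : ∀ k j → (+ 2 * k + 1ℤ) * (+ 2 * j) ≡ + 2 * (+ 2 * (k * j)) + + 2 * j
    l = solve-∀
  ... | inj₂ (k , refl) | inj₂ (j , refl) = cong (_*_ (χ (+ 2 * k + 1ℤ)))
    (trans (cong κ (l k j)) (trans (κ-odd (+ 2 * (k * j) + k + j)) (sym (κ-odd j))))
    where
    l : ∀ k j → (+ 2 * k + 1ℤ) * (+ 2 * j + 1ℤ) ≡ + 2 * (+ 2 * (k * j) + k + j) + 1ℤ
    l = solve-∀

  -- The involution argument

  ,₃-cong : {C : Set} {a a′ : A} {b b′ : B} {c c′ : C} → a ≡ a′ → b ≡ b′ → c ≡ c′ → (a , b , c) ≡ (a′ , b′ , c′)
  ,₃-cong refl refl refl = refl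

  ,₄-cong : {C D : Set} {a a′ : A} {b b′ : B} {c c′ : C} {d d′ : D} →
    a ≡ a′ → b ≡ b′ → c ≡ c′ → d ≡ d′ → (a , b , c , d) ≡ (a′ , b′ , c′ , d′)
  ,₄-cong refl refl refl refl = refl

  n≤n*n : ∀ n → n ℕ.≤ n ℕ.* n
  n≤n*n zero = ℕ.z≤n
  n≤n*n (suc n) = ℕP.m≤m*n (suc n) (suc n)

  sq≡+ : ∀ x → x * x ≡ + (∣ x ∣ ℕ.* ∣ x ∣)
  sq≡+ (+ n) = sym (ℤP.pos-* n n)
  sq≡+ -[1+ n ] = refl

  self-neg : ∀ {x} → x ≡ - x → x ≡ 0ℤ
  self-neg {x} eq = ℤP.*-cancelˡ-≡ (+ 2) x 0ℤ (begin
    + 2 * x  ≡⟨ double x ⟩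
    x + x    ≡⟨ cong (_+_ x) eq ⟩
    x + - x  ≡⟨ ℤP.+-inverseʳ x ⟩
    0ℤ ∎)
    where
    double : ∀ x → + 2 * x ≡ x + x
    double = solve-∀

  neg-pos : ∀ {x y} → x < y → 0ℤ < y - x
  neg-pos {x} {y} x<y = subst (λ z → z < y - x) (ℤP.+-inverseʳ x) (ℤP.+-monoˡ-< (- x) x<y)

  ∑[]-neg : (X : Box A) {P : A → Set} (P? : Decidable P) (f : A → ℤ) →
    ∑[ X ∣ P? ] (λ x → - f x) ≡ - ∑[ X ∣ P? ] f
  ∑[]-neg X P? f = begin
    ∑[ X ∣ P? ] (λ x → - f x)          ≡⟨ ∑[]-map X P? (λ x _ → sym (ℤP.-1*i≡-i (f x))) ⟩
    ∑[ X ∣ P? ] (λ x → - 1ℤ * f x)     ≡⟨ ∑[]-*ˡ X P? (- 1ℤ) f ⟨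
    - 1ℤ * ∑[ X ∣ P? ] f               ≡⟨ ℤP.-1*i≡-i _ ⟩
    - ∑[ X ∣ P? ] f ∎

  -- Reindexing by `inv` shows that the sum equals its own negative. Fixed points need no separate
  -- treatment.
  ∑[]-antisym : (X : Box A) {P : A → Set} (P? : Decidable P) {f : A → ℤ} (inv : A → A) →
    (∀ x → P x → x ∈ X) → (∀ x → P x → P (inv x)) → (∀ x → inv (inv x) ≡ x) →
    (∀ x → f (inv x) ≡ - f x) → ∑[ X ∣ P? ] f ≡ 0ℤ
  ∑[]-antisym X P? {f} inv P⊆X stable inv² anti = self-neg (trans
    (∑-reindex X X P? P? {h = λ x → - f x} inv inv P⊆X P⊆X
      (λ x p → stable x p , inv² x , trans (sym (ℤP.neg-involutive (f x))) (cong -_ (sym (anti x))))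
      (λ x p → stable x p , inv² x))
    (∑[]-neg X P? f))

  -- The factor q is 4 where the involution acts and in Jacobi's identity, and 1 in the recurrences.
  Ω : ℕ → ℕ → ℤ × ℤ × ℤ → Set
  Ω q M (p , d , e) = 0ℤ < d × 0ℤ < e × p * p + + q * (d * e) ≡ + M

  Ω? : ∀ q M → Decidable (Ω q M)
  Ω? q M (p , d , e) = (0ℤ <? d) ×-dec (0ℤ <? e) ×-dec (p * p + + q * (d * e) ≟ + M)

  Z³ : ℕ → Box (ℤ × ℤ × ℤ)
  Z³ N = Z N ⊗ Z N ⊗ Z N

  Z⁴ : ℕ → Box (ℤ × ℤ × ℤ × ℤ)
  Z⁴ N = Z N ⊗ Z³ N

  ∈-Z³ : ∀ {N x y z} → ∣ x ∣ ℕ.≤ N → ∣ y ∣ ℕ.≤ N → ∣ z ∣ ℕ.≤ N → (x , y , z) ∈ Z³ N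
  ∈-Z³ {N} x≤ y≤ z≤ = ∈-⊗ (Z N) (Z N ⊗ Z N) (∈-Z x≤) (∈-⊗ (Z N) (Z N) (∈-Z y≤) (∈-Z z≤))

  ∈-Z⁴ : ∀ {N x y z w} → ∣ x ∣ ℕ.≤ N → ∣ y ∣ ℕ.≤ N → ∣ z ∣ ℕ.≤ N → ∣ w ∣ ℕ.≤ N → (x , y , z , w) ∈ Z⁴ N
  ∈-Z⁴ {N} x≤ y≤ z≤ w≤ = ∈-⊗ (Z N) (Z³ N) (∈-Z x≤) (∈-Z³ y≤ z≤ w≤)

  Ω-≤ : ∀ q .{{_ : ℕ.NonZero q}} {M p d e} → Ω q M (p , d , e) →
    ∣ p ∣ ℕ.≤ M × ∣ d ∣ ℕ.≤ M × ∣ e ∣ ℕ.≤ M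
  Ω-≤ q {M} {p} {+ suc k} {+ suc l} (_ , _ , eq) =
    below (ℕP.≤-trans (n≤n*n ∣ p ∣) (ℕP.m≤m+n _ _)) ,
    below (ℕP.≤-trans (ℕP.m≤m*n (suc k) (suc l)) kl≤) ,
    below (ℕP.≤-trans (ℕP.m≤n*m (suc l) (suc k)) kl≤)
    where
    kl = suc k ℕ.* suc l
    total : ∣ p ∣ ℕ.* ∣ p ∣ ℕ.+ q ℕ.* kl ≡ M
    total = ℤP.+-injective (trans (cong₂ _+_ (sym (sq≡+ p)) (ℤP.pos-* q kl)) eq)
    below : ∀ {x} → x ℕ.≤ ∣ p ∣ ℕ.* ∣ p ∣ ℕ.+ q ℕ.* kl → x ℕ.≤ M
    below x≤ = ℕP.≤-trans x≤ (ℕP.≤-reflexive total)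
    kl≤ : kl ℕ.≤ ∣ p ∣ ℕ.* ∣ p ∣ ℕ.+ q ℕ.* kl
    kl≤ = ℕP.≤-trans (ℕP.m≤n*m kl q) (ℕP.m≤n+m _ _)
  Ω-≤ q {d = + zero} (+<+ () , _)
  Ω-≤ q {d = + suc k} {+ zero} (_ , +<+ () , _)

  Ω⊆Z³ : ∀ q .{{_ : ℕ.NonZero q}} {M N} → M ℕ.≤ N → ∀ v → Ω q M v → v ∈ Z³ N
  Ω⊆Z³ q M≤N (p , d , e) ω with Ω-≤ q {p = p} ω
  ... | p≤ , d≤ , e≤ = ∈-Z³ (ℕP.≤-trans p≤ M≤N) (ℕP.≤-trans d≤ M≤N) (ℕP.≤-trans e≤ M≤N)

  record Antisymmetric (h : ℤ → ℤ → ℤ → ℤ) : Set where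
    field
      swap₁₂ : ∀ a b c → h b a c ≡ - h a b c
      swap₂₃ : ∀ a b c → h a c b ≡ - h a b c

    swap₁₃ : ∀ a b c → h c b a ≡ - h a b c
    swap₁₃ a b c = begin
      h c b a         ≡⟨ swap₁₂ b c a ⟩
      - h b c a       ≡⟨ cong -_ (swap₂₃ b a c) ⟩
      - - h b a c     ≡⟨ ℤP.neg-involutive _ ⟩
      h b a c         ≡⟨ swap₁₂ a b c ⟩
      - h a b c ∎

  Square : ℕ → ℤ → Set
  Square M s = 0ℤ < s × s * s ≡ + M

  Square? : ∀ M → Decidable (Square M)
  Square? M s = (0ℤ <? s) ×-dec (s * s ≟ + M)

  Between : ℤ → ℤ → Set
  Between s a = 0ℤ < a × a < s

  Between? : ∀ s → Decidable (Between s)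
  Between? s a = (0ℤ <? a) ×-dec (a <? s)

  Square-≤ : ∀ {M N} → M ℕ.≤ N → ∀ s → s * s ≡ + M → ∣ s ∣ ℕ.≤ N
  Square-≤ M≤N s eq = ℕP.≤-trans (n≤n*n ∣ s ∣)
    (ℕP.≤-trans (ℕP.≤-reflexive (ℤP.+-injective (trans (sym (sq≡+ s)) eq))) M≤N)

  Between-≤ : ∀ {s a} → 0ℤ < s → Between s a → ∣ a ∣ ℕ.≤ ∣ s ∣
  Between-≤ {+ _} {+ _} _ (_ , +<+ a<s) = ℕP.<⇒≤ a<s

  ∑-nested : (X : Box A) (Y : Box B) {P : A → Set} {Q : A → B → Set} (P? : Decidable P)
    (Q? : ∀ x → Decidable (Q x)) (f : A × B → ℤ) →
    ∑[ X ⊗ Y ∣ (λ (x , y) → P? x ×-dec Q? x y) ] f ≡ ∑[ X ∣ P? ] (λ x → ∑[ Y ∣ Q? x ] (λ y → f (x , y)))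
  ∑-nested X Y P? Q? f = trans (∑-⊗ X Y _) (∑-cong (Box.elems X) inner)
    where
    inner : ∀ x → ∑ (Box.elems Y) (λ y → when (P? x ×-dec Q? x y) (f (x , y))) ≡
      when (P? x) (∑[ Y ∣ Q? x ] (λ y → f (x , y)))
    inner x with P? x
    ... | yes _ = refl
    ... | no _ = ∑-0 (Box.elems Y) (λ _ → refl)

  -- With (a, b, c) = (d, -e, p + d - e) one has p² + 4de = a² + b² + c² - 2(ab + bc + ca). Exchanging a and c
  -- preserves Ω when c > 0, exchanging b and c preserves it when c < 0, so only c = 0 contributes.
  module Involution {h : ℤ → ℤ → ℤ → ℤ} (anti : Antisymmetric h) {M N : ℕ} (M≤N : M ℕ.≤ N) where
    open Antisymmetric anti

    H : ℤ × ℤ × ℤ → ℤ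
    H (p , d , e) = h d (- e) (p + d - e)

    private
      P? = Ω? 4 M

      Pos Neg : ℤ × ℤ × ℤ → Set
      Pos (p , d , e) = 0ℤ < p + d - e
      Neg (p , d , e) = 0ℤ < e - p - d

      Pos? : Decidable Pos
      Pos? (p , d , e) = 0ℤ <? p + d - e

      Neg? : Decidable Neg
      Neg? (p , d , e) = 0ℤ <? e - p - d

      pos-part : ∑[ Z³ N ∣ (λ v → P? v ×-dec Pos? v) ] H ≡ 0ℤ
      pos-part = ∑[]-antisym (Z³ N) (λ v → P? v ×-dec Pos? v) inv (λ v (ω , _) → Ω⊆Z³ 4 M≤N v ω)
        (λ (p , d , e) ((d>0 , e>0 , eq) , c>0) → (c>0 , e>0 , trans (form p d e) eq) , subst (0ℤ <_) (sym (c′ p d e)) d>0)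
        (λ (p , d , e) → ,₃-cong (p″ p e) (c′ p d e) refl)
        (λ (p , d , e) → trans (cong (h (p + d - e) (- e)) (c′ p d e)) (swap₁₃ d (- e) (p + d - e)))
        where
        inv : ℤ × ℤ × ℤ → ℤ × ℤ × ℤ
        -- The new d is c, and the new p is the one that makes the new c equal to the old d.
        inv (p , d , e) = + 2 * e - p , p + d - e , e
        form : ∀ p d e → (+ 2 * e - p) * (+ 2 * e - p) + + 4 * ((p + d - e) * e) ≡ p * p + + 4 * (d * e)
        form = solve-∀
        c′ : ∀ p d e → + 2 * e - p + (p + d - e) - e ≡ d
        c′ = solve-∀
        p″ : ∀ p e → + 2 * e - (+ 2 * e - p) ≡ p
        p″ = solve-∀

      neg-part : ∑[ Z³ N ∣ (λ v → (P? v ×-dec ¬? (Pos? v)) ×-dec Neg? v) ] H ≡ 0ℤ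
      neg-part = ∑[]-antisym (Z³ N) (λ v → (P? v ×-dec ¬? (Pos? v)) ×-dec Neg? v) inv (λ v ((ω , _) , _) → Ω⊆Z³ 4 M≤N v ω)
        (λ (p , d , e) (((d>0 , e>0 , eq) , _) , c<0) →
          ((d>0 , c<0 , trans (form p d e) eq) ,
            (λ c′>0 → ℤP.<-asym e>0 (subst (_< 0ℤ) (ℤP.neg-involutive e)
              (ℤP.neg-mono-< (subst (0ℤ <_) (c′ p d e) c′>0))))) ,
          subst (0ℤ <_) (sym (e″ p d e)) e>0)
        (λ (p , d , e) → ,₃-cong (p″ p d) refl (e″ p d e))
        (λ (p , d , e) → trans (cong₂ (h d) (b′ p d e) (c′ p d e)) (swap₂₃ d (- e) (p + d - e)))
        where
        inv : ℤ × ℤ × ℤ → ℤ × ℤ × ℤ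
        -- The new e is -c, and the new p makes the new c equal to -e. As this is negative, the
        -- image again lies outside `Pos`.
        inv (p , d , e) = - p - + 2 * d , d , e - p - d
        form : ∀ p d e → (- p - + 2 * d) * (- p - + 2 * d) + + 4 * (d * (e - p - d)) ≡ p * p + + 4 * (d * e)
        form = solve-∀
        b′ : ∀ p d e → - (e - p - d) ≡ p + d - e
        b′ = solve-∀
        c′ : ∀ p d e → - p - + 2 * d + d - (e - p - d) ≡ - e
        c′ = solve-∀
        p″ : ∀ p d → - (- p - + 2 * d) - + 2 * d ≡ p
        p″ = solve-∀
        e″ : ∀ p d e → e - p - d - (- p - + 2 * d) - d ≡ e
        e″ = solve-∀

      zero-part : ∑[ Z³ N ∣ (λ v → (P? v ×-dec ¬? (Pos? v)) ×-dec ¬? (Neg? v)) ] H ≡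
        ∑[ Z N ⊗ Z N ∣ (λ (s , a) → Square? M s ×-dec Between? s a) ] (λ (s , a) → h a (a - s) 0ℤ)
      zero-part = ∑-reindex (Z³ N) (Z N ⊗ Z N)
        (λ v → (P? v ×-dec ¬? (Pos? v)) ×-dec ¬? (Neg? v)) (λ (s , a) → Square? M s ×-dec Between? s a)
        -- For c = 0 one has p = e - d, hence M = (d + e)²: the surviving triples are the splittings
        -- s = d + e of a positive root s of M.
        (λ (p , d , e) → d + e , d) (λ (s , a) → s - + 2 * a , a , s - a)
        (λ v ((ω , _) , _) → Ω⊆Z³ 4 M≤N v ω)
        (λ (s , a) (sq@(s>0 , eq) , bt) → ∈-⊗ (Z N) (Z N) (∈-Z (Square-≤ M≤N s eq))
          (∈-Z (ℕP.≤-trans (Between-≤ s>0 bt) (Square-≤ M≤N s eq))))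
        to
        (λ (s , a) ((s>0 , eq) , a>0 , a<s) →
          (((a>0 , neg-pos a<s , trans (form′ s a) eq) ,
            (λ c>0 → ℤP.<-irrefl refl (subst (0ℤ <_) (c₁ s a) c>0))) ,
            (λ c<0 → ℤP.<-irrefl refl (subst (0ℤ <_) (c₂ s a) c<0))) ,
          cong₂ _,_ (l₃ s a) refl)
        where
        form : ∀ d e → (d + e) * (d + e) ≡ (e - d) * (e - d) + + 4 * (d * e)
        form = solve-∀
        form′ : ∀ s a → (s - + 2 * a) * (s - + 2 * a) + + 4 * (a * (s - a)) ≡ s * s
        form′ = solve-∀
        c₁ : ∀ s a → s - + 2 * a + a - (s - a) ≡ 0ℤ
        c₁ = solve-∀
        c₂ : ∀ s a → s - a - (s - + 2 * a) - a ≡ 0ℤ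
        c₂ = solve-∀
        l₃ : ∀ s a → a + (s - a) ≡ s
        l₃ = solve-∀
        l₄ : ∀ d e → d + e - + 2 * d ≡ e - d
        l₄ = solve-∀
        l₅ : ∀ d e → d + e - d ≡ e
        l₅ = solve-∀
        l₆ : ∀ d e → - e ≡ d - (d + e)
        l₆ = solve-∀
        l₇ : ∀ p d e → p ≡ (p + d - e) + (e - d)
        l₇ = solve-∀
        l₈ : ∀ p d e → - (p + d - e) ≡ e - p - d
        l₈ = solve-∀
        to : ∀ v → (Ω 4 M v × ¬ Pos v) × ¬ Neg v → _
        to (p , d , e) (((d>0 , e>0 , eq) , ¬c>0) , ¬c<0) =
          ((ℤP.+-mono-< d>0 e>0 , trans (form d e) (trans (cong (λ z → z * z + + 4 * (d * e)) (sym p≡)) eq)) ,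
           d>0 , subst (_< d + e) (ℤP.+-identityʳ d) (ℤP.+-monoʳ-< d e>0)) ,
          ,₃-cong (trans (l₄ d e) (sym p≡)) refl (l₅ d e) ,
          cong₂ (h d) (l₆ d e) c≡0
          where
          c≡0 : p + d - e ≡ 0ℤ
          c≡0 with ℤP.<-cmp 0ℤ (p + d - e)
          ... | tri< c>0 _ _ = contradiction c>0 ¬c>0
          ... | tri≈ _ c≡0 _ = sym c≡0
          ... | tri> _ _ c<0 = contradiction (subst (0ℤ <_) (l₈ p d e) (ℤP.neg-mono-< c<0)) ¬c<0
          p≡ : p ≡ e - d
          p≡ = trans (l₇ p d e) (trans (cong (λ z → z + (e - d)) c≡0) (ℤP.+-identityˡ _))

    involution : ∑[ Z³ N ∣ Ω? 4 M ] H ≡ ∑[ Z N ∣ Square? M ] (λ s → ∑[ Z N ∣ Between? s ] (λ a → h a (a - s) 0ℤ))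
    involution = begin
      ∑[ Z³ N ∣ P? ] H
        ≡⟨ ∑-split (Z³ N) P? Pos? H ⟩
      ∑[ Z³ N ∣ (λ v → P? v ×-dec Pos? v) ] H + ∑[ Z³ N ∣ (λ v → P? v ×-dec ¬? (Pos? v)) ] H
        ≡⟨ cong₂ _+_ pos-part (∑-split (Z³ N) (λ v → P? v ×-dec ¬? (Pos? v)) Neg? H) ⟩
      0ℤ + (∑[ Z³ N ∣ (λ v → (P? v ×-dec ¬? (Pos? v)) ×-dec Neg? v) ] H +
            ∑[ Z³ N ∣ (λ v → (P? v ×-dec ¬? (Pos? v)) ×-dec ¬? (Neg? v)) ] H)
        ≡⟨ cong (_+_ 0ℤ) (cong₂ _+_ neg-part zero-part) ⟩
      0ℤ + (0ℤ + ∑[ Z N ⊗ Z N ∣ (λ (s , a) → Square? M s ×-dec Between? s a) ] (λ (s , a) → h a (a - s) 0ℤ))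
        ≡⟨ trans (ℤP.+-identityˡ _) (ℤP.+-identityˡ _) ⟩
      ∑[ Z N ⊗ Z N ∣ (λ (s , a) → Square? M s ×-dec Between? s a) ] (λ (s , a) → h a (a - s) 0ℤ)
        ≡⟨ ∑-nested (Z N) (Z N) (Square? M) Between? _ ⟩
      ∑[ Z N ∣ Square? M ] (λ s → ∑[ Z N ∣ Between? s ] (λ a → h a (a - s) 0ℤ)) ∎

  -- Symmetries of `Ω`, and the passage from p² + 4de to i² + de

  Ω-neg : ∀ q .{{_ : ℕ.NonZero q}} {M N} → M ℕ.≤ N → (f : ℤ × ℤ × ℤ → ℤ) →
    ∑[ Z³ N ∣ Ω? q M ] f ≡ ∑[ Z³ N ∣ Ω? q M ] (λ (p , d , e) → f (- p , d , e))
  Ω-neg q {M} {N} M≤N f = ∑-reindex (Z³ N) (Z³ N) (Ω? q M) (Ω? q M) neg neg (Ω⊆Z³ q M≤N) (Ω⊆Z³ q M≤N)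
    (λ (p , d , e) ω → stable p d e ω , neg² (p , d , e) , cong f (sym (neg² (p , d , e))))
    (λ (p , d , e) ω → stable p d e ω , neg² (p , d , e))
    where
    neg : ℤ × ℤ × ℤ → ℤ × ℤ × ℤ
    neg (p , d , e) = - p , d , e
    neg² : ∀ v → neg (neg v) ≡ v
    neg² (p , d , e) = cong (λ z → z , d , e) (ℤP.neg-involutive p)
    form : ∀ p r → - p * - p + r ≡ p * p + r
    form = solve-∀
    stable : ∀ p d e → Ω q M (p , d , e) → Ω q M (- p , d , e)
    stable p d e (d>0 , e>0 , eq) = d>0 , e>0 , trans (form p _) eq

  Ω-flip : ∀ q .{{_ : ℕ.NonZero q}} {M N} → M ℕ.≤ N → (f : ℤ × ℤ × ℤ → ℤ) →
    ∑[ Z³ N ∣ Ω? q M ] f ≡ ∑[ Z³ N ∣ Ω? q M ] (λ (p , d , e) → f (p , e , d))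
  Ω-flip q {M} {N} M≤N f = ∑-reindex (Z³ N) (Z³ N) (Ω? q M) (Ω? q M) flip flip (Ω⊆Z³ q M≤N) (Ω⊆Z³ q M≤N)
    (λ (p , d , e) ω → stable p d e ω , refl , refl)
    (λ (p , d , e) ω → stable p d e ω , refl)
    where
    flip : ℤ × ℤ × ℤ → ℤ × ℤ × ℤ
    flip (p , d , e) = p , e , d
    stable : ∀ p d e → Ω q M (p , d , e) → Ω q M (p , e , d)
    stable p d e (d>0 , e>0 , eq) = e>0 , d>0 , trans (cong (λ z → p * p + + q * z) (ℤP.*-comm e d)) eq

  -- A total function, as the maps in `∑-reindex` have to be; `half-2*` and `2*half` tie it to even
  -- arguments.
  half : ℤ → ℤ
  half x with parity x
  ... | inj₁ (k , _) = k
  ... | inj₂ (k , _) = k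

  half-2* : ∀ k → half (+ 2 * k) ≡ k
  half-2* k with parity (+ 2 * k)
  ... | inj₁ (j , eq) = sym (ℤP.*-cancelˡ-≡ (+ 2) k j eq)
  ... | inj₂ (j , eq) = contradiction eq (2k≢2j+1 {k} {j})

  2*half : ∀ {x} → (∃ λ k → x ≡ + 2 * k) → + 2 * half x ≡ x
  2*half (k , refl) = cong (_*_ (+ 2)) (half-2* k)

  even-root : ∀ x r → x * x ≡ + 2 * r → ∃ λ k → x ≡ + 2 * k
  even-root x r eq with parity x
  ... | inj₁ even = even
  ... | inj₂ (k , refl) = contradiction (trans (sym eq) (l k)) (2k≢2j+1 {r} {+ 2 * (k * k + k)})
    where
    l : ∀ k → (+ 2 * k + 1ℤ) * (+ 2 * k + 1ℤ) ≡ + 2 * (+ 2 * (k * k + k)) + 1ℤ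
    l = solve-∀

  4*-cancel : ∀ {x n} → + 4 * x ≡ + (4 ℕ.* n) → x ≡ + n
  4*-cancel {x} {n} eq = ℤP.*-cancelˡ-≡ (+ 4) x (+ n) (trans eq (ℤP.pos-* 4 n))

  2*-pos : ∀ {x} → 0ℤ < x → 0ℤ < + 2 * x
  2*-pos {+ suc n} _ = +<+ (ℕ.s≤s ℕ.z≤n)
  2*-pos {+ zero} (+<+ ())

  2*-pos⁻¹ : ∀ {x} → 0ℤ < + 2 * x → 0ℤ < x
  2*-pos⁻¹ {+ suc n} _ = +<+ (ℕ.s≤s ℕ.z≤n)
  2*-pos⁻¹ {+ zero} (+<+ ())

  module _ {h : ℤ → ℤ → ℤ → ℤ} (anti : Antisymmetric h) {n N : ℕ} (4n≤N : 4 ℕ.* n ℕ.≤ N) where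
    private
      n≤N : n ℕ.≤ N
      n≤N = ℕP.≤-trans (ℕP.m≤n*m n 4) 4n≤N

      to-Ω₄ : ∀ {i d e} → Ω 1 n (i , d , e) → Ω 4 (4 ℕ.* n) (+ 2 * i , d , e)
      to-Ω₄ {i} {d} {e} (d>0 , e>0 , eq) =
        d>0 , e>0 , trans (form i d e) (trans (cong (_*_ (+ 4)) eq) (sym (ℤP.pos-* 4 n)))
        where
        form : ∀ i d e → (+ 2 * i) * (+ 2 * i) + + 4 * (d * e) ≡ + 4 * (i * i + + 1 * (d * e))
        form = solve-∀

      even-p : ∀ {p d e} → Ω 4 (4 ℕ.* n) (p , d , e) → + 2 * half p ≡ p
      even-p {p} {d} {e} (_ , _ , eq) = 2*half (even-root p (+ 2 * (+ n - d * e)) (begin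
        p * p                                       ≡⟨ l₁ (p * p) (d * e) ⟩
        p * p + + 4 * (d * e) - + 4 * (d * e)       ≡⟨ cong (λ z → z - + 4 * (d * e)) eq ⟩
        + (4 ℕ.* n) - + 4 * (d * e)                 ≡⟨ cong (λ z → z - + 4 * (d * e)) (ℤP.pos-* 4 n) ⟩
        + 4 * + n - + 4 * (d * e)                   ≡⟨ l₂ (+ n) (d * e) ⟩
        + 2 * (+ 2 * (+ n - d * e)) ∎))
        where
        l₁ : ∀ a b → a ≡ a + + 4 * b - + 4 * b
        l₁ = solve-∀
        l₂ : ∀ a b → + 4 * a - + 4 * b ≡ + 2 * (+ 2 * (a - b))
        l₂ = solve-∀

      from-Ω₄ : ∀ {p d e} → Ω 4 (4 ℕ.* n) (p , d , e) → Ω 1 n (half p , d , e)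
      from-Ω₄ {p} {d} {e} ω@(d>0 , e>0 , eq) = d>0 , e>0 , 4*-cancel (begin
        + 4 * (half p * half p + + 1 * (d * e))           ≡⟨ form (half p) d e ⟩
        (+ 2 * half p) * (+ 2 * half p) + + 4 * (d * e)
          ≡⟨ cong (λ z → z * z + + 4 * (d * e)) (even-p {p} {d} {e} ω) ⟩
        p * p + + 4 * (d * e)                             ≡⟨ eq ⟩
        + (4 ℕ.* n) ∎)
        where
        form : ∀ i d e → + 4 * (i * i + + 1 * (d * e)) ≡ (+ 2 * i) * (+ 2 * i) + + 4 * (d * e)
        form = solve-∀

      even-s : ∀ {s} → s * s ≡ + (4 ℕ.* n) → + 2 * half s ≡ s
      even-s {s} eq = 2*half (even-root s (+ 2 * + n) (trans eq (trans (ℤP.pos-* 4 n) (l (+ n)))))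
        where
        l : ∀ a → + 4 * a ≡ + 2 * (+ 2 * a)
        l = solve-∀

      l-sq : ∀ s → (+ 2 * s) * (+ 2 * s) ≡ + 4 * (s * s)
      l-sq = solve-∀

      inner : ℤ → ℤ
      inner s = ∑[ Z N ∣ Between? s ] (λ a → h a (a - s) 0ℤ)

    -- The equations p² = 4(n - de) and s² = 4n force p and s to be even, so doubling is a bijection
    -- on both sides of the identity for 4n.
    involution₁ : ∑[ Z³ N ∣ Ω? 1 n ] (λ (i , d , e) → h d (- e) (+ 2 * i + d - e)) ≡
      ∑[ Z N ∣ Square? n ] (λ s → ∑[ Z N ∣ Between? (+ 2 * s) ] (λ a → h a (a - + 2 * s) 0ℤ))
    involution₁ = begin
      ∑[ Z³ N ∣ Ω? 1 n ] (λ (i , d , e) → h d (- e) (+ 2 * i + d - e))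
        ≡⟨ ∑-reindex (Z³ N) (Z³ N) (Ω? 1 n) (Ω? 4 (4 ℕ.* n))
             (λ (i , d , e) → + 2 * i , d , e) (λ (p , d , e) → half p , d , e)
             (Ω⊆Z³ 1 n≤N) (Ω⊆Z³ 4 4n≤N)
             (λ (i , d , e) ω → to-Ω₄ {i} {d} {e} ω , cong (λ z → z , d , e) (half-2* i) , refl)
             (λ (p , d , e) ω → from-Ω₄ {p} {d} {e} ω , cong (λ z → z , d , e) (even-p {p} {d} {e} ω)) ⟩
      ∑[ Z³ N ∣ Ω? 4 (4 ℕ.* n) ] (Involution.H anti 4n≤N)
        ≡⟨ Involution.involution anti 4n≤N ⟩
      ∑[ Z N ∣ Square? (4 ℕ.* n) ] inner
        ≡⟨ ∑-reindex (Z N) (Z N) (Square? (4 ℕ.* n)) (Square? n) half (_*_ (+ 2))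
             (λ s (_ , eq) → ∈-Z (Square-≤ 4n≤N s eq)) (λ s (_ , eq) → ∈-Z (Square-≤ n≤N s eq))
             (λ s (s>0 , eq) → (2*-pos⁻¹ (subst (0ℤ <_) (sym (even-s {s} eq)) s>0) ,
                4*-cancel (trans (sym (l-sq (half s))) (trans (cong (λ z → z * z) (even-s {s} eq)) eq))) ,
                even-s {s} eq , cong inner (sym (even-s {s} eq)))
             (λ s (s>0 , eq) → (2*-pos s>0 , trans (l-sq s) (trans (cong (_*_ (+ 4)) eq) (sym (ℤP.pos-* 4 n)))) ,
                half-2* s) ⟩
      ∑[ Z N ∣ Square? n ] (λ s → inner (+ 2 * s)) ∎

  -- Closed forms for the sums on the plane c = 0

  ∑<-cong-< : ∀ k {f g : ℕ → ℤ} → (∀ j → j ℕ.< k → f j ≡ g j) → ∑< k f ≡ ∑< k g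
  ∑<-cong-< zero eq = refl
  ∑<-cong-< (suc k) eq = cong₂ _+_ (eq 0 (ℕ.s≤s ℕ.z≤n)) (∑<-cong-< k (λ j j<k → eq (suc j) (ℕ.s≤s j<k)))

  -- The condition at 0 lets the sum over 0 < a < k start at j = 0, as telescoping wants it.
  ∑-Between : ∀ {N k} → k ℕ.≤ N → (f : ℤ → ℤ) → f 0ℤ ≡ 0ℤ →
    ∑[ Z N ∣ Between? (+ k) ] f ≡ ∑< k (λ j → f (+ j))
  ∑-Between {N} {k} k≤N f f0 = begin
    ∑[ Z N ∣ Between? (+ k) ] f
      ≡⟨ ∑-reindex (Z N) Y (Between? (+ k)) (λ j → Between? (+ k) (+ j)) ∣_∣ +_
           (λ a bt → ∈-Z (ℕP.≤-trans (a≤k bt) k≤N))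
           (λ j (_ , j<k) g g0 → trans (∑-applyUpTo id k g) (∑<-δ (ℤP.drop‿+<+ j<k) g0))
           (λ a bt → subst (Between (+ k)) (abs bt) bt , sym (abs bt) , cong f (abs bt))
           (λ j bt → bt , refl) ⟩
    ∑ (upTo k) (λ j → when (Between? (+ k) (+ j)) (f (+ j)))
      ≡⟨ ∑-applyUpTo id k _ ⟩
    ∑< k (λ j → when (Between? (+ k) (+ j)) (f (+ j)))
      ≡⟨ ∑<-cong-< k drop ⟩
    ∑< k (λ j → f (+ j)) ∎
    where
    Y : Box ℕ
    Y = box (upTo k) ℕ._≟_
    abs : ∀ {a} → Between (+ k) a → a ≡ + ∣ a ∣
    abs {+ _} _ = refl
    a≤k : ∀ {a} → Between (+ k) a → ∣ a ∣ ℕ.≤ k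
    a≤k {+ _} (_ , +<+ a<k) = ℕP.<⇒≤ a<k
    drop : ∀ j → j ℕ.< k → when (Between? (+ k) (+ j)) (f (+ j)) ≡ f (+ j)
    drop zero _ = sym f0
    drop (suc j) j<k = when-yes (Between? (+ k) (+ suc j)) (+<+ (ℕ.s≤s ℕ.z≤n) , +<+ j<k)

  -- The constant c clears the denominators 2 and 4 that partial sums of κ, χ and sgn carry, so the
  -- closed form F stays integral.
  ∑<-telescope : ∀ c (f F : ℕ → ℤ) → F 0 ≡ 0ℤ → (∀ k → F k + c * f k ≡ F (suc k)) →
    ∀ k → c * ∑< k f ≡ F k
  ∑<-telescope c f F F0 step zero = trans (ℤP.*-zeroʳ c) (sym F0)
  ∑<-telescope c f F F0 step (suc k) = begin
    c * ∑< (suc k) f           ≡⟨ cong (_*_ c) (∑<-last k f) ⟩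
    c * (∑< k f + f k)         ≡⟨ ℤP.*-distribˡ-+ c (∑< k f) (f k) ⟩
    c * ∑< k f + c * f k       ≡⟨ cong (λ z → z + c * f k) (∑<-telescope c f F F0 step k) ⟩
    F k + c * f k              ≡⟨ step k ⟩
    F (suc k) ∎

  sgn-suc : ∀ x → sgn (1ℤ + x) ≡ - sgn x
  sgn-suc x = trans (sgn-+ 1ℤ x) (ℤP.-1*i≡-i (sgn x))

  sgn-neg : ∀ x → sgn (- x) ≡ sgn x
  sgn-neg x = trans (cong κ (l x)) (κ-neg (+ 2 * x))
    where
    l : ∀ x → + 2 * - x ≡ - (+ 2 * x)
    l = solve-∀

  ev-neg : ∀ x → ev (- x) ≡ ev x
  ev-neg x = cong (λ k → k * k) (κ-neg x)

  ev-2*-+ : ∀ x y → ev (+ 2 * x + y) ≡ ev y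
  ev-2*-+ x y = begin
    ev (+ 2 * x + y)                      ≡⟨ cong (λ k → k * k) (κ-2*-+ x y) ⟩
    sgn x * κ y * (sgn x * κ y)           ≡⟨ l₁ (sgn x) (κ y) ⟩
    sgn x * sgn x * ev y                  ≡⟨ cong (λ z → z * ev y) (sgn²≡1 x) ⟩
    1ℤ * ev y                             ≡⟨ ℤP.*-identityˡ (ev y) ⟩
    ev y ∎
    where
    l₁ : ∀ s k → s * k * (s * k) ≡ s * s * (k * k)
    l₁ = solve-∀

  ev-idem : ∀ x → ev x * ev x ≡ ev x
  ev-idem x with parity x
  ... | inj₁ (k , refl) = trans (cong (λ z → z * z) (ev-2* k)) (sym (ev-2* k))
  ... | inj₂ (k , refl) = trans (cong (λ z → z * z) (ev-odd k)) (sym (ev-odd k))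

  ev-minus : ∀ x y → ev x * ev y * ev (x - y) ≡ ev x * ev y
  ev-minus x y with parity x
  ... | inj₁ (k , refl) = trans (cong (_*_ (ev (+ 2 * k) * ev y)) (trans (ev-2*-+ k (- y)) (ev-neg y)))
    (trans (ℤP.*-assoc (ev (+ 2 * k)) (ev y) (ev y)) (cong (_*_ (ev (+ 2 * k))) (ev-idem y)))
  ... | inj₂ (k , refl) = trans (cong (λ z → z * ev y * ev (+ 2 * k + 1ℤ - y)) (ev-odd k))
    (sym (cong (λ z → z * ev y) (ev-odd k)))

  -- Exchanging the two zeros fixes the arguments and reverses the sign. This supplies the value at
  -- 0 required by `∑-Between`.
  h-0b0 : ∀ {h} → Antisymmetric h → ∀ b → h 0ℤ b 0ℤ ≡ 0ℤ
  h-0b0 anti b = self-neg (Antisymmetric.swap₁₃ anti 0ℤ b 0ℤ)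

  +double : ∀ s → + 2 * + s ≡ + (s ℕ.+ s)
  +double s = l (+ s)
    where
    l : ∀ s → + 2 * s ≡ s + s
    l = solve-∀

  -- Only the part of h(d, -e, 2i + d - e) that is even in i and symmetric in d, e contributes.
  Ω₁-sum : ∀ {h} (anti : Antisymmetric h) (c : ℤ) .{{_ : NonZero c}} (g : ℤ → ℤ → ℤ → ℤ) →
    (∀ i d e → h d (- e) (+ 2 * i + d - e) + h d (- e) (+ 2 * - i + d - e) ≡ + 2 * c * (g i d e + g i e d)) →
    (∀ s → ∑< (s ℕ.+ s) (λ j → h (+ j) (+ j - + 2 * + s) 0ℤ) ≡ + 2 * c * (+ s * + s)) →
    ∀ {n N} → 4 ℕ.* n ℕ.≤ N →
    ∑[ Z³ N ∣ Ω? 1 n ] (λ (i , d , e) → g i d e) ≡ ∑[ Z N ∣ Square? n ] (λ s → s * s)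
  Ω₁-sum {h} anti c g symm inner {n} {N} 4n≤N =
    -- The 4 is a 2 from the symmetrisation, i with -i on one side and d with e on the other, times
    -- the 2 in the normalisation `2 * c` of both hypotheses.
    ℤP.*-cancelˡ-≡ c G R (ℤP.*-cancelˡ-≡ (+ 4) (c * G) (c * R) (begin
      + 4 * (c * G)                ≡⟨ l₁ c G ⟩
      + 2 * c * (G + G)            ≡⟨ cong (λ z → + 2 * c * (G + z)) (Ω-flip 1 n≤N g′) ⟩
      + 2 * c * (G + ∑[ Z³ N ∣ Ω? 1 n ] (λ (i , d , e) → g i e d))
        ≡⟨ cong (_*_ (+ 2 * c)) (∑[]-+ (Z³ N) (Ω? 1 n) g′ (λ (i , d , e) → g i e d)) ⟨
      + 2 * c * ∑[ Z³ N ∣ Ω? 1 n ] (λ (i , d , e) → g i d e + g i e d)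
        ≡⟨ ∑[]-*ˡ (Z³ N) (Ω? 1 n) (+ 2 * c) _ ⟩
      ∑[ Z³ N ∣ Ω? 1 n ] (λ (i , d , e) → + 2 * c * (g i d e + g i e d))
        ≡⟨ ∑[]-map (Z³ N) (Ω? 1 n) (λ (i , d , e) _ → symm i d e) ⟨
      ∑[ Z³ N ∣ Ω? 1 n ] (λ (i , d , e) → H (i , d , e) + H (- i , d , e))
        ≡⟨ ∑[]-+ (Z³ N) (Ω? 1 n) H _ ⟩
      S + ∑[ Z³ N ∣ Ω? 1 n ] (λ (i , d , e) → H (- i , d , e))
        ≡⟨ cong (_+_ S) (Ω-neg 1 n≤N H) ⟨
      S + S                        ≡⟨ cong₂ _+_ S≡ S≡ ⟩
      + 2 * c * R + + 2 * c * R    ≡⟨ l₂ c R ⟩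
      + 4 * (c * R) ∎))
    where
    n≤N : n ℕ.≤ N
    n≤N = ℕP.≤-trans (ℕP.m≤n*m n 4) 4n≤N
    g′ H : ℤ × ℤ × ℤ → ℤ
    g′ (i , d , e) = g i d e
    H (i , d , e) = h d (- e) (+ 2 * i + d - e)
    G R S : ℤ
    G = ∑[ Z³ N ∣ Ω? 1 n ] (λ (i , d , e) → g i d e)
    R = ∑[ Z N ∣ Square? n ] (λ s → s * s)
    S = ∑[ Z³ N ∣ Ω? 1 n ] H
    l₁ : ∀ c G → + 4 * (c * G) ≡ + 2 * c * (G + G)
    l₁ = solve-∀
    l₂ : ∀ c R → + 2 * c * R + + 2 * c * R ≡ + 4 * (c * R)
    l₂ = solve-∀
    column : ∀ s → Square n s → ∑[ Z N ∣ Between? (+ 2 * s) ] (λ a → h a (a - + 2 * s) 0ℤ) ≡ + 2 * c * (s * s)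
    column (+ s) (_ , eq) = begin
      ∑[ Z N ∣ Between? (+ 2 * + s) ] f
        ≡⟨ cong (λ z → ∑[ Z N ∣ Between? z ] f) (+double s) ⟩
      ∑[ Z N ∣ Between? (+ (s ℕ.+ s)) ] f
        ≡⟨ ∑-Between 2s≤N f (h-0b0 anti (0ℤ - + 2 * + s)) ⟩
      ∑< (s ℕ.+ s) (λ j → f (+ j))
        ≡⟨ inner s ⟩
      + 2 * c * (+ s * + s) ∎
      where
      f : ℤ → ℤ
      f a = h a (a - + 2 * + s) 0ℤ
      s≤n : s ℕ.≤ n
      s≤n = Square-≤ ℕP.≤-refl (+ s) eq
      2s≤N : s ℕ.+ s ℕ.≤ N
      2s≤N = ℕP.≤-trans (ℕP.+-mono-≤ s≤n (ℕP.≤-trans s≤n (ℕP.m≤m+n n _))) 4n≤N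
    S≡ : S ≡ + 2 * c * R
    S≡ = trans (involution₁ anti 4n≤N)
      (trans (∑[]-map (Z N) (Square? n) column) (sym (∑[]-*ˡ (Z N) (Square? n) (+ 2 * c) (λ s → s * s))))

  -- At (d, -e, 2i + d - e) the coefficients of χ d and χ e both have the part 2(de - 2i²) even in
  -- i. The coefficient -2i(d + e) of χ c is odd in i while χ c = (-1)ⁱ χ (d - e) is even, so the
  -- third term cancels between i and -i.
  h₂ : ℤ → ℤ → ℤ → ℤ
  h₂ a b c = χ a * ((b - c) * (b + c - a)) + χ b * ((c - a) * (c + a - b)) + χ c * ((a - b) * (a + b - c))

  h₂-anti : Antisymmetric h₂
  h₂-anti = record
    { swap₁₂ = λ a b c → l₁ a b c (χ a) (χ b) (χ c)
    ; swap₂₃ = λ a b c → l₂ a b c (χ a) (χ b) (χ c)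
    }
    where
    l₁ : ∀ a b c x y z →
      y * ((a - c) * (a + c - b)) + x * ((c - b) * (c + b - a)) + z * ((b - a) * (b + a - c)) ≡
      - (x * ((b - c) * (b + c - a)) + y * ((c - a) * (c + a - b)) + z * ((a - b) * (a + b - c)))
    l₁ = solve-∀
    l₂ : ∀ a b c x y z →
      x * ((c - b) * (c + b - a)) + z * ((b - a) * (b + a - c)) + y * ((a - c) * (a + c - b)) ≡
      - (x * ((b - c) * (b + c - a)) + y * ((c - a) * (c + a - b)) + z * ((a - b) * (a + b - c)))
    l₂ = solve-∀

  ∑χ-squares : ∀ {n N} → 4 ℕ.* n ℕ.≤ N →
    ∑[ Z³ N ∣ Ω? 1 n ] (λ (i , d , e) → χ d * (d * e - + 2 * (i * i))) ≡ ∑[ Z N ∣ Square? n ] (λ s → s * s)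
  ∑χ-squares = Ω₁-sum h₂-anti (+ 2) (λ i d e → χ d * (d * e - + 2 * (i * i))) symm inner
    where
    symm : ∀ i d e → h₂ d (- e) (+ 2 * i + d - e) + h₂ d (- e) (+ 2 * - i + d - e) ≡
      + 4 * (χ d * (d * e - + 2 * (i * i)) + χ e * (e * d - + 2 * (i * i)))
    symm i d e = begin
      h₂ d (- e) (+ 2 * i + d - e) + h₂ d (- e) (+ 2 * - i + d - e)
        ≡⟨ cong₂ _+_
             (cong₂ (λ y z → χ d * A₀ i + y * B₀ i + z * C₀ i) (χ-neg e) (χ-c i))
             (cong₂ (λ y z → χ d * A₀ (- i) + y * B₀ (- i) + z * C₀ (- i)) (χ-neg e)
               (trans (χ-c (- i)) (cong (λ s → s * χ (d - e)) (sgn-neg i)))) ⟩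
      (χ d * A₀ i + - χ e * B₀ i + sgn i * χ (d - e) * C₀ i) +
      (χ d * A₀ (- i) + - χ e * B₀ (- i) + sgn i * χ (d - e) * C₀ (- i))
        ≡⟨ l i d e (χ d) (χ e) (sgn i * χ (d - e)) ⟩
      + 4 * (χ d * (d * e - + 2 * (i * i)) + χ e * (e * d - + 2 * (i * i))) ∎
      where
      A₀ B₀ C₀ : ℤ → ℤ
      A₀ i = (- e - (+ 2 * i + d - e)) * (- e + (+ 2 * i + d - e) - d)
      B₀ i = ((+ 2 * i + d - e) - d) * ((+ 2 * i + d - e) + d - - e)
      C₀ i = (d - - e) * (d + - e - (+ 2 * i + d - e))
      χ-c : ∀ i → χ (+ 2 * i + d - e) ≡ sgn i * χ (d - e)
      χ-c i = trans (cong χ (ℤP.+-assoc (+ 2 * i) d (- e))) (χ-2*-+ i (d - e))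
      l : ∀ i d e x y z →
        (x * ((- e - (+ 2 * i + d - e)) * (- e + (+ 2 * i + d - e) - d)) +
         - y * (((+ 2 * i + d - e) - d) * ((+ 2 * i + d - e) + d - - e)) +
         z * ((d - - e) * (d + - e - (+ 2 * i + d - e)))) +
        (x * ((- e - (+ 2 * - i + d - e)) * (- e + (+ 2 * - i + d - e) - d)) +
         - y * (((+ 2 * - i + d - e) - d) * ((+ 2 * - i + d - e) + d - - e)) +
         z * ((d - - e) * (d + - e - (+ 2 * - i + d - e)))) ≡
        + 4 * (x * (d * e - + 2 * (i * i)) + y * (e * d - + 2 * (i * i)))
      l = solve-∀
    inner : ∀ s → ∑< (s ℕ.+ s) (λ j → h₂ (+ j) (+ j - + 2 * + s) 0ℤ) ≡ + 4 * (+ s * + s)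
    inner s = begin
      ∑< (s ℕ.+ s) (λ j → h₂ (+ j) (+ j - + 2 * + s) 0ℤ)
        ≡⟨ ∑<-cong (s ℕ.+ s) (λ j → trans
             (cong (λ y → χ (+ j) * ((+ j - K - 0ℤ) * (+ j - K + 0ℤ - + j)) +
                          y * ((0ℤ - + j) * (0ℤ + + j - (+ j - K))) + 0ℤ * ((+ j - (+ j - K)) * (+ j + (+ j - K) - 0ℤ)))
                   (χ-shift (+ j)))
             (l₁ (χ (+ j)) (sgn (+ s)) (+ j) K)) ⟩
      ∑< (s ℕ.+ s) (λ j → K * (χ (+ j) * (K - + j - sgn (+ s) * + j)))
        ≡⟨ ∑<-*ˡ (s ℕ.+ s) K _ ⟨
      K * ∑< (s ℕ.+ s) (λ j → χ (+ j) * (K - + j - sgn (+ s) * + j))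
        ≡⟨ l₂ (+ s) _ ⟩
      + s * (+ 2 * ∑< (s ℕ.+ s) (λ j → χ (+ j) * (K - + j - sgn (+ s) * + j)))
        ≡⟨ cong (_*_ (+ s)) (∑<-telescope (+ 2) _ F (F0 K (sgn (+ s))) step (s ℕ.+ s)) ⟩
      + s * F (s ℕ.+ s)
        ≡⟨ cong (λ z → + s * (K * (1ℤ - κ z - χ z) - (1ℤ + sgn (+ s)) * (χ z - z * (κ z + χ z)))) (+double s) ⟨
      + s * (K * (1ℤ - sgn (+ s) - χ K) - (1ℤ + sgn (+ s)) * (χ K - K * (sgn (+ s) + χ K)))
        ≡⟨ cong (λ c → + s * (K * (1ℤ - sgn (+ s) - c) - (1ℤ + sgn (+ s)) * (c - K * (sgn (+ s) + c)))) (χ-2* (+ s)) ⟩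
      + s * (K * (1ℤ - sgn (+ s) - 0ℤ) - (1ℤ + sgn (+ s)) * (0ℤ - K * (sgn (+ s) + 0ℤ)))
        ≡⟨ l₄ (+ s) (sgn (+ s)) ⟩
      + 2 * (+ s * + s) * (1ℤ + sgn (+ s) * sgn (+ s))
        ≡⟨ cong (λ z → + 2 * (+ s * + s) * (1ℤ + z)) (sgn²≡1 (+ s)) ⟩
      + 2 * (+ s * + s) * + 2
        ≡⟨ l₅ (+ s) ⟩
      + 4 * (+ s * + s) ∎
      where
      K : ℤ
      K = + 2 * + s
      χ-shift : ∀ j → χ (j - K) ≡ sgn (+ s) * χ j
      χ-shift j = trans (cong χ (l j (+ s))) (trans (χ-2*-+ (- + s) j) (cong (λ z → z * χ j) (sgn-neg (+ s))))
        where
        l : ∀ j s → j - + 2 * s ≡ + 2 * - s + j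
        l = solve-∀
      l₁ : ∀ x t j K → x * ((j - K - 0ℤ) * (j - K + 0ℤ - j)) + t * x * ((0ℤ - j) * (0ℤ + j - (j - K))) +
        0ℤ * ((j - (j - K)) * (j + (j - K) - 0ℤ)) ≡ K * (x * (K - j - t * j))
      l₁ = solve-∀
      l₂ : ∀ s x → + 2 * s * x ≡ s * (+ 2 * x)
      l₂ = solve-∀
      -- Over j < k, twice the sum of χ j is 1 - κ k - χ k, and twice the sum of j χ j is χ k - k(κ
      -- k + χ k).
      F : ℕ → ℤ
      F k = K * (1ℤ - κ (+ k) - χ (+ k)) - (1ℤ + sgn (+ s)) * (χ (+ k) - + k * (κ (+ k) + χ (+ k)))
      F0 : ∀ K t → K * (1ℤ - 1ℤ - 0ℤ) - (1ℤ + t) * (0ℤ - 0ℤ * (1ℤ + 0ℤ)) ≡ 0ℤ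
      F0 = solve-∀
      step : ∀ k → F k + + 2 * (χ (+ k) * (K - + k - sgn (+ s) * + k)) ≡ F (suc k)
      step k = l₃ K (sgn (+ s)) (+ k) (κ (+ k)) (χ (+ k))
        where
        l₃ : ∀ K t j c x → K * (1ℤ - c - x) - (1ℤ + t) * (x - j * (c + x)) + + 2 * (x * (K - j - t * j)) ≡
          K * (1ℤ - - x - c) - (1ℤ + t) * (c - (1ℤ + j) * (- x + c))
        l₃ = solve-∀
      l₄ : ∀ s t → s * (+ 2 * s * (1ℤ - t - 0ℤ) - (1ℤ + t) * (0ℤ - + 2 * s * (t + 0ℤ))) ≡
        + 2 * (s * s) * (1ℤ + t * t)
      l₄ = solve-∀
      l₅ : ∀ s → + 2 * (s * s) * + 2 ≡ + 4 * (s * s)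
      l₅ = solve-∀

  -- A Vandermonde product times a symmetric weight. At (d, -e, 2i + d - e) the part of the product
  -- even in i is (d + e)(de - 4i²), which splits into a d-term and an e-term. As c ≡ d - e mod 2,
  -- the weight is 1 - 2 `ev d` `ev e`.
  h₄ : ℤ → ℤ → ℤ → ℤ
  h₄ a b c = (a - b) * (b - c) * (c - a) * (1ℤ - + 2 * (ev a * ev b * ev c))

  h₄-anti : Antisymmetric h₄
  h₄-anti = record
    { swap₁₂ = λ a b c → l₁ a b c (ev a) (ev b) (ev c)
    ; swap₂₃ = λ a b c → l₂ a b c (ev a) (ev b) (ev c)
    }
    where
    l₁ : ∀ a b c x y z → (b - a) * (a - c) * (c - b) * (1ℤ - + 2 * (y * x * z)) ≡
      - ((a - b) * (b - c) * (c - a) * (1ℤ - + 2 * (x * y * z)))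
    l₁ = solve-∀
    l₂ : ∀ a b c x y z → (a - c) * (c - b) * (b - a) * (1ℤ - + 2 * (x * z * y)) ≡
      - ((a - b) * (b - c) * (c - a) * (1ℤ - + 2 * (x * y * z)))
    l₂ = solve-∀

  ∑d-squares : ∀ {n N} → 4 ℕ.* n ℕ.≤ N →
    ∑[ Z³ N ∣ Ω? 1 n ] (λ (i , d , e) → d * (1ℤ - + 2 * (ev d * ev e)) * (d * e - + 4 * (i * i))) ≡
    ∑[ Z N ∣ Square? n ] (λ s → s * s)
  ∑d-squares = Ω₁-sum h₄-anti 1ℤ (λ i d e → d * (1ℤ - + 2 * (ev d * ev e)) * (d * e - + 4 * (i * i))) symm inner
    where
    symm : ∀ i d e → h₄ d (- e) (+ 2 * i + d - e) + h₄ d (- e) (+ 2 * - i + d - e) ≡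
      + 2 * (d * (1ℤ - + 2 * (ev d * ev e)) * (d * e - + 4 * (i * i)) +
             e * (1ℤ - + 2 * (ev e * ev d)) * (e * d - + 4 * (i * i)))
    symm i d e = begin
      h₄ d (- e) (+ 2 * i + d - e) + h₄ d (- e) (+ 2 * - i + d - e)
        ≡⟨ cong₂ (λ x y → V i * (1ℤ - + 2 * x) + V (- i) * (1ℤ - + 2 * y)) (evs i) (evs (- i)) ⟩
      V i * (1ℤ - + 2 * (ev d * ev e)) + V (- i) * (1ℤ - + 2 * (ev d * ev e))
        ≡⟨ l i d e (ev d) (ev e) ⟩
      + 2 * (d * (1ℤ - + 2 * (ev d * ev e)) * (d * e - + 4 * (i * i)) +
             e * (1ℤ - + 2 * (ev e * ev d)) * (e * d - + 4 * (i * i))) ∎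
      where
      V : ℤ → ℤ
      V i = (d - - e) * (- e - (+ 2 * i + d - e)) * ((+ 2 * i + d - e) - d)
      evs : ∀ i → ev d * ev (- e) * ev (+ 2 * i + d - e) ≡ ev d * ev e
      evs i = trans (cong₂ (λ x y → ev d * x * y) (ev-neg e)
          (trans (cong ev (ℤP.+-assoc (+ 2 * i) d (- e))) (ev-2*-+ i (d - e))))
        (ev-minus d e)
      l : ∀ i d e x y →
        (d - - e) * (- e - (+ 2 * i + d - e)) * ((+ 2 * i + d - e) - d) * (1ℤ - + 2 * (x * y)) +
        (d - - e) * (- e - (+ 2 * - i + d - e)) * ((+ 2 * - i + d - e) - d) * (1ℤ - + 2 * (x * y)) ≡
        + 2 * (d * (1ℤ - + 2 * (x * y)) * (d * e - + 4 * (i * i)) + e * (1ℤ - + 2 * (y * x)) * (e * d - + 4 * (i * i)))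
      l = solve-∀
    inner : ∀ s → ∑< (s ℕ.+ s) (λ j → h₄ (+ j) (+ j - + 2 * + s) 0ℤ) ≡ + 2 * (+ s * + s)
    inner s = begin
      ∑< (s ℕ.+ s) (λ j → h₄ (+ j) (+ j - + 2 * + s) 0ℤ)
        ≡⟨ ∑<-cong (s ℕ.+ s) (λ j → trans (cong (λ x → (+ j - (+ j - K)) * (+ j - K - 0ℤ) * (0ℤ - + j) * x) (weight (+ j)))
             (l₁ (+ j) K (sgn (+ j)))) ⟩
      ∑< (s ℕ.+ s) (λ j → K * (- sgn (+ j) * + j * (K - + j)))
        ≡⟨ ∑<-*ˡ (s ℕ.+ s) K _ ⟨
      K * ∑< (s ℕ.+ s) (λ j → - sgn (+ j) * + j * (K - + j))
        ≡⟨ cong (_*_ K) (ℤP.*-cancelˡ-≡ (+ 4) _ (+ s) (begin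
             + 4 * ∑< (s ℕ.+ s) (λ j → - sgn (+ j) * + j * (K - + j))
               ≡⟨ ∑<-telescope (+ 4) _ F (F0 K) step (s ℕ.+ s) ⟩
             F (s ℕ.+ s)
               ≡⟨ cong (λ z → K * (1ℤ + sgn z * (+ 2 * z - 1ℤ)) - + 2 * (sgn z * (z * z - z))) (+double s) ⟨
             K * (1ℤ + sgn K * (+ 2 * K - 1ℤ)) - + 2 * (sgn K * (K * K - K))
               ≡⟨ cong (λ z → K * (1ℤ + z * (+ 2 * K - 1ℤ)) - + 2 * (z * (K * K - K))) (sgn-2* (+ s)) ⟩
             K * (1ℤ + 1ℤ * (+ 2 * K - 1ℤ)) - + 2 * (1ℤ * (K * K - K))
               ≡⟨ l₃ (+ s) ⟩
             + 4 * + s ∎)) ⟩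
      K * + s
        ≡⟨ ℤP.*-assoc (+ 2) (+ s) (+ s) ⟩
      + 2 * (+ s * + s) ∎
      where
      K : ℤ
      K = + 2 * + s
      -- For c = 0 the entries a = j and b = j - 2s have equal parity, so the weight is 1 - 2
      -- `ev j`, an alternating sign.
      weight : ∀ j → 1ℤ - + 2 * (ev j * ev (j - K) * 1ℤ) ≡ - sgn j
      weight j = begin
        1ℤ - + 2 * (ev j * ev (j - K) * 1ℤ)
          ≡⟨ cong (λ z → 1ℤ - + 2 * (ev j * z * 1ℤ)) (trans (cong ev (l j (+ s))) (ev-2*-+ (- + s) j)) ⟩
        1ℤ - + 2 * (ev j * ev j * 1ℤ)
          ≡⟨ cong (λ z → 1ℤ - + 2 * (z * 1ℤ)) (ev-idem j) ⟩
        1ℤ - + 2 * (ev j * 1ℤ)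
          ≡⟨ l′ (ev j) ⟩
        - (+ 2 * ev j - 1ℤ)
          ≡⟨ cong -_ (sgn≡2ev-1 j) ⟨
        - sgn j ∎
        where
        l : ∀ j s → j - + 2 * s ≡ + 2 * - s + j
        l = solve-∀
        l′ : ∀ x → 1ℤ - + 2 * (x * 1ℤ) ≡ - (+ 2 * x - 1ℤ)
        l′ = solve-∀
      l₁ : ∀ j K t → (j - (j - K)) * (j - K - 0ℤ) * (0ℤ - j) * - t ≡ K * (- t * j * (K - j))
      l₁ = solve-∀
      -- Over j < k, four times the sum of -(-1)ʲ j is 1 + (-1)ᵏ(2k - 1), and four times the sum of
      -- (-1)ʲ j² is -2(-1)ᵏ(k² - k).
      F : ℕ → ℤ
      F k = K * (1ℤ + sgn (+ k) * (+ 2 * + k - 1ℤ)) - + 2 * (sgn (+ k) * (+ k * + k - + k))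
      F0 : ∀ K → K * (1ℤ + 1ℤ * (+ 2 * 0ℤ - 1ℤ)) - + 2 * (1ℤ * (0ℤ * 0ℤ - 0ℤ)) ≡ 0ℤ
      F0 = solve-∀
      step : ∀ k → F k + + 4 * (- sgn (+ k) * + k * (K - + k)) ≡ F (suc k)
      step k = trans (l₂ K (+ k) (sgn (+ k)))
        (cong (λ t → K * (1ℤ + t * (+ 2 * + suc k - 1ℤ)) - + 2 * (t * (+ suc k * + suc k - + suc k))) (sym (sgn-suc (+ k))))
        where
        l₂ : ∀ K j t → K * (1ℤ + t * (+ 2 * j - 1ℤ)) - + 2 * (t * (j * j - j)) + + 4 * (- t * j * (K - j)) ≡
          K * (1ℤ + - t * (+ 2 * (1ℤ + j) - 1ℤ)) - + 2 * (- t * ((1ℤ + j) * (1ℤ + j) - (1ℤ + j)))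
        l₂ = solve-∀
      l₃ : ∀ s → + 2 * s * (1ℤ + 1ℤ * (+ 2 * (+ 2 * s) - 1ℤ)) - + 2 * (1ℤ * (+ 2 * s * (+ 2 * s) - + 2 * s)) ≡ + 4 * s
      l₃ = solve-∀

  -- Jacobi's identity for the cube of the eta function

  Root? : ∀ M → Decidable (λ p → p * p ≡ + M)
  Root? M p = p * p ≟ + M

  -- M > 0 excludes the root 0, so the roots come in pairs ±s.
  ∑-roots : ∀ {M N} → 0 ℕ.< M → M ℕ.≤ N → (g : ℤ → ℤ) → (∀ p → g (- p) ≡ g p) →
    ∑[ Z N ∣ Root? M ] g ≡ + 2 * ∑[ Z N ∣ Square? M ] g
  ∑-roots {M} {N} M>0 M≤N g even = begin
    ∑[ Z N ∣ Root? M ] g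
      ≡⟨ ∑-split (Z N) (Root? M) (0ℤ <?_) g ⟩
    ∑[ Z N ∣ (λ p → Root? M p ×-dec (0ℤ <? p)) ] g + ∑[ Z N ∣ (λ p → Root? M p ×-dec ¬? (0ℤ <? p)) ] g
      ≡⟨ cong₂ _+_
           (∑[]-cong (Z N) (λ p → Root? M p ×-dec (0ℤ <? p)) (Square? M)
             (λ _ (eq , p>0) → p>0 , eq) (λ _ (p>0 , eq) → eq , p>0) (λ _ _ → refl))
           (∑-reindex (Z N) (Z N) (λ p → Root? M p ×-dec ¬? (0ℤ <? p)) (Square? M) -_ -_
             (λ p (eq , _) → ∈-Z (Square-≤ M≤N p eq)) (λ p (_ , eq) → ∈-Z (Square-≤ M≤N p eq))
             (λ p (eq , p≯0) → (-pos p eq p≯0 , trans (neg-sq p) eq) , ℤP.neg-involutive p , sym (even p))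
             (λ p (p>0 , eq) → (trans (neg-sq p) eq , λ -p>0 → ℤP.<-asym p>0 (subst (_< 0ℤ) (ℤP.neg-involutive p) (ℤP.neg-mono-< -p>0))) ,
                ℤP.neg-involutive p)) ⟩
    ∑[ Z N ∣ Square? M ] g + ∑[ Z N ∣ Square? M ] g
      ≡⟨ l (∑[ Z N ∣ Square? M ] g) ⟩
    + 2 * ∑[ Z N ∣ Square? M ] g ∎
    where
    l : ∀ x → x + x ≡ + 2 * x
    l = solve-∀
    neg-sq : ∀ p → - p * - p ≡ p * p
    neg-sq = solve-∀
    -pos : ∀ p → p * p ≡ + M → ¬ (0ℤ < p) → 0ℤ < - p
    -pos p eq p≯0 with ℤP.<-cmp 0ℤ p
    ... | tri< p>0 _ _ = contradiction p>0 p≯0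
    ... | tri≈ _ refl _ = contradiction (ℤP.+-injective eq) (ℕP.<⇒≢ M>0)
    ... | tri> _ _ p<0 = ℤP.neg-mono-< p<0

  -- Antisymmetric because χ is odd. At (d, -e, p + d - e) the differences are d + e, -(p + d) and p
  -- - e. For odd p the last two contribute χ p (κ e - κ d), odd in p, and the first contributes χ d
  -- κ e + κ d χ e.
  h₃ : ℤ → ℤ → ℤ → ℤ
  h₃ a b c = χ (a - b) + χ (b - c) + χ (c - a)

  χ-minus-neg : ∀ x y → χ (y - x) ≡ - χ (x - y)
  χ-minus-neg x y = trans (cong χ (l x y)) (χ-neg (x - y))
    where
    l : ∀ x y → y - x ≡ - (x - y)
    l = solve-∀

  h₃-anti : Antisymmetric h₃
  h₃-anti = record
    { swap₁₂ = λ a b c → trans (cong₂ _+_ (cong₂ _+_ (χ-minus-neg a b) (χ-minus-neg c a)) (χ-minus-neg b c))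
        (l₁ (χ (a - b)) (χ (b - c)) (χ (c - a)))
    ; swap₂₃ = λ a b c → trans (cong₂ _+_ (cong₂ _+_ (χ-minus-neg c a) (χ-minus-neg b c)) (χ-minus-neg a b))
        (l₂ (χ (a - b)) (χ (b - c)) (χ (c - a)))
    }
    where
    l₁ : ∀ x y z → - x + - z + - y ≡ - (x + y + z)
    l₁ = solve-∀
    l₂ : ∀ x y z → - z + - y + - x ≡ - (x + y + z)
    l₂ = solve-∀

  -- κ M = 0 encodes that M is odd. An even p would make M a multiple of 4, where κ does not vanish.
  κ-odd-root : ∀ {M} p r → κ (+ M) ≡ 0ℤ → p * p + + 4 * r ≡ + M → κ p ≡ 0ℤ
  κ-odd-root {M} p r κM eq with parity p
  ... | inj₂ (k , refl) = κ-odd k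
  ... | inj₁ (k , refl) = contradiction (trans (sym (sgn²≡1 (+ 2 * (k * k + r))))
          (cong (λ z → z * z) (trans (cong κ (trans (l k r) eq)) κM))) λ ()
    where
    l : ∀ k r → + 2 * (+ 2 * (k * k + r)) ≡ + 2 * k * (+ 2 * k) + + 4 * r
    l = solve-∀

  χ²≡1 : ∀ x → κ x ≡ 0ℤ → χ x * χ x ≡ 1ℤ
  χ²≡1 x κx = trans (l (χ x)) (trans (cong (λ z → z * z + χ x * χ x) (sym κx)) (κ²+χ²≡1 x))
    where
    l : ∀ c → c * c ≡ 0ℤ * 0ℤ + c * c
    l = solve-∀

  -- On the plane c = 0 the differences are s, a - s and -a, so for odd s the terms are χ s - κ a χ
  -- s - χ a, with sum s χ s - 1. The -1 is what the count of the roots of M compensates afterwards.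
  ∑χκ : ∀ {M N} → M ℕ.≤ N → κ (+ M) ≡ 0ℤ →
    + 2 * ∑[ Z³ N ∣ Ω? 4 M ] (λ (p , d , e) → χ d * κ e) ≡ ∑[ Z N ∣ Square? M ] (λ s → s * χ s - 1ℤ)
  ∑χκ {M} {N} M≤N κM = ℤP.*-cancelˡ-≡ (+ 2) _ _ (begin
    + 2 * (+ 2 * G)
      ≡⟨ l₁ G ⟩
    + 2 * (G + G)
      ≡⟨ cong (λ z → + 2 * (G + z)) (Ω-flip 4 M≤N g) ⟩
    + 2 * (G + ∑[ Z³ N ∣ Ω? 4 M ] (λ (p , d , e) → χ e * κ d))
      ≡⟨ cong (_*_ (+ 2)) (∑[]-+ (Z³ N) (Ω? 4 M) g _) ⟨
    + 2 * ∑[ Z³ N ∣ Ω? 4 M ] (λ (p , d , e) → χ d * κ e + χ e * κ d)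
      ≡⟨ ∑[]-*ˡ (Z³ N) (Ω? 4 M) (+ 2) _ ⟩
    ∑[ Z³ N ∣ Ω? 4 M ] (λ (p , d , e) → + 2 * (χ d * κ e + χ e * κ d))
      ≡⟨ ∑[]-map (Z³ N) (Ω? 4 M) (λ (p , d , e) (_ , _ , eq) → symm p d e (κ-odd-root p (d * e) κM eq)) ⟨
    ∑[ Z³ N ∣ Ω? 4 M ] (λ (p , d , e) → H (p , d , e) + H (- p , d , e))
      ≡⟨ ∑[]-+ (Z³ N) (Ω? 4 M) H _ ⟩
    S + ∑[ Z³ N ∣ Ω? 4 M ] (λ (p , d , e) → H (- p , d , e))
      ≡⟨ cong (_+_ S) (Ω-neg 4 M≤N H) ⟨
    S + S
      ≡⟨ l₂ S ⟩
    + 2 * S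
      ≡⟨ cong (_*_ (+ 2)) (trans (Involution.involution h₃-anti M≤N) (∑[]-map (Z N) (Square? M) column)) ⟩
    + 2 * ∑[ Z N ∣ Square? M ] (λ s → s * χ s - 1ℤ) ∎)
    where
    g H : ℤ × ℤ × ℤ → ℤ
    g (p , d , e) = χ d * κ e
    H = Involution.H h₃-anti M≤N
    G S : ℤ
    G = ∑[ Z³ N ∣ Ω? 4 M ] g
    S = ∑[ Z³ N ∣ Ω? 4 M ] H
    l₁ : ∀ x → + 2 * (+ 2 * x) ≡ + 2 * (x + x)
    l₁ = solve-∀
    l₂ : ∀ x → x + x ≡ + 2 * x
    l₂ = solve-∀
    expand : ∀ p d e → κ p ≡ 0ℤ → H (p , d , e) ≡ χ d * κ e + κ d * χ e - χ p * κ d + χ p * κ e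
    expand p d e κp = cong₂ _+_ (cong₂ _+_ first second) third
      where
      first : χ (d - - e) ≡ χ d * κ e + κ d * χ e
      first = trans (cong (λ z → χ (d + z)) (ℤP.neg-involutive e)) (χ-+ d e)
      second : χ (- e - (p + d - e)) ≡ - (χ p * κ d)
      second = trans (cong χ (l p d e)) (trans (χ-neg (p + d)) (cong -_ (trans (χ-+ p d)
        (trans (cong (λ z → χ p * κ d + z * χ d) κp) (ℤP.+-identityʳ _)))))
        where
        l : ∀ p d e → - e - (p + d - e) ≡ - (p + d)
        l = solve-∀
      third : χ (p + d - e - d) ≡ χ p * κ e
      third = trans (cong χ (l p d e)) (trans (χ-+ p (- e))
        (trans (cong₂ (λ k z → χ p * k + z * χ (- e)) (κ-neg e) κp) (ℤP.+-identityʳ _)))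
        where
        l : ∀ p d e → p + d - e - d ≡ p - e
        l = solve-∀
    symm : ∀ p d e → κ p ≡ 0ℤ → H (p , d , e) + H (- p , d , e) ≡ + 2 * (χ d * κ e + χ e * κ d)
    symm p d e κp = trans (cong₂ _+_ (expand p d e κp)
        (trans (expand (- p) d e (trans (κ-neg p) κp))
               (cong (λ z → χ d * κ e + κ d * χ e - z * κ d + z * κ e) (χ-neg p))))
      (l (χ p) (χ d) (κ d) (χ e) (κ e))
      where
      l : ∀ t x k y m → (x * m + k * y - t * k + t * m) + (x * m + k * y - - t * k + - t * m) ≡
        + 2 * (x * m + y * k)
      l = solve-∀
    column : ∀ s → Square M s → ∑[ Z N ∣ Between? s ] (λ a → h₃ a (a - s) 0ℤ) ≡ s * χ s - 1ℤ
    column (+ s) (_ , eq) = begin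
      ∑[ Z N ∣ Between? (+ s) ] (λ a → h₃ a (a - + s) 0ℤ)
        ≡⟨ ∑-Between (Square-≤ M≤N (+ s) eq) (λ a → h₃ a (a - + s) 0ℤ) (h-0b0 h₃-anti (0ℤ - + s)) ⟩
      ∑< s (λ j → h₃ (+ j) (+ j - + s) 0ℤ)
        ≡⟨ ∑<-cong s (λ j → term (+ j)) ⟩
      ∑< s (λ j → x - κ (+ j) * x - χ (+ j))
        ≡⟨ ℤP.*-cancelˡ-≡ (+ 2) _ (+ s * x - 1ℤ) (begin
             + 2 * ∑< s (λ j → x - κ (+ j) * x - χ (+ j))
               ≡⟨ ∑<-telescope (+ 2) _ F (F0 x) (λ k → step x (+ k) (κ (+ k)) (χ (+ k))) s ⟩
             + 2 * + s * x - x * (1ℤ - κ (+ s) + x) - (1ℤ - κ (+ s) - x)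
               ≡⟨ cong (λ k → + 2 * + s * x - x * (1ℤ - k + x) - (1ℤ - k - x)) κs ⟩
             + 2 * + s * x - x * (1ℤ - 0ℤ + x) - (1ℤ - 0ℤ - x)
               ≡⟨ l (+ s) x ⟩
             + 2 * + s * x - x * x - 1ℤ
               ≡⟨ cong (λ z → + 2 * + s * x - z - 1ℤ) (χ²≡1 (+ s) κs) ⟩
             + 2 * + s * x - 1ℤ - 1ℤ
               ≡⟨ l′ (+ s) x ⟩
             + 2 * (+ s * x - 1ℤ) ∎) ⟩
      + s * x - 1ℤ ∎
      where
      x : ℤ
      x = χ (+ s)
      κs : κ (+ s) ≡ 0ℤ
      κs = κ-odd-root (+ s) 0ℤ κM (trans (ℤP.+-identityʳ _) eq)
      term : ∀ j → h₃ j (j - + s) 0ℤ ≡ x - κ j * x - χ j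
      term j = cong₂ _+_ (cong₂ _+_ (cong χ (l₃ j (+ s))) second)
          (trans (cong χ (ℤP.+-identityˡ (- j))) (χ-neg j))
        where
        l₃ : ∀ j s → j - (j - s) ≡ s
        l₃ = solve-∀
        l₄ : ∀ k c x → c * 0ℤ + k * - x ≡ - (k * x)
        l₄ = solve-∀
        second : χ (j - + s - 0ℤ) ≡ - (κ j * x)
        second = trans (cong χ (ℤP.+-identityʳ (j - + s))) (trans (χ-+ j (- + s))
          (trans (cong₂ (λ k z → χ j * k + κ j * z) (trans (κ-neg (+ s)) κs) (χ-neg (+ s))) (l₄ (κ j) (χ j) x)))
      -- Over j < k, twice the sum of κ j is 1 - κ k + χ k, and twice the sum of χ j is 1 - κ k - χ
      -- k.
      F : ℕ → ℤ
      F k = + 2 * + k * x - x * (1ℤ - κ (+ k) + χ (+ k)) - (1ℤ - κ (+ k) - χ (+ k))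
      F0 : ∀ x → + 2 * 0ℤ * x - x * (1ℤ - 1ℤ + 0ℤ) - (1ℤ - 1ℤ - 0ℤ) ≡ 0ℤ
      F0 = solve-∀
      step : ∀ x j k c → + 2 * j * x - x * (1ℤ - k + c) - (1ℤ - k - c) + + 2 * (x - k * x - c) ≡
        + 2 * (1ℤ + j) * x - x * (1ℤ - - c + k) - (1ℤ - - c - k)
      step = solve-∀
      l : ∀ s x → + 2 * s * x - x * (1ℤ - 0ℤ + x) - (1ℤ - 0ℤ - x) ≡ + 2 * s * x - x * x - 1ℤ
      l = solve-∀
      l′ : ∀ s x → + 2 * s * x - 1ℤ - 1ℤ ≡ + 2 * (s * x - 1ℤ)
      l′ = solve-∀

  -- Jacobi's Σ (-1)ᵏ(2k+1)q^{k(k+1)/2} = ψ(q)φ(-q)², once φ(-q)² is expanded as a divisor sum.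
  ∑χκ-roots : ∀ {M N} → 0 ℕ.< M → M ℕ.≤ N → κ (+ M) ≡ 0ℤ →
    ∑[ Z N ∣ Root? M ] (λ _ → 1ℤ) + + 4 * ∑[ Z³ N ∣ Ω? 4 M ] (λ (p , d , e) → χ d * κ e) ≡
    ∑[ Z N ∣ Root? M ] (λ p → p * χ p)
  ∑χκ-roots {M} {N} M>0 M≤N κM = begin
    ∑[ Z N ∣ Root? M ] (λ _ → 1ℤ) + + 4 * G
      ≡⟨ cong₂ _+_ (∑-roots M>0 M≤N (λ _ → 1ℤ) (λ _ → refl)) (l₁ G) ⟩
    + 2 * ∑[ Z N ∣ Square? M ] (λ _ → 1ℤ) + + 2 * (+ 2 * G)
      ≡⟨ cong (λ z → + 2 * ∑[ Z N ∣ Square? M ] (λ _ → 1ℤ) + + 2 * z) (∑χκ M≤N κM) ⟩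
    + 2 * ∑[ Z N ∣ Square? M ] (λ _ → 1ℤ) + + 2 * ∑[ Z N ∣ Square? M ] (λ s → s * χ s - 1ℤ)
      ≡⟨ ℤP.*-distribˡ-+ (+ 2) (∑[ Z N ∣ Square? M ] (λ _ → 1ℤ)) (∑[ Z N ∣ Square? M ] (λ s → s * χ s - 1ℤ)) ⟨
    + 2 * (∑[ Z N ∣ Square? M ] (λ _ → 1ℤ) + ∑[ Z N ∣ Square? M ] (λ s → s * χ s - 1ℤ))
      ≡⟨ cong (_*_ (+ 2)) (∑[]-+ (Z N) (Square? M) (λ _ → 1ℤ) (λ s → s * χ s - 1ℤ)) ⟨
    + 2 * ∑[ Z N ∣ Square? M ] (λ s → 1ℤ + (s * χ s - 1ℤ))
      ≡⟨ cong (_*_ (+ 2)) (∑[]-map (Z N) (Square? M) (λ s _ → l₂ (s * χ s))) ⟩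
    + 2 * ∑[ Z N ∣ Square? M ] (λ s → s * χ s)
      ≡⟨ ∑-roots M>0 M≤N (λ p → p * χ p) (λ p → trans (cong (_*_ (- p)) (χ-neg p)) (l₃ p (χ p))) ⟨
    ∑[ Z N ∣ Root? M ] (λ p → p * χ p) ∎
    where
    G : ℤ
    G = ∑[ Z³ N ∣ Ω? 4 M ] (λ (p , d , e) → χ d * κ e)
    l₁ : ∀ x → + 4 * x ≡ + 2 * (+ 2 * x)
    l₁ = solve-∀
    l₂ : ∀ x → 1ℤ + (x - 1ℤ) ≡ x
    l₂ = solve-∀
    l₃ : ∀ p x → - p * - x ≡ p * x
    l₃ = solve-∀

  -- Sums of two and of four squares

  0≤sq : ∀ x → 0ℤ ≤ x * x
  0≤sq x = subst (0ℤ ≤_) (sym (sq≡+ x)) (+≤+ ℕ.z≤n)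

  0≤sq+ : ∀ x {r} → 0ℤ ≤ r → 0ℤ ≤ x * x + r
  0≤sq+ x 0≤r = ℤP.+-mono-≤ (0≤sq x) 0≤r

  sq-≤ : ∀ {n} x r → 0ℤ ≤ r → x * x + r ≡ + n → ∣ x ∣ ℕ.≤ n
  sq-≤ x (+ r) _ eq = ℕP.≤-trans (n≤n*n ∣ x ∣) (ℕP.≤-trans (ℕP.m≤m+n _ r)
    (ℕP.≤-reflexive (ℤP.+-injective (trans (cong (λ z → z + + r) (sym (sq≡+ x))) eq))))

  ∣x∣≤0 : ∀ {x} → ∣ x ∣ ℕ.≤ 0 → x ≡ 0ℤ
  ∣x∣≤0 x≤0 = ℤP.∣i∣≡0⇒i≡0 (ℕP.n≤0⇒n≡0 x≤0)

  x+y≡z⇒y≡z-x : ∀ x y z → x + y ≡ z → y ≡ z - x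
  x+y≡z⇒y≡z-x x y z eq = trans (l x y) (cong (λ w → w - x) eq)
    where
    l : ∀ x y → y ≡ x + y - x
    l = solve-∀

  y≡z-x⇒x+y≡z : ∀ x y z → y ≡ z - x → x + y ≡ z
  y≡z-x⇒x+y≡z x y z eq = trans (cong (_+_ x) eq) (l x z)
    where
    l : ∀ x z → x + (z - x) ≡ z
    l = solve-∀

  -- The coefficients of θᵏ, θ = Σ q^{i²}, satisfy this with c = k + 1: compare coefficients in θ (θᵏ)′ = k θ′ θᵏ.
  Recurrence : ℤ → ℕ → (ℤ → ℤ) → ℕ → Set
  Recurrence c N f n = ∑ (Box.elems (Z N)) (λ i → (+ n - c * (i * i)) * f (+ n - i * i)) ≡ 0ℤ

  -- The term i = 0 is n f(n) with n ≠ 0. Every other term evaluates f below n, where it vanishes by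
  -- induction or, at negative arguments, by assumption.
  recurrence-0 : ∀ c N (f : ℤ → ℤ) → f 0ℤ ≡ 0ℤ → (∀ k → f -[1+ k ] ≡ 0ℤ) →
    (∀ n → 4 ℕ.* suc n ℕ.≤ N → Recurrence c N f (suc n)) →
    ∀ n → 4 ℕ.* n ℕ.≤ N → f (+ n) ≡ 0ℤ
  recurrence-0 c N f f0 f- rec = <-rec _ go
    where
    go : ∀ n → (∀ {k} → k ℕ.< n → 4 ℕ.* k ℕ.≤ N → f (+ k) ≡ 0ℤ) → 4 ℕ.* n ℕ.≤ N → f (+ n) ≡ 0ℤ
    go zero ih le = f0
    go (suc n) ih le = ℤP.*-cancelˡ-≡ (+ suc n) (f (+ suc n)) 0ℤ (begin
      + suc n * f (+ suc n)
        ≡⟨ cong₂ (λ a b → a * f b) (l₁ (+ suc n) c) (l₂ (+ suc n)) ⟩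
      (+ suc n - c * (0ℤ * 0ℤ)) * f (+ suc n - 0ℤ * 0ℤ)
        ≡⟨ ∈-Z ℕ.z≤n _ off ⟨
      ∑ (Box.elems (Z N)) (λ i → (+ suc n - c * (i * i)) * f (+ suc n - i * i))
        ≡⟨ rec n le ⟩
      0ℤ
        ≡⟨ ℤP.*-zeroʳ (+ suc n) ⟨
      + suc n * 0ℤ ∎)
      where
      l₁ : ∀ n c → n ≡ n - c * (0ℤ * 0ℤ)
      l₁ = solve-∀
      l₂ : ∀ n → n ≡ n - 0ℤ * 0ℤ
      l₂ = solve-∀
      small : ∀ x → x < + suc n → f x ≡ 0ℤ
      small (+ k) (+<+ k<n) = ih k<n (ℕP.≤-trans (ℕP.*-monoʳ-≤ 4 (ℕP.<⇒≤ k<n)) le)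
      small -[1+ k ] _ = f- k
      sq>0 : ∀ i → i ≢ 0ℤ → 0ℤ < i * i
      sq>0 (+ zero) i≢0 = contradiction refl i≢0
      sq>0 (+ suc i) _ = +<+ (ℕ.s≤s ℕ.z≤n)
      sq>0 -[1+ i ] _ = +<+ (ℕ.s≤s ℕ.z≤n)
      off : ∀ i → i ≢ 0ℤ → (+ suc n - c * (i * i)) * f (+ suc n - i * i) ≡ 0ℤ
      off i i≢0 = trans (cong (_*_ (+ suc n - c * (i * i)))
          (small (+ suc n - i * i) (subst (+ suc n - i * i <_) (ℤP.+-identityʳ (+ suc n))
            (ℤP.+-monoʳ-< (+ suc n) (ℤP.neg-mono-< (sq>0 i i≢0))))))
        (ℤP.*-zeroʳ (+ suc n - c * (i * i)))

  recurrence-unique : ∀ c N (f g : ℤ → ℤ) → f 0ℤ ≡ g 0ℤ → (∀ k → f -[1+ k ] ≡ g -[1+ k ]) →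
    (∀ n → 4 ℕ.* suc n ℕ.≤ N → Recurrence c N f (suc n)) →
    (∀ n → 4 ℕ.* suc n ℕ.≤ N → Recurrence c N g (suc n)) →
    ∀ n → 4 ℕ.* n ℕ.≤ N → f (+ n) ≡ g (+ n)
  recurrence-unique c N f g f0 f- recf recg n le = ℤP.i-j≡0⇒i≡j (f (+ n)) (g (+ n))
    (recurrence-0 c N (λ x → f x - g x) (ℤP.i≡j⇒i-j≡0 f0) (λ k → ℤP.i≡j⇒i-j≡0 (f- k)) rec n le)
    where
    l : ∀ a x y → a * (x - y) ≡ a * x + - 1ℤ * (a * y)
    l = solve-∀
    rec : ∀ n → 4 ℕ.* suc n ℕ.≤ N → Recurrence c N (λ x → f x - g x) (suc n)
    rec n le = begin
      ∑ Zs (λ i → a i * (f (b i) - g (b i)))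
        ≡⟨ ∑-cong Zs (λ i → l (a i) (f (b i)) (g (b i))) ⟩
      ∑ Zs (λ i → a i * f (b i) + - 1ℤ * (a i * g (b i)))
        ≡⟨ ∑-+ Zs _ _ ⟩
      ∑ Zs (λ i → a i * f (b i)) + ∑ Zs (λ i → - 1ℤ * (a i * g (b i)))
        ≡⟨ cong₂ _+_ (recf n le) (trans (sym (∑-*ˡ Zs (- 1ℤ) _)) (cong (_*_ (- 1ℤ)) (recg n le))) ⟩
      0ℤ ∎
      where
      Zs : List ℤ
      Zs = Box.elems (Z N)
      a b : ℤ → ℤ
      a i = + suc n - c * (i * i)
      b i = + suc n - i * i

  -- Divisor sums as coefficients of Lambert series

  Divisors : ℤ → ℤ × ℤ → Set
  Divisors x (d , e) = 0ℤ < d × 0ℤ < e × d * e ≡ x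

  Divisors? : ∀ x → Decidable (Divisors x)
  Divisors? x (d , e) = (0ℤ <? d) ×-dec (0ℤ <? e) ×-dec (d * e ≟ x)

  divisorSum : (ℤ × ℤ → ℤ) → ℕ → ℤ → ℤ
  divisorSum w N x = ∑[ Z N ⊗ Z N ∣ Divisors? x ] w

  -- The coefficients of 1 + c Σ_{d, e ≥ 1} w(d, e) q^{de}.
  lambert : ℤ → (ℤ × ℤ → ℤ) → ℕ → ℤ → ℤ
  lambert c w N x = when (x ≟ 0ℤ) 1ℤ + c * divisorSum w N x

  product-pos : ∀ {d e} → 0ℤ < d → 0ℤ < e → 0ℤ < d * e
  product-pos {+ suc d} {+ suc e} _ _ = +<+ (ℕ.s≤s ℕ.z≤n)
  product-pos {+ zero} (+<+ ())
  product-pos {+ suc d} {+ zero} _ (+<+ ())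

  divisorSum-≤0 : ∀ w N {x} → ¬ (0ℤ < x) → divisorSum w N x ≡ 0ℤ
  divisorSum-≤0 w N x≯0 = ∑-0 (Box.elems (Z N ⊗ Z N)) (λ (d , e) → when-no (Divisors? _ (d , e))
    (λ (d>0 , e>0 , eq) → x≯0 (subst (0ℤ <_) eq (product-pos d>0 e>0))))

  lambert-0 : ∀ c w N → lambert c w N 0ℤ ≡ 1ℤ
  lambert-0 c w N = trans (cong (λ z → 1ℤ + c * z) (divisorSum-≤0 w N (ℤP.<-irrefl refl)))
    (cong (_+_ 1ℤ) (ℤP.*-zeroʳ c))

  lambert-neg : ∀ c w N k → lambert c w N -[1+ k ] ≡ 0ℤ
  lambert-neg c w N k = trans (cong (λ z → 0ℤ + c * z) (divisorSum-≤0 w N (λ ())))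
    (trans (ℤP.+-identityˡ (c * 0ℤ)) (ℤP.*-zeroʳ c))

  -- The constant term 1 is met only at the roots i² = n, where the factor is -m i²; the two signs
  -- of i give -2m times the sum of s². On i² + de = n the factor is de - m i², so the divisor part
  -- gives 2m times the sum in the hypothesis. The leading constant 2m is exactly what makes them
  -- cancel.
  lambert-recurrence : ∀ (m : ℤ) (w : ℤ × ℤ → ℤ) {n N} → 4 ℕ.* suc n ℕ.≤ N →
    ∑[ Z³ N ∣ Ω? 1 (suc n) ] (λ (i , d , e) → w (d , e) * (d * e - m * (i * i))) ≡ ∑[ Z N ∣ Square? (suc n) ] (λ s → s * s) →
    Recurrence (1ℤ + m) N (lambert (+ 2 * m) w N) (suc n)
  lambert-recurrence m w {n₁} {N} 4n≤N identity = begin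
    ∑ Zs (λ i → a i * lambert (+ 2 * m) w N (b i))
      ≡⟨ ∑-cong Zs (λ i → split (a i) (when (b i ≟ 0ℤ) 1ℤ) (+ 2 * m) (divisorSum w N (b i))) ⟩
    ∑ Zs (λ i → a i * when (b i ≟ 0ℤ) 1ℤ + + 2 * m * (a i * divisorSum w N (b i)))
      ≡⟨ ∑-+ Zs _ _ ⟩
    ∑ Zs (λ i → a i * when (b i ≟ 0ℤ) 1ℤ) + ∑ Zs (λ i → + 2 * m * (a i * divisorSum w N (b i)))
      ≡⟨ cong₂ _+_ roots (trans (sym (∑-*ˡ Zs (+ 2 * m) _)) (cong (_*_ (+ 2 * m)) divisors)) ⟩
    + 2 * (- m * T) + + 2 * m * T
      ≡⟨ cancel m T ⟩
    0ℤ ∎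
    where
    n : ℕ
    n = suc n₁
    n≤N : n ℕ.≤ N
    n≤N = ℕP.≤-trans (ℕP.m≤n*m n 4) 4n≤N
    Zs : List ℤ
    Zs = Box.elems (Z N)
    a b : ℤ → ℤ
    a i = + n - (1ℤ + m) * (i * i)
    b i = + n - i * i
    T : ℤ
    T = ∑[ Z N ∣ Square? n ] (λ s → s * s)
    split : ∀ a x c y → a * (x + c * y) ≡ a * x + c * (a * y)
    split = solve-∀
    cancel : ∀ m T → + 2 * (- m * T) + + 2 * m * T ≡ 0ℤ
    cancel = solve-∀
    at-root : ∀ i → i * i ≡ + n → a i * 1ℤ ≡ - m * (i * i)
    at-root i eq = trans (cong (λ z → (z - (1ℤ + m) * (i * i)) * 1ℤ) (sym eq)) (l m (i * i))
      where
      l : ∀ m x → (x - (1ℤ + m) * x) * 1ℤ ≡ - m * x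
      l = solve-∀
    roots : ∑ Zs (λ i → a i * when (b i ≟ 0ℤ) 1ℤ) ≡ + 2 * (- m * T)
    roots = begin
      ∑ Zs (λ i → a i * when (b i ≟ 0ℤ) 1ℤ)
        ≡⟨ ∑-cong Zs (λ i → trans (when-*ˡ (b i ≟ 0ℤ) (a i) 1ℤ) (when-cong (b i ≟ 0ℤ) (Root? n i)
             (λ eq → sym (ℤP.i-j≡0⇒i≡j (+ n) (i * i) eq)) (λ eq → ℤP.i≡j⇒i-j≡0 (sym eq))
             (λ eq → at-root i (sym (ℤP.i-j≡0⇒i≡j (+ n) (i * i) eq))))) ⟩
      ∑[ Z N ∣ Root? n ] (λ i → - m * (i * i))
        ≡⟨ ∑-roots (ℕ.s≤s ℕ.z≤n) n≤N (λ i → - m * (i * i)) (λ i → cong (_*_ (- m)) (neg-sq i)) ⟩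
      + 2 * ∑[ Z N ∣ Square? n ] (λ s → - m * (s * s))
        ≡⟨ cong (_*_ (+ 2)) (∑[]-*ˡ (Z N) (Square? n) (- m) (λ s → s * s)) ⟨
      + 2 * (- m * T) ∎
      where
      neg-sq : ∀ p → - p * - p ≡ p * p
      neg-sq = solve-∀
    divisors : ∑ Zs (λ i → a i * divisorSum w N (b i)) ≡ T
    divisors = begin
      ∑ Zs (λ i → a i * divisorSum w N (b i))
        ≡⟨ ∑-cong Zs (λ i → ∑-*ˡ (Box.elems (Z N ⊗ Z N)) (a i) _) ⟩
      ∑ Zs (λ i → ∑ (Box.elems (Z N ⊗ Z N)) (λ v → a i * when (Divisors? (b i) v) (w v)))
        ≡⟨ ∑-⊗ (Z N) (Z N ⊗ Z N) _ ⟨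
      ∑ (Box.elems (Z³ N)) (λ (i , v) → a i * when (Divisors? (b i) v) (w v))
        ≡⟨ ∑-cong (Box.elems (Z³ N)) (λ (i , d , e) → trans (when-*ˡ (Divisors? (b i) (d , e)) (a i) (w (d , e)))
             (when-cong (Divisors? (b i) (d , e)) (Ω? 1 n (i , d , e))
               (λ (d>0 , e>0 , eq) → d>0 , e>0 , y≡z-x⇒x+y≡z (i * i) (+ 1 * (d * e)) (+ n) (trans (ℤP.*-identityˡ (d * e)) eq))
               (λ (d>0 , e>0 , eq) → d>0 , e>0 , trans (sym (ℤP.*-identityˡ (d * e))) (x+y≡z⇒y≡z-x (i * i) _ (+ n) eq))
               (λ (d>0 , e>0 , eq) → weight i d e (y≡z-x⇒x+y≡z (i * i) (d * e) (+ n) eq)))) ⟩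
      ∑[ Z³ N ∣ Ω? 1 n ] (λ (i , d , e) → w (d , e) * (d * e - m * (i * i)))
        ≡⟨ identity ⟩
      T ∎
      where
      weight : ∀ i d e → i * i + d * e ≡ + n → a i * w (d , e) ≡ w (d , e) * (d * e - m * (i * i))
      weight i d e eq = trans (cong (λ z → (z - (1ℤ + m) * (i * i)) * w (d , e)) (sym eq)) (l (w (d , e)) m (i * i) (d * e))
        where
        l : ∀ w m x y → (x + y - (1ℤ + m) * x) * w ≡ w * (y - m * x)
        l = solve-∀

  -- The numbers of representations r₂ and r₄

  TwoSquares? : ∀ x → Decidable (λ ((b , c) : ℤ × ℤ) → b * b + c * c ≡ x)
  TwoSquares? x (b , c) = b * b + c * c ≟ x

  FourSquares? : ∀ x → Decidable (λ ((b , c , d , e) : ℤ × ℤ × ℤ × ℤ) → b * b + (c * c + (d * d + e * e)) ≡ x)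
  FourSquares? x (b , c , d , e) = b * b + (c * c + (d * d + e * e)) ≟ x

  r₂ r₄ : ℕ → ℤ → ℤ
  r₂ N x = ∑[ Z N ⊗ Z N ∣ TwoSquares? x ] (λ _ → 1ℤ)
  r₄ N x = ∑[ Z⁴ N ∣ FourSquares? x ] (λ _ → 1ℤ)

  -- The second weight counts d negatively when d and e are both even, so over de = n > 0 it sums to
  -- σ(n) - 4σ(n/4), with the last term absent unless 4 divides n. The two Lambert series are
  -- Jacobi's formulas for r₂ and r₄.
  χ-weight d-weight : ℤ × ℤ → ℤ
  χ-weight (d , e) = χ d
  d-weight (d , e) = d * (1ℤ - + 2 * (ev d * ev e))

  0≤2sq : ∀ x y → 0ℤ ≤ x * x + y * y
  0≤2sq x y = 0≤sq+ x (0≤sq y)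

  0≤4sq : ∀ x y z w → 0ℤ ≤ x * x + (y * y + (z * z + w * w))
  0≤4sq x y z w = 0≤sq+ x (0≤sq+ y (0≤2sq z w))

  not-neg : ∀ {x k} → 0ℤ ≤ x → x ≢ -[1+ k ]
  not-neg (+≤+ _) ()

  -- On i² + b² + c² = n the factor n - 3i² equals (b² - i²) + (c² - i²), and each summand changes
  -- sign when its two variables are exchanged. This is the logarithmic derivative without power
  -- series; the case of r₄ has four such summands.
  r₂-recurrence : ∀ {n N} → n ℕ.≤ N → Recurrence (+ 3) N (r₂ N) n
  r₂-recurrence {n} {N} n≤N = begin
    ∑ (Box.elems (Z N)) (λ i → a i * r₂ N (+ n - i * i))
      ≡⟨ ∑-cong (Box.elems (Z N)) (λ i → ∑-*ˡ (Box.elems (Z N ⊗ Z N)) (a i) _) ⟩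
    ∑ (Box.elems (Z N)) (λ i → ∑ (Box.elems (Z N ⊗ Z N)) (λ v → a i * when (TwoSquares? (+ n - i * i) v) 1ℤ))
      ≡⟨ ∑-⊗ (Z N) (Z N ⊗ Z N) _ ⟨
    ∑ (Box.elems (Z³ N)) (λ (i , v) → a i * when (TwoSquares? (+ n - i * i) v) 1ℤ)
      ≡⟨ ∑-cong (Box.elems (Z³ N)) (λ (i , b , c) → trans (when-*ˡ (TwoSquares? (+ n - i * i) (b , c)) (a i) 1ℤ)
           (when-cong (TwoSquares? (+ n - i * i) (b , c)) (Three? (i , b , c))
             (y≡z-x⇒x+y≡z (i * i) (b * b + c * c) (+ n)) (x+y≡z⇒y≡z-x (i * i) (b * b + c * c) (+ n))
             (λ eq → weight i b c (y≡z-x⇒x+y≡z (i * i) (b * b + c * c) (+ n) eq)))) ⟩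
    ∑[ Z³ N ∣ Three? ] (λ (i , b , c) → (b * b - i * i) + (c * c - i * i))
      ≡⟨ ∑[]-+ (Z³ N) Three? _ _ ⟩
    ∑[ Z³ N ∣ Three? ] (λ (i , b , c) → b * b - i * i) + ∑[ Z³ N ∣ Three? ] (λ (i , b , c) → c * c - i * i)
      ≡⟨ cong₂ _+_
        (∑[]-antisym (Z³ N) Three? (λ (i , b , c) → b , i , c) bounded
          (λ (i , b , c) → trans (l₁ i b c)) (λ _ → refl) (λ (i , b , c) → l₃ i b))
        (∑[]-antisym (Z³ N) Three? (λ (i , b , c) → c , b , i) bounded
          (λ (i , b , c) → trans (l₂ i b c)) (λ _ → refl) (λ (i , b , c) → l₃ i c)) ⟩
    0ℤ ∎
    where
    a : ℤ → ℤ
    a i = + n - + 3 * (i * i)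
    Three? : Decidable (λ ((i , b , c) : ℤ × ℤ × ℤ) → i * i + (b * b + c * c) ≡ + n)
    Three? (i , b , c) = i * i + (b * b + c * c) ≟ + n
    weight : ∀ i b c → i * i + (b * b + c * c) ≡ + n → a i * 1ℤ ≡ (b * b - i * i) + (c * c - i * i)
    weight i b c eq = trans (cong (λ z → (z - + 3 * (i * i)) * 1ℤ) (sym eq)) (l i b c)
      where
      l : ∀ i b c → (i * i + (b * b + c * c) - + 3 * (i * i)) * 1ℤ ≡ (b * b - i * i) + (c * c - i * i)
      l = solve-∀
    l₁ : ∀ i b c → b * b + (i * i + c * c) ≡ i * i + (b * b + c * c)
    l₁ = solve-∀
    l₂ : ∀ i b c → c * c + (b * b + i * i) ≡ i * i + (b * b + c * c)
    l₂ = solve-∀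
    l₃ : ∀ i b → i * i - b * b ≡ - (b * b - i * i)
    l₃ = solve-∀
    bounded : ∀ v → _ → v ∈ Z³ N
    bounded (i , b , c) eq = ∈-Z³
      (ℕP.≤-trans (sq-≤ i _ (0≤2sq b c) eq) n≤N)
      (ℕP.≤-trans (sq-≤ b _ (0≤2sq i c) (trans (l₁ i b c) eq)) n≤N)
      (ℕP.≤-trans (sq-≤ c _ (0≤2sq b i) (trans (l₂ i b c) eq)) n≤N)

  r₄-recurrence : ∀ {n N} → n ℕ.≤ N → Recurrence (+ 5) N (r₄ N) n
  r₄-recurrence {n} {N} n≤N = begin
    ∑ (Box.elems (Z N)) (λ i → a i * r₄ N (+ n - i * i))
      ≡⟨ ∑-cong (Box.elems (Z N)) (λ i → ∑-*ˡ (Box.elems (Z⁴ N)) (a i) _) ⟩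
    ∑ (Box.elems (Z N)) (λ i → ∑ (Box.elems (Z⁴ N)) (λ v → a i * when (FourSquares? (+ n - i * i) v) 1ℤ))
      ≡⟨ ∑-⊗ (Z N) (Z⁴ N) _ ⟨
    ∑ (Box.elems Z⁵) (λ (i , v) → a i * when (FourSquares? (+ n - i * i) v) 1ℤ)
      ≡⟨ ∑-cong (Box.elems Z⁵) (λ (i , b , c , d , e) →
           trans (when-*ˡ (FourSquares? (+ n - i * i) (b , c , d , e)) (a i) 1ℤ)
           (when-cong (FourSquares? (+ n - i * i) (b , c , d , e)) (Five? (i , b , c , d , e))
             (y≡z-x⇒x+y≡z (i * i) _ (+ n)) (x+y≡z⇒y≡z-x (i * i) _ (+ n))
             (λ eq → weight i b c d e (y≡z-x⇒x+y≡z (i * i) _ (+ n) eq)))) ⟩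
    ∑[ Z⁵ ∣ Five? ] (λ (i , b , c , d , e) → (b * b - i * i) + ((c * c - i * i) + ((d * d - i * i) + (e * e - i * i))))
      ≡⟨ trans (∑[]-+ Z⁵ Five? f₁ _) (cong (_+_ (∑[ Z⁵ ∣ Five? ] f₁))
           (trans (∑[]-+ Z⁵ Five? f₂ _) (cong (_+_ (∑[ Z⁵ ∣ Five? ] f₂)) (∑[]-+ Z⁵ Five? f₃ f₄)))) ⟩
    ∑[ Z⁵ ∣ Five? ] f₁ + (∑[ Z⁵ ∣ Five? ] f₂ + (∑[ Z⁵ ∣ Five? ] f₃ + ∑[ Z⁵ ∣ Five? ] f₄))
      ≡⟨ cong₂ _+_
        (∑[]-antisym Z⁵ Five? (λ (i , b , c , d , e) → b , i , c , d , e) bounded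
          (λ (i , b , c , d , e) → trans (l₁ i b c d e)) (λ _ → refl) (λ (i , b , c , d , e) → anti i b))
        (cong₂ _+_
          (∑[]-antisym Z⁵ Five? (λ (i , b , c , d , e) → c , b , i , d , e) bounded
            (λ (i , b , c , d , e) → trans (l₂ i b c d e)) (λ _ → refl) (λ (i , b , c , d , e) → anti i c))
          (cong₂ _+_
            (∑[]-antisym Z⁵ Five? (λ (i , b , c , d , e) → d , b , c , i , e) bounded
              (λ (i , b , c , d , e) → trans (l₃ i b c d e)) (λ _ → refl) (λ (i , b , c , d , e) → anti i d))
            (∑[]-antisym Z⁵ Five? (λ (i , b , c , d , e) → e , b , c , d , i) bounded
              (λ (i , b , c , d , e) → trans (l₄ i b c d e)) (λ _ → refl) (λ (i , b , c , d , e) → anti i e)))) ⟩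
    0ℤ ∎
    where
    Z⁵ : Box (ℤ × ℤ × ℤ × ℤ × ℤ)
    Z⁵ = Z N ⊗ Z⁴ N
    f₁ f₂ f₃ f₄ : ℤ × ℤ × ℤ × ℤ × ℤ → ℤ
    f₁ (i , b , c , d , e) = b * b - i * i
    f₂ (i , b , c , d , e) = c * c - i * i
    f₃ (i , b , c , d , e) = d * d - i * i
    f₄ (i , b , c , d , e) = e * e - i * i
    a : ℤ → ℤ
    a i = + n - + 5 * (i * i)
    Five? : Decidable (λ ((i , b , c , d , e) : ℤ × ℤ × ℤ × ℤ × ℤ) → i * i + (b * b + (c * c + (d * d + e * e))) ≡ + n)
    Five? (i , b , c , d , e) = i * i + (b * b + (c * c + (d * d + e * e))) ≟ + n
    weight : ∀ i b c d e → i * i + (b * b + (c * c + (d * d + e * e))) ≡ + n →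
      a i * 1ℤ ≡ (b * b - i * i) + ((c * c - i * i) + ((d * d - i * i) + (e * e - i * i)))
    weight i b c d e eq = trans (cong (λ z → (z - + 5 * (i * i)) * 1ℤ) (sym eq)) (l (i * i) (b * b) (c * c) (d * d) (e * e))
      where
      l : ∀ i b c d e → (i + (b + (c + (d + e))) - + 5 * i) * 1ℤ ≡ (b - i) + ((c - i) + ((d - i) + (e - i)))
      l = solve-∀
    l₁ : ∀ i b c d e → b * b + (i * i + (c * c + (d * d + e * e))) ≡ i * i + (b * b + (c * c + (d * d + e * e)))
    l₁ = solve-∀
    l₂ : ∀ i b c d e → c * c + (b * b + (i * i + (d * d + e * e))) ≡ i * i + (b * b + (c * c + (d * d + e * e)))
    l₂ = solve-∀
    l₃ : ∀ i b c d e → d * d + (b * b + (c * c + (i * i + e * e))) ≡ i * i + (b * b + (c * c + (d * d + e * e)))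
    l₃ = solve-∀
    l₄ : ∀ i b c d e → e * e + (b * b + (c * c + (d * d + i * i))) ≡ i * i + (b * b + (c * c + (d * d + e * e)))
    l₄ = solve-∀
    anti : ∀ i b → i * i - b * b ≡ - (b * b - i * i)
    anti = solve-∀
    bounded : ∀ v → _ → v ∈ Z⁵
    bounded (i , b , c , d , e) eq = ∈-⊗ (Z N) (Z⁴ N)
      (∈-Z (ℕP.≤-trans (sq-≤ i _ (0≤4sq b c d e) eq) n≤N)) (∈-Z⁴
      (ℕP.≤-trans (sq-≤ b _ (0≤4sq i c d e) (trans (l₁ i b c d e) eq)) n≤N)
      (ℕP.≤-trans (sq-≤ c _ (0≤4sq b i d e) (trans (l₂ i b c d e) eq)) n≤N)
      (ℕP.≤-trans (sq-≤ d _ (0≤4sq b c i e) (trans (l₃ i b c d e) eq)) n≤N)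
      (ℕP.≤-trans (sq-≤ e _ (0≤4sq b c d i) (trans (l₄ i b c d e) eq)) n≤N))

  r₂-0 : ∀ N → r₂ N 0ℤ ≡ 1ℤ
  r₂-0 N = ∈-⊗ (Z N) (Z N) (∈-Z {x = 0ℤ} ℕ.z≤n) (∈-Z {x = 0ℤ} ℕ.z≤n) _
    (λ (b , c) bc≢0 → when-no (TwoSquares? 0ℤ (b , c)) (λ eq → bc≢0 (cong₂ _,_
      (∣x∣≤0 (sq-≤ b _ (0≤sq c) eq))
      (∣x∣≤0 (sq-≤ c _ (0≤sq b) (trans (ℤP.+-comm (c * c) (b * b)) eq))))))

  r₄-0 : ∀ N → r₄ N 0ℤ ≡ 1ℤ
  r₄-0 N = ∈-Z⁴ {x = 0ℤ} {0ℤ} {0ℤ} {0ℤ} ℕ.z≤n ℕ.z≤n ℕ.z≤n ℕ.z≤n _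
    (λ (b , c , d , e) ≢0 → when-no (FourSquares? 0ℤ (b , c , d , e)) (λ eq → ≢0 (,₄-cong
      (∣x∣≤0 (sq-≤ b _ (0≤sq+ c (0≤2sq d e)) eq))
      (∣x∣≤0 (sq-≤ c _ (0≤sq+ b (0≤2sq d e)) (trans (l₁ b c d e) eq)))
      (∣x∣≤0 (sq-≤ d _ (0≤sq+ b (0≤2sq c e)) (trans (l₂ b c d e) eq)))
      (∣x∣≤0 (sq-≤ e _ (0≤sq+ b (0≤2sq c d)) (trans (l₃ b c d e) eq))))))
    where
    l₁ : ∀ b c d e → c * c + (b * b + (d * d + e * e)) ≡ b * b + (c * c + (d * d + e * e))
    l₁ = solve-∀
    l₂ : ∀ b c d e → d * d + (b * b + (c * c + e * e)) ≡ b * b + (c * c + (d * d + e * e))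
    l₂ = solve-∀
    l₃ : ∀ b c d e → e * e + (b * b + (c * c + d * d)) ≡ b * b + (c * c + (d * d + e * e))
    l₃ = solve-∀

  two-squares : ∀ n {N} → 4 ℕ.* n ℕ.≤ N → r₂ N (+ n) ≡ lambert (+ 4) χ-weight N (+ n)
  two-squares n {N} = recurrence-unique (+ 3) N (r₂ N) (lambert (+ 4) χ-weight N)
    (trans (r₂-0 N) (sym (lambert-0 (+ 4) χ-weight N)))
    (λ k → trans (∑[]-0′ k) (sym (lambert-neg (+ 4) χ-weight N k)))
    (λ n le → r₂-recurrence (ℕP.≤-trans (ℕP.m≤n*m (suc n) 4) le))
    (λ n le → lambert-recurrence (+ 2) χ-weight le (∑χ-squares le)) n
    where
    ∑[]-0′ : ∀ k → r₂ N -[1+ k ] ≡ 0ℤ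
    ∑[]-0′ k = ∑[]-0 (Z N ⊗ Z N) (TwoSquares? -[1+ k ]) (λ (b , c) eq → contradiction eq (not-neg (0≤2sq b c)))

  four-squares : ∀ n {N} → 4 ℕ.* n ℕ.≤ N → r₄ N (+ n) ≡ lambert (+ 8) d-weight N (+ n)
  four-squares n {N} = recurrence-unique (+ 5) N (r₄ N) (lambert (+ 8) d-weight N)
    (trans (r₄-0 N) (sym (lambert-0 (+ 8) d-weight N)))
    (λ k → trans (∑[]-0′ k) (sym (lambert-neg (+ 8) d-weight N k)))
    (λ n le → r₄-recurrence (ℕP.≤-trans (ℕP.m≤n*m (suc n) 4) le))
    (λ n le → lambert-recurrence (+ 4) d-weight le (∑d-squares le)) n
    where
    ∑[]-0′ : ∀ k → r₄ N -[1+ k ] ≡ 0ℤ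
    ∑[]-0′ k = ∑[]-0 (Z⁴ N) (FourSquares? -[1+ k ])
      (λ (b , c , d , e) eq → contradiction eq (not-neg (0≤4sq b c d e)))

  -- The form p² + q² + 2u² + 2w²

  Even : ℤ → Set
  Even x = ∃ λ k → x ≡ + 2 * k

  odd⇒¬Even : ∀ {x} k → x ≡ + 2 * k + 1ℤ → ¬ Even x
  odd⇒¬Even k eq (j , eq′) = 2k≢2j+1 {j} {k} (trans (sym eq′) eq)

  Even? : Decidable Even
  Even? x with parity x
  ... | inj₁ even = yes even
  ... | inj₂ (k , eq) = no (odd⇒¬Even k eq)

  ¬Even⇒odd : ∀ {x} → ¬ Even x → ∃ λ k → x ≡ + 2 * k + 1ℤ
  ¬Even⇒odd {x} ¬even with parity x
  ... | inj₁ even = contradiction even ¬even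
  ... | inj₂ odd = odd

  ¬Even-suc : ∀ {x} → ¬ Even x → Even (x + 1ℤ)
  ¬Even-suc ¬even with ¬Even⇒odd ¬even
  ... | k , refl = k + 1ℤ , l k
    where
    l : ∀ k → + 2 * k + 1ℤ + 1ℤ ≡ + 2 * (k + 1ℤ)
    l = solve-∀

  Even-minus : ∀ {x y} → Even (x + y) → Even (x - y)
  Even-minus {x} {y} (k , eq) = k - y , trans (l₁ x y) (trans (cong (λ z → z - + 2 * y) eq) (l₂ k y))
    where
    l₁ : ∀ x y → x - y ≡ x + y - + 2 * y
    l₁ = solve-∀
    l₂ : ∀ k y → + 2 * k - + 2 * y ≡ + 2 * (k - y)
    l₂ = solve-∀

  ¬Even-minus : ∀ {x y} → ¬ Even (x + y) → ¬ Even (x - y)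
  ¬Even-minus {x} {y} ¬even even = ¬even (subst (λ z → Even (x + z)) (ℤP.neg-involutive y) (Even-minus {x} { - y} even))

  -- The sum of the squares is odd and congruent to (b + c) + (d + e) modulo 2.
  odd-sum-Even : ∀ {m} b c d e k → m ≡ + 2 * k + 1ℤ → b * b + (c * c + (d * d + e * e)) ≡ m →
    (Even (b + c) × ¬ Even (d + e)) ⊎ (¬ Even (b + c) × Even (d + e))
  odd-sum-Even b c d e k odd eq with parity (b + c) | parity (d + e)
  ... | inj₁ p | inj₂ (j , q) = inj₁ (p , odd⇒¬Even j q)
  ... | inj₂ (i , p) | inj₁ q = inj₂ (odd⇒¬Even i p , q)
  ... | inj₁ (i , p) | inj₁ (j , q) = contradiction
    (trans (sym odd) (trans (sym eq) (trans (l₁ b c d e) (trans (cong₂ (λ x y → x * x + y * y - + 2 * (b * c + d * e)) p q) (l₂ i j (b * c + d * e))))))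
    (λ eq′ → 2k≢2j+1 {+ 2 * (i * i + j * j) - (b * c + d * e)} {k} (sym eq′))
    where
    l₁ : ∀ b c d e → b * b + (c * c + (d * d + e * e)) ≡ (b + c) * (b + c) + (d + e) * (d + e) - + 2 * (b * c + d * e)
    l₁ = solve-∀
    l₂ : ∀ i j r → + 2 * i * (+ 2 * i) + + 2 * j * (+ 2 * j) - + 2 * r ≡ + 2 * (+ 2 * (i * i + j * j) - r)
    l₂ = solve-∀
  ... | inj₂ (i , p) | inj₂ (j , q) = contradiction
    (trans (sym odd) (trans (sym eq) (trans (l₁ b c d e) (trans (cong₂ (λ x y → x * x + y * y - + 2 * (b * c + d * e)) p q) (l₂ i j (b * c + d * e))))))
    (λ eq′ → 2k≢2j+1 {+ 2 * (i * i + i + j * j + j) + 1ℤ - (b * c + d * e)} {k} (sym eq′))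
    where
    l₁ : ∀ b c d e → b * b + (c * c + (d * d + e * e)) ≡ (b + c) * (b + c) + (d + e) * (d + e) - + 2 * (b * c + d * e)
    l₁ = solve-∀
    l₂ : ∀ i j r → (+ 2 * i + 1ℤ) * (+ 2 * i + 1ℤ) + (+ 2 * j + 1ℤ) * (+ 2 * j + 1ℤ) - + 2 * r ≡
      + 2 * (+ 2 * (i * i + i + j * j + j) + 1ℤ - r)
    l₂ = solve-∀

  0≤* : ∀ k {x} → 0ℤ ≤ x → 0ℤ ≤ + k * x
  0≤* k {+ x} _ = subst (0ℤ ≤_) (ℤP.pos-* k x) (+≤+ ℕ.z≤n)

  Form : ℕ → ℤ × ℤ × ℤ × ℤ → Set
  Form m (p , q , u , w) = p * p + (q * q + (+ 2 * (u * u) + + 2 * (w * w))) ≡ + m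

  Form? : ∀ m → Decidable (Form m)
  Form? m (p , q , u , w) = p * p + (q * q + (+ 2 * (u * u) + + 2 * (w * w))) ≟ + m

  Form⊆Z⁴ : ∀ {m N} → m ℕ.≤ N → ∀ v → Form m v → v ∈ Z⁴ N
  Form⊆Z⁴ m≤N (p , q , u , w) eq = ∈-Z⁴
    (ℕP.≤-trans (sq-≤ p _ (0≤sq+ q (0≤2u² u w)) eq) m≤N)
    (ℕP.≤-trans (sq-≤ q _ (0≤sq+ p (0≤2u² u w)) (trans (l₁ p q u w) eq)) m≤N)
    (ℕP.≤-trans (sq-≤ u _ (0≤sq+ u (0≤sq+ p (0≤sq+ q (0≤* 2 (0≤sq w))))) (trans (l₂ p q u w) eq)) m≤N)
    (ℕP.≤-trans (sq-≤ w _ (0≤sq+ w (0≤sq+ p (0≤sq+ q (0≤* 2 (0≤sq u))))) (trans (l₃ p q u w) eq)) m≤N)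
    where
    0≤2u² : ∀ u w → 0ℤ ≤ + 2 * (u * u) + + 2 * (w * w)
    0≤2u² u w = ℤP.+-mono-≤ (0≤* 2 (0≤sq u)) (0≤* 2 (0≤sq w))
    l₁ : ∀ p q u w → q * q + (p * p + (+ 2 * (u * u) + + 2 * (w * w))) ≡ p * p + (q * q + (+ 2 * (u * u) + + 2 * (w * w)))
    l₁ = solve-∀
    l₂ : ∀ p q u w → u * u + (u * u + (p * p + (q * q + + 2 * (w * w)))) ≡ p * p + (q * q + (+ 2 * (u * u) + + 2 * (w * w)))
    l₂ = solve-∀
    l₃ : ∀ p q u w → w * w + (w * w + (p * p + (q * q + + 2 * (u * u)))) ≡ p * p + (q * q + (+ 2 * (u * u) + + 2 * (w * w)))
    l₃ = solve-∀

  FourSquares⊆Z⁴ : ∀ {m N} → m ℕ.≤ N → ∀ ((b , c , d , e) : ℤ × ℤ × ℤ × ℤ) →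
    b * b + (c * c + (d * d + e * e)) ≡ + m → (b , c , d , e) ∈ Z⁴ N
  FourSquares⊆Z⁴ m≤N (b , c , d , e) eq = ∈-Z⁴
    (ℕP.≤-trans (sq-≤ b _ (0≤sq+ c (0≤2sq d e)) eq) m≤N)
    (ℕP.≤-trans (sq-≤ c _ (0≤sq+ b (0≤2sq d e)) (trans (l₁ b c d e) eq)) m≤N)
    (ℕP.≤-trans (sq-≤ d _ (0≤sq+ b (0≤2sq c e)) (trans (l₂ b c d e) eq)) m≤N)
    (ℕP.≤-trans (sq-≤ e _ (0≤sq+ b (0≤2sq c d)) (trans (l₃ b c d e) eq)) m≤N)
    where
    l₁ : ∀ b c d e → c * c + (b * b + (d * d + e * e)) ≡ b * b + (c * c + (d * d + e * e))
    l₁ = solve-∀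
    l₂ : ∀ b c d e → d * d + (b * b + (c * c + e * e)) ≡ b * b + (c * c + (d * d + e * e))
    l₂ = solve-∀
    l₃ : ∀ b c d e → e * e + (b * b + (c * c + d * d)) ≡ b * b + (c * c + (d * d + e * e))
    l₃ = solve-∀

  -- For odd m exactly one of b + c and d + e is even, and exchanging the pairs accounts for the
  -- factor 2. When d + e is even, d = u + w and e = u - w turn d² + e² into 2u² + 2w².
  r₄≡2Form : ∀ {m N} k → + m ≡ + 2 * k + 1ℤ → m ℕ.≤ N → r₄ N (+ m) ≡ + 2 * ∑[ Z⁴ N ∣ Form? m ] (λ _ → 1ℤ)
  r₄≡2Form {m} {N} k odd m≤N = begin
    r₄ N (+ m)
      ≡⟨ ∑-split (Z⁴ N) (FourSquares? (+ m)) Q? (λ _ → 1ℤ) ⟩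
    ∑[ Z⁴ N ∣ A? ] (λ _ → 1ℤ) + ∑[ Z⁴ N ∣ (λ v → FourSquares? (+ m) v ×-dec ¬? (Q? v)) ] (λ _ → 1ℤ)
      ≡⟨ cong (_+_ (∑[ Z⁴ N ∣ A? ] (λ _ → 1ℤ))) swapped ⟩
    ∑[ Z⁴ N ∣ A? ] (λ _ → 1ℤ) + ∑[ Z⁴ N ∣ A? ] (λ _ → 1ℤ)
      ≡⟨ cong₂ _+_ halved halved ⟩
    ∑[ Z⁴ N ∣ Form? m ] (λ _ → 1ℤ) + ∑[ Z⁴ N ∣ Form? m ] (λ _ → 1ℤ)
      ≡⟨ double (∑[ Z⁴ N ∣ Form? m ] (λ _ → 1ℤ)) ⟩
    + 2 * ∑[ Z⁴ N ∣ Form? m ] (λ _ → 1ℤ) ∎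
    where
    double : ∀ x → x + x ≡ + 2 * x
    double = solve-∀
    Q? : Decidable (λ ((b , c , d , e) : ℤ × ℤ × ℤ × ℤ) → Even (d + e))
    Q? (b , c , d , e) = Even? (d + e)
    A? : Decidable (λ ((b , c , d , e) : ℤ × ℤ × ℤ × ℤ) → b * b + (c * c + (d * d + e * e)) ≡ + m × Even (d + e))
    A? v = FourSquares? (+ m) v ×-dec Q? v
    rotate : ∀ b c d e → d * d + (e * e + (b * b + c * c)) ≡ b * b + (c * c + (d * d + e * e))
    rotate = solve-∀
    swapped : ∑[ Z⁴ N ∣ (λ v → FourSquares? (+ m) v ×-dec ¬? (Q? v)) ] (λ _ → 1ℤ) ≡ ∑[ Z⁴ N ∣ A? ] (λ _ → 1ℤ)
    swapped = ∑-reindex (Z⁴ N) (Z⁴ N) (λ v → FourSquares? (+ m) v ×-dec ¬? (Q? v)) A?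
      (λ (b , c , d , e) → d , e , b , c) (λ (b , c , d , e) → d , e , b , c)
      (λ v (eq , _) → FourSquares⊆Z⁴ m≤N v eq) (λ v (eq , _) → FourSquares⊆Z⁴ m≤N v eq)
      (λ (b , c , d , e) (eq , ¬even) → (trans (rotate b c d e) eq , to b c d e eq ¬even) , refl , refl)
      (λ (b , c , d , e) (eq , even) → (trans (rotate b c d e) eq , from b c d e eq even) , refl)
      where
      to : ∀ b c d e → b * b + (c * c + (d * d + e * e)) ≡ + m → ¬ Even (d + e) → Even (b + c)
      to b c d e eq ¬even with odd-sum-Even b c d e k odd eq
      ... | inj₁ (even , _) = even
      ... | inj₂ (_ , even) = contradiction even ¬even
      from : ∀ b c d e → b * b + (c * c + (d * d + e * e)) ≡ + m → Even (d + e) → ¬ Even (b + c)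
      from b c d e eq even with odd-sum-Even b c d e k odd eq
      ... | inj₁ (_ , ¬even) = contradiction even ¬even
      ... | inj₂ (¬even , _) = ¬even
    halved : ∑[ Z⁴ N ∣ A? ] (λ _ → 1ℤ) ≡ ∑[ Z⁴ N ∣ Form? m ] (λ _ → 1ℤ)
    halved = ∑-reindex (Z⁴ N) (Z⁴ N) A? (Form? m)
      (λ (b , c , d , e) → b , c , half (d + e) , half (d - e)) (λ (p , q , u , w) → p , q , u + w , u - w)
      (λ v (eq , _) → FourSquares⊆Z⁴ m≤N v eq) (Form⊆Z⁴ m≤N)
      (λ (b , c , d , e) (eq , even) → to b c d e eq even , ,₄-cong refl refl (mean d e even) (diff d e even) , refl)
      (λ (p , q , u , w) eq → (trans (l₂ p q u w) eq , u , l₃ u w) ,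
        ,₄-cong refl refl (trans (cong half (l₃ u w)) (half-2* u)) (trans (cong half (l₄ u w)) (half-2* w)))
      where
      l₁ : ∀ u w → + 2 * (+ 2 * (u * u) + + 2 * (w * w)) ≡ + 2 * u * (+ 2 * u) + + 2 * w * (+ 2 * w)
      l₁ = solve-∀
      l₁′ : ∀ d e → (d + e) * (d + e) + (d - e) * (d - e) ≡ + 2 * (d * d + e * e)
      l₁′ = solve-∀
      l₂ : ∀ p q u w → p * p + (q * q + ((u + w) * (u + w) + (u - w) * (u - w))) ≡
        p * p + (q * q + (+ 2 * (u * u) + + 2 * (w * w)))
      l₂ = solve-∀
      l₃ : ∀ u w → u + w + (u - w) ≡ + 2 * u
      l₃ = solve-∀
      l₄ : ∀ u w → u + w - (u - w) ≡ + 2 * w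
      l₄ = solve-∀
      l₅ : ∀ a b → + 2 * (a + b) ≡ + 2 * a + + 2 * b
      l₅ = solve-∀
      l₆ : ∀ d e → d + e + (d - e) ≡ + 2 * d
      l₆ = solve-∀
      l₇ : ∀ d e → d + e - (d - e) ≡ + 2 * e
      l₇ = solve-∀
      l₈ : ∀ a b → + 2 * (a - b) ≡ + 2 * a - + 2 * b
      l₈ = solve-∀
      mean : ∀ d e → Even (d + e) → half (d + e) + half (d - e) ≡ d
      mean d e even = ℤP.*-cancelˡ-≡ (+ 2) _ d (trans (l₅ (half (d + e)) (half (d - e)))
        (trans (cong₂ _+_ (2*half even) (2*half (Even-minus {d} {e} even))) (l₆ d e)))
      diff : ∀ d e → Even (d + e) → half (d + e) - half (d - e) ≡ e
      diff d e even = ℤP.*-cancelˡ-≡ (+ 2) _ e (trans (l₈ (half (d + e)) (half (d - e)))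
        (trans (cong₂ _-_ (2*half even) (2*half (Even-minus {d} {e} even))) (l₇ d e)))
      to : ∀ b c d e → b * b + (c * c + (d * d + e * e)) ≡ + m → Even (d + e) → Form m (b , c , half (d + e) , half (d - e))
      to b c d e eq even = trans (cong (λ z → b * b + (c * c + z)) (ℤP.*-cancelˡ-≡ (+ 2) _ (d * d + e * e)
        (trans (l₁ (half (d + e)) (half (d - e)))
          (trans (cong₂ (λ x y → x * x + y * y) (2*half even) (2*half (Even-minus {d} {e} even))) (l₁′ d e))))) eq

  -- From divisor pairs to σ

  +sum≡∑ : (xs : List ℕ) → + sum xs ≡ ∑ xs (λ x → + x)
  +sum≡∑ [] = refl
  +sum≡∑ (x ∷ xs) = cong (_+_ (+ x)) (+sum≡∑ xs)

  ∑-divisors≡σ : ∀ m .{{_ : ℕ.NonZero m}} {N} → m ℕ.≤ N → ∑[ Z N ⊗ Z N ∣ Divisors? (+ m) ] proj₁ ≡ + σ m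
  ∑-divisors≡σ m {N} m≤N = begin
    ∑[ Z N ⊗ Z N ∣ Divisors? (+ m) ] proj₁
      ≡⟨ ∑-reindex (Z N ⊗ Z N) Y (Divisors? (+ m)) (λ d → d ℕD.∣? m) (∣_∣ ∘ proj₁) (λ d → + d , cofactor d (d ℕD.∣? m))
           bounded divisor to from ⟩
    ∑ (map suc (upTo m)) (λ d → when (d ℕD.∣? m) (+ d))
      ≡⟨ ∑-filter (λ d → d ℕD.∣? m) (map suc (upTo m)) (λ d → + d) ⟨
    ∑ (filter (λ d → d ℕD.∣? m) (map suc (upTo m))) (λ d → + d)
      ≡⟨ +sum≡∑ (filter (λ d → d ℕD.∣? m) (map suc (upTo m))) ⟨
    + σ m ∎
    where
    Y : Box ℕ
    Y = box (map suc (upTo m)) ℕ._≟_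
    -- The inverse map has to be total, so the decision is an argument and non-divisors receive the
    -- default 0.
    cofactor : ∀ d → Dec (d ℕD.∣ m) → ℤ
    cofactor d (yes (ℕD.divides q _)) = + q
    cofactor d (no _) = 0ℤ
    natural : ∀ {d e} → 0ℤ < d → 0ℤ < e → d * e ≡ + m → ∃ λ j → ∃ λ k → d ≡ + suc j × e ≡ + suc k × suc j ℕ.* suc k ≡ m
    natural {+ suc j} {+ suc k} _ _ eq = j , k , refl , refl , ℤP.+-injective eq
    natural {+ zero} (+<+ ())
    natural {+ suc _} {+ zero} _ (+<+ ())
    bounded : ∀ v → Divisors (+ m) v → v ∈ Z N ⊗ Z N
    bounded (d , e) (d>0 , e>0 , eq) with natural d>0 e>0 eq
    ... | j , k , refl , refl , eq′ = ∈-⊗ (Z N) (Z N)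
      (∈-Z (ℕP.≤-trans (ℕP.≤-trans (ℕP.m≤m*n (suc j) (suc k)) (ℕP.≤-reflexive eq′)) m≤N))
      (∈-Z (ℕP.≤-trans (ℕP.≤-trans (ℕP.m≤n*m (suc k) (suc j)) (ℕP.≤-reflexive eq′)) m≤N))
    divisor : ∀ d → d ℕD.∣ m → d ∈ Y
    divisor zero 0∣m = contradiction (ℕD.0∣⇒≡0 0∣m) (ℕ.≢-nonZero⁻¹ m)
    divisor (suc d) d∣m f f0 = trans (∑-map suc (upTo m) f) (trans (∑-applyUpTo id m (f ∘ suc))
      (∑<-δ (ℕD.∣⇒≤ d∣m) (λ j j≢d → f0 (suc j) (j≢d ∘ ℕP.suc-injective))))
    to : ∀ v → Divisors (+ m) v →
      ∣ proj₁ v ∣ ℕD.∣ m × (+ ∣ proj₁ v ∣ , cofactor ∣ proj₁ v ∣ (∣ proj₁ v ∣ ℕD.∣? m)) ≡ v × proj₁ v ≡ + ∣ proj₁ v ∣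
    to (d , e) (d>0 , e>0 , eq) with natural d>0 e>0 eq
    ... | j , k , refl , refl , eq′ with suc j ℕD.∣? m
    ...   | yes (ℕD.divides q eq″) = subst (suc j ℕD.∣_) eq′ (ℕD.m∣m*n (suc k)) ,
      cong (λ z → + suc j , + z) (ℕP.*-cancelʳ-≡ q (suc k) (suc j) (trans (sym eq″) (trans (sym eq′) (ℕP.*-comm (suc j) (suc k))))) ,
      refl
    ...   | no ∤ = contradiction (subst (suc j ℕD.∣_) eq′ (ℕD.m∣m*n (suc k))) ∤
    from : ∀ d → d ℕD.∣ m → Divisors (+ m) (+ d , cofactor d (d ℕD.∣? m)) × d ≡ d
    from zero 0∣m = contradiction (ℕD.0∣⇒≡0 0∣m) (ℕ.≢-nonZero⁻¹ m)
    from (suc d) d∣m with suc d ℕD.∣? m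
    ... | no ∤ = contradiction d∣m ∤
    ... | yes (ℕD.divides zero eq′) = contradiction eq′ (ℕ.≢-nonZero⁻¹ m)
    ... | yes (ℕD.divides (suc q) eq′) = (+<+ (ℕ.s≤s ℕ.z≤n) , +<+ (ℕ.s≤s ℕ.z≤n) ,
      cong (λ z → + z) (trans (ℕP.*-comm (suc d) (suc q)) (sym eq′))) , refl

  -- Divisors of an odd m are odd, so `d-weight` reduces to d and r₄(m) = 8σ(m).
  Form≡4σ : ∀ m .{{_ : ℕ.NonZero m}} {N} k → + m ≡ + 2 * k + 1ℤ → 4 ℕ.* m ℕ.≤ N →
    ∑[ Z⁴ N ∣ Form? m ] (λ _ → 1ℤ) ≡ + 4 * + σ m
  Form≡4σ m {N} k odd 4m≤N = ℤP.*-cancelˡ-≡ (+ 2) _ (+ 4 * + σ m) (begin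
    + 2 * ∑[ Z⁴ N ∣ Form? m ] (λ _ → 1ℤ)
      ≡⟨ r₄≡2Form k odd m≤N ⟨
    r₄ N (+ m)
      ≡⟨ four-squares m 4m≤N ⟩
    when (+ m ≟ 0ℤ) 1ℤ + + 8 * divisorSum d-weight N (+ m)
      ≡⟨ cong₂ (λ x y → x + + 8 * y) (when-no (+ m ≟ 0ℤ) (ℕ.≢-nonZero⁻¹ m ∘ ℤP.+-injective))
           (trans (∑[]-map (Z N ⊗ Z N) (Divisors? (+ m)) (λ (d , e) (_ , _ , eq) → odd-divisor d e eq)) (∑-divisors≡σ m m≤N)) ⟩
    0ℤ + + 8 * + σ m
      ≡⟨ l (+ σ m) ⟩
    + 2 * (+ 4 * + σ m) ∎)
    where
    m≤N : m ℕ.≤ N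
    m≤N = ℕP.≤-trans (ℕP.m≤n*m m 4) 4m≤N
    l : ∀ x → 0ℤ + + 8 * x ≡ + 2 * (+ 4 * x)
    l = solve-∀
    odd-divisor : ∀ d e → d * e ≡ + m → d-weight (d , e) ≡ d
    odd-divisor d e eq with parity d
    ... | inj₁ (j , refl) = contradiction (trans (sym (ℤP.*-assoc (+ 2) j e)) (trans eq odd)) (2k≢2j+1 {j * e} {k})
    ... | inj₂ (j , refl) = trans (cong (λ z → (+ 2 * j + 1ℤ) * (1ℤ - + 2 * (z * ev e))) (ev-odd j)) (ℤP.*-identityʳ (+ 2 * j + 1ℤ))

  -- The sum of (-1)ʷ over the form

  +1-injective : ∀ {x y} → x + 1ℤ ≡ y + 1ℤ → x ≡ y
  +1-injective {x} {y} eq = trans (l x) (trans (cong (λ z → z - 1ℤ) eq) (sym (l y)))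
    where
    l : ∀ x → x ≡ x + 1ℤ - 1ℤ
    l = solve-∀

  sgn-sq : ∀ x → sgn (x * x) ≡ sgn x
  sgn-sq x = trans (sgn≡2ev-1 (x * x)) (trans (cong (λ z → + 2 * z - 1ℤ)
    (trans (cong (λ k → k * k) (κ-sq x)) (ev-idem x))) (sym (sgn≡2ev-1 x)))

  -- Averaging over the exchange of b and c replaces the sign by κ x, which depends on x alone; the
  -- two-square formula and χ d κ(de) = χ d κ e do the rest. Negative x are included because x will
  -- be the quotient (M - p²)/4.
  ∑sgn-two-squares : ∀ x {N} → (∀ k → x ≡ + k → 4 ℕ.* k ℕ.≤ N) →
    ∑[ Z N ⊗ Z N ∣ TwoSquares? x ] (λ (b , c) → sgn c) ≡
    when (x ≟ 0ℤ) 1ℤ + + 4 * ∑[ Z N ⊗ Z N ∣ Divisors? x ] (λ (d , e) → χ d * κ e)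
  ∑sgn-two-squares -[1+ k ] {N} _ = trans
    (∑[]-0 (Z N ⊗ Z N) (TwoSquares? -[1+ k ]) (λ (b , c) eq → contradiction eq (not-neg (0≤2sq b c))))
    (sym (lambert-neg (+ 4) (λ (d , e) → χ d * κ e) N k))
  ∑sgn-two-squares x@(+ k) {N} 4k≤N = ℤP.*-cancelˡ-≡ (+ 2) _ _ (begin
    + 2 * S
      ≡⟨ l₁ S ⟩
    S + S
      ≡⟨ cong (_+_ S) swapped ⟩
    S + ∑[ X ∣ TwoSquares? x ] (λ (b , c) → sgn b)
      ≡⟨ ∑[]-+ X (TwoSquares? x) (λ (b , c) → sgn c) (λ (b , c) → sgn b) ⟨
    ∑[ X ∣ TwoSquares? x ] (λ (b , c) → sgn c + sgn b)
      ≡⟨ ∑[]-map X (TwoSquares? x) (λ (b , c) eq → trans (ℤP.+-comm (sgn c) (sgn b))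
           (trans (sgn+sgn b c) (trans (cong (λ z → + 2 * κ z) eq) (sym (ℤP.*-identityʳ (+ 2 * κ x)))))) ⟩
    ∑[ X ∣ TwoSquares? x ] (λ _ → + 2 * κ x * 1ℤ)
      ≡⟨ ∑[]-*ˡ X (TwoSquares? x) (+ 2 * κ x) (λ _ → 1ℤ) ⟨
    + 2 * κ x * r₂ N x
      ≡⟨ cong (_*_ (+ 2 * κ x)) (two-squares k (4k≤N k refl)) ⟩
    + 2 * κ x * (when (x ≟ 0ℤ) 1ℤ + + 4 * divisorSum χ-weight N x)
      ≡⟨ l₂ (κ x) (when (x ≟ 0ℤ) 1ℤ) (divisorSum χ-weight N x) ⟩
    + 2 * (κ x * when (x ≟ 0ℤ) 1ℤ + + 4 * (κ x * divisorSum χ-weight N x))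
      ≡⟨ cong (_*_ (+ 2)) (cong₂ (λ a b → a + + 4 * b)
           (trans (when-*ˡ (x ≟ 0ℤ) (κ x) 1ℤ) (when-cong (x ≟ 0ℤ) (x ≟ 0ℤ) id id (λ x≡0 → cong (λ z → κ z * 1ℤ) x≡0)))
           (trans (∑[]-*ˡ X (Divisors? x) (κ x) χ-weight)
             (∑[]-map X (Divisors? x) (λ (d , e) (_ , _ , eq) → trans (ℤP.*-comm (κ x) (χ d))
               (trans (cong (λ z → χ d * κ z) (sym eq)) (χκ-* d e)))))) ⟩
    + 2 * (when (x ≟ 0ℤ) 1ℤ + + 4 * ∑[ X ∣ Divisors? x ] (λ (d , e) → χ d * κ e)) ∎)
    where
    X : Box (ℤ × ℤ)
    X = Z N ⊗ Z N
    S : ℤ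
    S = ∑[ X ∣ TwoSquares? x ] (λ (b , c) → sgn c)
    l₁ : ∀ x → + 2 * x ≡ x + x
    l₁ = solve-∀
    l₂ : ∀ k a b → + 2 * k * (a + + 4 * b) ≡ + 2 * (k * a + + 4 * (k * b))
    l₂ = solve-∀
    k≤N : k ℕ.≤ N
    k≤N = ℕP.≤-trans (ℕP.m≤n*m k 4) (4k≤N k refl)
    bounded : ∀ ((b , c) : ℤ × ℤ) → b * b + c * c ≡ x → (b , c) ∈ X
    bounded (b , c) eq = ∈-⊗ (Z N) (Z N)
      (∈-Z (ℕP.≤-trans (sq-≤ b _ (0≤sq c) eq) k≤N))
      (∈-Z (ℕP.≤-trans (sq-≤ c _ (0≤sq b) (trans (ℤP.+-comm (c * c) (b * b)) eq)) k≤N))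
    swapped : S ≡ ∑[ X ∣ TwoSquares? x ] (λ (b , c) → sgn b)
    swapped = ∑-reindex X X (TwoSquares? x) (TwoSquares? x) (λ (b , c) → c , b) (λ (b , c) → c , b) bounded bounded
      (λ (b , c) eq → trans (ℤP.+-comm (c * c) (b * b)) eq , refl , refl)
      (λ (b , c) eq → trans (ℤP.+-comm (c * c) (b * b)) eq , refl)

  Ternary? : ∀ M → Decidable (λ ((p , b , c) : ℤ × ℤ × ℤ) → p * p + + 4 * (b * b + c * c) ≡ + M)
  Ternary? M (p , b , c) = p * p + + 4 * (b * b + c * c) ≟ + M

  -- For fixed p the inner sum is a signed sum over two squares, and its divisor expansion is the
  -- slice at p of the left side of `∑χκ-roots`.
  ∑sgn-ternary : ∀ {M N} → 0 ℕ.< M → M ℕ.≤ N → κ (+ M) ≡ 0ℤ →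
    ∑[ Z³ N ∣ Ternary? M ] (λ (p , b , c) → sgn c) ≡ ∑[ Z N ∣ Root? M ] (λ p → p * χ p)
  ∑sgn-ternary {M} {N} M>0 M≤N κM = begin
    ∑[ Z³ N ∣ Ternary? M ] (λ (p , b , c) → sgn c)
      ≡⟨ ∑-⊗ (Z N) X _ ⟩
    ∑ Zs (λ p → ∑[ X ∣ (λ v → Ternary? M (p , v)) ] (λ (b , c) → sgn c))
      ≡⟨ ∑-cong Zs column ⟩
    ∑ Zs (λ p → when (Root? M p) 1ℤ + + 4 * ∑[ X ∣ (λ v → Ω? 4 M (p , v)) ] (λ (d , e) → χ d * κ e))
      ≡⟨ ∑-+ Zs _ _ ⟩
    ∑[ Z N ∣ Root? M ] (λ _ → 1ℤ) + ∑ Zs (λ p → + 4 * ∑[ X ∣ (λ v → Ω? 4 M (p , v)) ] (λ (d , e) → χ d * κ e))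
      ≡⟨ cong (_+_ (∑[ Z N ∣ Root? M ] (λ _ → 1ℤ))) (trans (sym (∑-*ˡ Zs (+ 4) _)) (cong (_*_ (+ 4)) (sym (∑-⊗ (Z N) X _)))) ⟩
    ∑[ Z N ∣ Root? M ] (λ _ → 1ℤ) + + 4 * ∑[ Z³ N ∣ Ω? 4 M ] (λ (p , d , e) → χ d * κ e)
      ≡⟨ ∑χκ-roots M>0 M≤N κM ⟩
    ∑[ Z N ∣ Root? M ] (λ p → p * χ p) ∎
    where
    Zs : List ℤ
    Zs = Box.elems (Z N)
    X : Box (ℤ × ℤ)
    X = Z N ⊗ Z N
    column : ∀ p → ∑[ X ∣ (λ v → Ternary? M (p , v)) ] (λ (b , c) → sgn c) ≡
      when (Root? M p) 1ℤ + + 4 * ∑[ X ∣ (λ v → Ω? 4 M (p , v)) ] (λ (d , e) → χ d * κ e)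
    column p with + 4 ℤD.∣? (+ M - p * p)
    ... | yes (ℤD.divides x eq) = begin
      ∑[ X ∣ (λ v → Ternary? M (p , v)) ] (λ (b , c) → sgn c)
        ≡⟨ ∑[]-cong X (λ v → Ternary? M (p , v)) (TwoSquares? x) (λ (b , c) → quot) (λ (b , c) → unquot) (λ _ _ → refl) ⟩
      ∑[ X ∣ TwoSquares? x ] (λ (b , c) → sgn c)
        ≡⟨ ∑sgn-two-squares x bound ⟩
      when (x ≟ 0ℤ) 1ℤ + + 4 * ∑[ X ∣ Divisors? x ] (λ (d , e) → χ d * κ e)
        ≡⟨ cong₂ (λ a b → a + + 4 * b)
             (when-cong (x ≟ 0ℤ) (Root? M p)
               (λ x≡0 → trans (sym (ℤP.+-identityʳ (p * p))) (unquot (sym x≡0)))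
               (λ root → sym (quot (trans (ℤP.+-identityʳ (p * p)) root)))
               (λ _ → refl))
             (∑[]-cong X (Divisors? x) (λ v → Ω? 4 M (p , v))
               (λ (d , e) (d>0 , e>0 , de≡x) → d>0 , e>0 , unquot de≡x)
               (λ (d , e) (d>0 , e>0 , ω) → d>0 , e>0 , quot ω) (λ _ _ → refl)) ⟩
      when (Root? M p) 1ℤ + + 4 * ∑[ X ∣ (λ v → Ω? 4 M (p , v)) ] (λ (d , e) → χ d * κ e) ∎
      where
      quot : ∀ {y} → p * p + + 4 * y ≡ + M → y ≡ x
      quot {y} eq′ = ℤP.*-cancelˡ-≡ (+ 4) y x (trans (x+y≡z⇒y≡z-x (p * p) (+ 4 * y) (+ M) eq′) (trans eq (ℤP.*-comm x (+ 4))))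
      unquot : ∀ {y} → y ≡ x → p * p + + 4 * y ≡ + M
      unquot {y} refl = y≡z-x⇒x+y≡z (p * p) (+ 4 * y) (+ M) (trans (ℤP.*-comm (+ 4) y) (sym eq))
      bound : ∀ k → x ≡ + k → 4 ℕ.* k ℕ.≤ N
      bound k refl = ℕP.≤-trans (ℕP.≤-trans (ℕP.m≤n+m (4 ℕ.* k) (∣ p ∣ ℕ.* ∣ p ∣)) (ℕP.≤-reflexive (ℤP.+-injective
        (trans (cong₂ _+_ (sym (sq≡+ p)) (ℤP.pos-* 4 k)) (unquot refl))))) M≤N
    -- When 4 does not divide M - p², none of the equations is solvable, so both sides vanish.
    ... | no ∤ = trans
      (∑[]-0 X (λ v → Ternary? M (p , v)) (λ (b , c) eq → contradiction eq (never (b * b + c * c))))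
      (sym (cong₂ (λ a b → a + + 4 * b)
        (when-no (Root? M p) (λ root → never 0ℤ (trans (ℤP.+-identityʳ (p * p)) root)))
        (∑[]-0 X (λ v → Ω? 4 M (p , v)) (λ (d , e) (_ , _ , eq) → contradiction eq (never (d * e))))))
      where
      never : ∀ y → p * p + + 4 * y ≢ + M
      never y eq = ∤ (ℤD.divides y (trans (sym (x+y≡z⇒y≡z-x (p * p) (+ 4 * y) (+ M) eq)) (ℤP.*-comm (+ 4) y)))

  Quaternary : ℕ → ℤ × ℤ × ℤ × ℤ → Set
  Quaternary m (a , p , b , c) = + 4 * (a * a) + (p * p + + 4 * (b * b + c * c)) ≡ + m

  Quaternary? : ∀ m → Decidable (Quaternary m)
  Quaternary? m (a , p , b , c) = + 4 * (a * a) + (p * p + + 4 * (b * b + c * c)) ≟ + m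

  Binary? : ∀ m → Decidable (λ ((a , p) : ℤ × ℤ) → + 4 * (a * a) + p * p ≡ + m)
  Binary? m (a , p) = + 4 * (a * a) + p * p ≟ + m

  Quaternary⊆Z⁴ : ∀ {m N} → m ℕ.≤ N → ∀ v → Quaternary m v → v ∈ Z⁴ N
  Quaternary⊆Z⁴ m≤N (a , p , b , c) eq = ∈-Z⁴
    (ℕP.≤-trans (sq-≤ a _ (0≤3+ a (0≤sq+ p (0≤* 4 (0≤2sq b c)))) (trans (l₁ a p b c) eq)) m≤N)
    (ℕP.≤-trans (sq-≤ p _ (ℤP.+-mono-≤ (0≤* 4 (0≤sq a)) (0≤* 4 (0≤2sq b c))) (trans (l₂ a p b c) eq)) m≤N)
    (ℕP.≤-trans (sq-≤ b _ (0≤3+ b (0≤sq+ p (0≤* 4 (0≤2sq a c)))) (trans (l₃ a p b c) eq)) m≤N)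
    (ℕP.≤-trans (sq-≤ c _ (0≤3+ c (0≤sq+ p (0≤* 4 (0≤2sq a b)))) (trans (l₄ a p b c) eq)) m≤N)
    where
    0≤3+ : ∀ x {r} → 0ℤ ≤ r → 0ℤ ≤ + 3 * (x * x) + r
    0≤3+ x = ℤP.+-mono-≤ (0≤* 3 (0≤sq x))
    l₁ : ∀ a p b c → a * a + (+ 3 * (a * a) + (p * p + + 4 * (b * b + c * c))) ≡ + 4 * (a * a) + (p * p + + 4 * (b * b + c * c))
    l₁ = solve-∀
    l₂ : ∀ a p b c → p * p + (+ 4 * (a * a) + + 4 * (b * b + c * c)) ≡ + 4 * (a * a) + (p * p + + 4 * (b * b + c * c))
    l₂ = solve-∀
    l₃ : ∀ a p b c → b * b + (+ 3 * (b * b) + (p * p + + 4 * (a * a + c * c))) ≡ + 4 * (a * a) + (p * p + + 4 * (b * b + c * c))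
    l₃ = solve-∀
    l₄ : ∀ a p b c → c * c + (+ 3 * (c * c) + (p * p + + 4 * (a * a + b * b))) ≡ + 4 * (a * a) + (p * p + + 4 * (b * b + c * c))
    l₄ = solve-∀

  -- Slicing by a leaves the ternary problem for M = m - 4a². If M is negative both slices are
  -- empty; otherwise M is odd like m, hence positive as required.
  ∑sgn-quaternary : ∀ {m N} → m ℕ.≤ N → κ (+ m) ≡ 0ℤ →
    ∑[ Z⁴ N ∣ Quaternary? m ] (λ (a , p , b , c) → sgn c) ≡ ∑[ Z N ⊗ Z N ∣ Binary? m ] (λ (a , p) → p * χ p)
  ∑sgn-quaternary {m} {N} m≤N κm = begin
    ∑[ Z⁴ N ∣ Quaternary? m ] (λ (a , p , b , c) → sgn c)
      ≡⟨ ∑-⊗ (Z N) (Z³ N) _ ⟩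
    ∑ (Box.elems (Z N)) (λ a → ∑[ Z³ N ∣ (λ v → Quaternary? m (a , v)) ] (λ (p , b , c) → sgn c))
      ≡⟨ ∑-cong (Box.elems (Z N)) (λ a → slice a (+ m - + 4 * (a * a)) refl) ⟩
    ∑ (Box.elems (Z N)) (λ a → ∑[ Z N ∣ (λ p → Binary? m (a , p)) ] (λ p → p * χ p))
      ≡⟨ ∑-⊗ (Z N) (Z N) _ ⟨
    ∑[ Z N ⊗ Z N ∣ Binary? m ] (λ (a , p) → p * χ p) ∎
    where
    slice : ∀ a M → + m - + 4 * (a * a) ≡ M →
      ∑[ Z³ N ∣ (λ v → Quaternary? m (a , v)) ] (λ (p , b , c) → sgn c) ≡
      ∑[ Z N ∣ (λ p → Binary? m (a , p)) ] (λ p → p * χ p)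
    slice a -[1+ k ] eq = trans
      (∑[]-0 (Z³ N) (λ v → Quaternary? m (a , v)) (λ (p , b , c) eq′ → contradiction
        (trans (x+y≡z⇒y≡z-x (+ 4 * (a * a)) _ (+ m) eq′) eq) (not-neg (0≤sq+ p (0≤* 4 (0≤2sq b c))))))
      (sym (∑[]-0 (Z N) (λ p → Binary? m (a , p)) (λ p eq′ → contradiction
        (trans (x+y≡z⇒y≡z-x (+ 4 * (a * a)) _ (+ m) eq′) eq) (not-neg (0≤sq p)))))
    slice a (+ M) eq = begin
      ∑[ Z³ N ∣ (λ v → Quaternary? m (a , v)) ] (λ (p , b , c) → sgn c)
        ≡⟨ ∑[]-cong (Z³ N) (λ v → Quaternary? m (a , v)) (Ternary? M)
             (λ (p , b , c) eq′ → trans (x+y≡z⇒y≡z-x (+ 4 * (a * a)) _ (+ m) eq′) eq)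
             (λ (p , b , c) eq′ → y≡z-x⇒x+y≡z (+ 4 * (a * a)) _ (+ m) (trans eq′ (sym eq))) (λ _ _ → refl) ⟩
      ∑[ Z³ N ∣ Ternary? M ] (λ (p , b , c) → sgn c)
        ≡⟨ ∑sgn-ternary (M>0 M refl) (ℕP.≤-trans M≤m m≤N) κM ⟩
      ∑[ Z N ∣ Root? M ] (λ p → p * χ p)
        ≡⟨ ∑[]-cong (Z N) (Root? M) (λ p → Binary? m (a , p))
             (λ p eq′ → y≡z-x⇒x+y≡z (+ 4 * (a * a)) _ (+ m) (trans eq′ (sym eq)))
             (λ p eq′ → trans (x+y≡z⇒y≡z-x (+ 4 * (a * a)) _ (+ m) eq′) eq) (λ _ _ → refl) ⟩
      ∑[ Z N ∣ (λ p → Binary? m (a , p)) ] (λ p → p * χ p) ∎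
      where
      total : + 2 * (+ 2 * (a * a)) + + M ≡ + m
      total = trans (l (a * a) (+ M)) (y≡z-x⇒x+y≡z (+ 4 * (a * a)) (+ M) (+ m) (sym eq))
        where
        l : ∀ x M → + 2 * (+ 2 * x) + M ≡ + 4 * x + M
        l = solve-∀
      κM : κ (+ M) ≡ 0ℤ
      κM = begin
        κ (+ M)                                  ≡⟨ ℤP.*-identityˡ _ ⟨
        1ℤ * κ (+ M)                             ≡⟨ cong (λ z → z * κ (+ M)) (sgn-2* (a * a)) ⟨
        sgn (+ 2 * (a * a)) * κ (+ M)            ≡⟨ κ-2*-+ (+ 2 * (a * a)) (+ M) ⟨
        κ (+ 2 * (+ 2 * (a * a)) + + M)          ≡⟨ cong κ total ⟩
        κ (+ m)                                  ≡⟨ κm ⟩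
        0ℤ ∎
      M>0 : ∀ M′ → M′ ≡ M → 0 ℕ.< M′
      M>0 zero refl = contradiction κM (λ ())
      M>0 (suc _) _ = ℕ.s≤s ℕ.z≤n
      M≤m : M ℕ.≤ m
      M≤m = ℤP.drop‿+≤+ (subst (_≤ + m) (ℤP.+-identityˡ (+ M)) (subst (0ℤ + + M ≤_) total
        (ℤP.+-monoˡ-≤ (+ M) (0≤* 2 (0≤* 2 (0≤sq a))))))

  -- Here p = 2j + 1 is odd, and dividing by 4 gives k = a² + (j² + j) + b² + c². As j² + j is even
  -- and x² ≡ x mod 2, this means k ≡ a + b + c.
  sgn-quaternary : ∀ {m} k a p b c → + m ≡ + 4 * k + 1ℤ → Quaternary m (a , p , b , c) → sgn (b - c) ≡ sgn k * sgn a
  sgn-quaternary {m} k a p b c m≡ eq with parity p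
  ... | inj₁ (j , refl) = contradiction
    (trans (l a j (b * b + c * c)) (trans eq (trans m≡ (l′ k))))
    (2k≢2j+1 {+ 2 * (a * a) + + 2 * (j * j) + + 2 * (b * b + c * c)} {+ 2 * k})
    where
    l : ∀ a j r → + 2 * (+ 2 * (a * a) + + 2 * (j * j) + + 2 * r) ≡ + 4 * (a * a) + (+ 2 * j * (+ 2 * j) + + 4 * r)
    l = solve-∀
    l′ : ∀ k → + 4 * k + 1ℤ ≡ + 2 * (+ 2 * k) + 1ℤ
    l′ = solve-∀
  ... | inj₂ (j , refl) = begin
    sgn (b - c)                                            ≡⟨ sgn-+ b (- c) ⟩
    sgn b * sgn (- c)                                      ≡⟨ cong (_*_ (sgn b)) (sgn-neg c) ⟩
    sgn b * sgn c                                          ≡⟨ l₁ (sgn b * sgn c) ⟩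
    1ℤ * (sgn b * sgn c) * 1ℤ                              ≡⟨ cong₂ (λ x y → x * (sgn b * sgn c) * y) (sgn²≡1 j) (sgn²≡1 a) ⟨
    sgn j * sgn j * (sgn b * sgn c) * (sgn a * sgn a)      ≡⟨ l₂ (sgn j) (sgn b) (sgn c) (sgn a) ⟩
    sgn a * ((sgn j * sgn j) * (sgn b * sgn c)) * sgn a    ≡⟨ cong (λ z → z * sgn a) sgn-k ⟨
    sgn k * sgn a ∎
    where
    l₁ : ∀ x → x ≡ 1ℤ * x * 1ℤ
    l₁ = solve-∀
    l₂ : ∀ j b c a → j * j * (b * c) * (a * a) ≡ a * ((j * j) * (b * c)) * a
    l₂ = solve-∀
    l₃ : ∀ a j r → + 4 * (a * a) + ((+ 2 * j + 1ℤ) * (+ 2 * j + 1ℤ) + + 4 * r) ≡ + 4 * (a * a + ((j * j + j) + r)) + 1ℤ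
    l₃ = solve-∀
    k≡ : a * a + ((j * j + j) + (b * b + c * c)) ≡ k
    k≡ = ℤP.*-cancelˡ-≡ (+ 4) _ k (+1-injective (trans (sym (l₃ a j (b * b + c * c))) (trans eq m≡)))
    sgn-k : sgn k ≡ sgn a * ((sgn j * sgn j) * (sgn b * sgn c))
    sgn-k = trans (cong sgn (sym k≡)) (trans (sgn-+ (a * a) _) (cong₂ _*_ (sgn-sq a)
      (trans (sgn-+ (j * j + j) _) (cong₂ _*_
        (trans (sgn-+ (j * j) j) (cong (λ z → z * sgn j) (sgn-sq j)))
        (trans (sgn-+ (b * b) (c * c)) (cong₂ _*_ (sgn-sq b) (sgn-sq c)))))))

  -- Exactly one of p and q is even, and exchanging them gives the factor 2. With q = 2a the sum u +
  -- w is even, so u = b + c and w = b - c lead to p² + 4(a² + b² + c²); `sgn-quaternary` then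
  -- rewrites the sign of w.
  ∑sgn-Form : ∀ {m N} k → + m ≡ + 4 * k + 1ℤ → m ℕ.≤ N →
    ∑[ Z⁴ N ∣ Form? m ] (λ (p , q , u , w) → sgn w) ≡
    + 2 * (sgn k * ∑[ Z N ⊗ Z N ∣ Binary? m ] (λ (a , p) → p * χ p))
  ∑sgn-Form {m} {N} k m≡ m≤N = begin
    ∑[ Z⁴ N ∣ Form? m ] f
      ≡⟨ ∑-split (Z⁴ N) (Form? m) Q? f ⟩
    ∑[ Z⁴ N ∣ A? ] f + ∑[ Z⁴ N ∣ (λ v → Form? m v ×-dec ¬? (Q? v)) ] f
      ≡⟨ cong (_+_ (∑[ Z⁴ N ∣ A? ] f)) swapped ⟩
    ∑[ Z⁴ N ∣ A? ] f + ∑[ Z⁴ N ∣ A? ] f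
      ≡⟨ l (∑[ Z⁴ N ∣ A? ] f) ⟩
    + 2 * ∑[ Z⁴ N ∣ A? ] f
      ≡⟨ cong (_*_ (+ 2)) (begin
           ∑[ Z⁴ N ∣ A? ] f
             ≡⟨ halved ⟩
           ∑[ Z⁴ N ∣ Quaternary? m ] (λ (a , p , b , c) → sgn (b - c))
             ≡⟨ ∑[]-map (Z⁴ N) (Quaternary? m) (λ (a , p , b , c) eq → sgn-quaternary k a p b c m≡ eq) ⟩
           ∑[ Z⁴ N ∣ Quaternary? m ] (λ (a , p , b , c) → sgn k * sgn a)
             ≡⟨ ∑[]-*ˡ (Z⁴ N) (Quaternary? m) (sgn k) (λ (a , p , b , c) → sgn a) ⟨
           sgn k * ∑[ Z⁴ N ∣ Quaternary? m ] (λ (a , p , b , c) → sgn a)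
             ≡⟨ cong (_*_ (sgn k)) (trans exchanged (∑sgn-quaternary m≤N (trans (cong κ (trans m≡ (l′ k))) (κ-odd (+ 2 * k))))) ⟩
           sgn k * ∑[ Z N ⊗ Z N ∣ Binary? m ] (λ (a , p) → p * χ p) ∎) ⟩
    + 2 * (sgn k * ∑[ Z N ⊗ Z N ∣ Binary? m ] (λ (a , p) → p * χ p)) ∎
    where
    f : ℤ × ℤ × ℤ × ℤ → ℤ
    f (p , q , u , w) = sgn w
    Q? : Decidable (λ ((p , q , u , w) : ℤ × ℤ × ℤ × ℤ) → Even q)
    Q? (p , q , u , w) = Even? q
    A? : Decidable (λ (v : ℤ × ℤ × ℤ × ℤ) → Form m v × Even (proj₁ (proj₂ v)))
    A? v = Form? m v ×-dec Q? v
    l : ∀ x → x + x ≡ + 2 * x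
    l = solve-∀
    l′ : ∀ k → + 4 * k + 1ℤ ≡ + 2 * (+ 2 * k) + 1ℤ
    l′ = solve-∀
    exchange : ∀ p q r → q * q + (p * p + r) ≡ p * p + (q * q + r)
    exchange = solve-∀
    not-both-even : ∀ {p q u w} → Form m (p , q , u , w) → Even p → ¬ Even q
    not-both-even {u = u} {w} eq (i , refl) (j , refl) = 2k≢2j+1 {+ 2 * (i * i) + + 2 * (j * j) + (u * u + w * w)} {+ 2 * k}
      (trans (l₁ i j u w) (trans eq (trans m≡ (l′ k))))
      where
      l₁ : ∀ i j u w → + 2 * (+ 2 * (i * i) + + 2 * (j * j) + (u * u + w * w)) ≡
        + 2 * i * (+ 2 * i) + (+ 2 * j * (+ 2 * j) + (+ 2 * (u * u) + + 2 * (w * w)))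
      l₁ = solve-∀
    one-even : ∀ {p q u w} → Form m (p , q , u , w) → ¬ Even q → Even p
    one-even {p} {q} {u} {w} eq q-odd with parity p | ¬Even⇒odd q-odd
    ... | inj₁ even | _ = even
    ... | inj₂ (i , refl) | j , refl = contradiction
      (trans (l₁ i j u w) (trans eq (trans m≡ (l′ k))))
      (2k≢2j+1 {+ 2 * (i * i + i) + + 2 * (j * j + j) + 1ℤ + (u * u + w * w)} {+ 2 * k})
      where
      l₁ : ∀ i j u w → + 2 * (+ 2 * (i * i + i) + + 2 * (j * j + j) + 1ℤ + (u * u + w * w)) ≡
        (+ 2 * i + 1ℤ) * (+ 2 * i + 1ℤ) + ((+ 2 * j + 1ℤ) * (+ 2 * j + 1ℤ) + (+ 2 * (u * u) + + 2 * (w * w)))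
      l₁ = solve-∀
    swapped : ∑[ Z⁴ N ∣ (λ v → Form? m v ×-dec ¬? (Q? v)) ] f ≡ ∑[ Z⁴ N ∣ A? ] f
    swapped = ∑-reindex (Z⁴ N) (Z⁴ N) (λ v → Form? m v ×-dec ¬? (Q? v)) A?
      (λ (p , q , u , w) → q , p , u , w) (λ (p , q , u , w) → q , p , u , w)
      (λ v (eq , _) → Form⊆Z⁴ m≤N v eq) (λ v (eq , _) → Form⊆Z⁴ m≤N v eq)
      (λ (p , q , u , w) (eq , q-odd) → (trans (exchange p q _) eq , one-even {p} {q} {u} {w} eq q-odd) , refl , refl)
      (λ (p , q , u , w) (eq , q-even) → (trans (exchange p q _) eq ,
        λ p-even → not-both-even {p} {q} {u} {w} eq p-even q-even) , refl)
    -- The sign now sits on a, but the slicing by a needs it on one of the inner variables; the form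
    -- is symmetric in a and c.
    exchanged : ∑[ Z⁴ N ∣ Quaternary? m ] (λ (a , p , b , c) → sgn a) ≡ ∑[ Z⁴ N ∣ Quaternary? m ] (λ (a , p , b , c) → sgn c)
    exchanged = ∑-reindex (Z⁴ N) (Z⁴ N) (Quaternary? m) (Quaternary? m)
      (λ (a , p , b , c) → c , p , b , a) (λ (a , p , b , c) → c , p , b , a)
      (Quaternary⊆Z⁴ m≤N) (Quaternary⊆Z⁴ m≤N)
      (λ (a , p , b , c) eq → trans (l₁ a p b c) eq , refl , refl)
      (λ (a , p , b , c) eq → trans (l₁ a p b c) eq , refl)
      where
      l₁ : ∀ a p b c → + 4 * (c * c) + (p * p + + 4 * (b * b + a * a)) ≡ + 4 * (a * a) + (p * p + + 4 * (b * b + c * c))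
      l₁ = solve-∀
    -- Subtracting p² + q² = 4(j² + j + a²) + 1 from m = 4k + 1 shows that 2(u² + w²) is divisible
    -- by 4.
    sum-even : ∀ {p q u w} → Form m (p , q , u , w) → Even q → Even (u + w)
    sum-even {p} {q} {u} {w} eq q-even@(a , refl) with ¬Even⇒odd {p} (λ p-even → not-both-even {p} {q} {u} {w} eq p-even q-even)
    ... | j , refl = even-root (u + w) (k - j * j - j - a * a + u * w) (begin
      (u + w) * (u + w)                                ≡⟨ l₁ u w ⟩
      u * u + w * w + + 2 * (u * w)                    ≡⟨ cong (λ z → z + + 2 * (u * w)) halved-eq ⟩
      + 2 * (k - j * j - j - a * a) + + 2 * (u * w)    ≡⟨ ℤP.*-distribˡ-+ (+ 2) (k - j * j - j - a * a) (u * w) ⟨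
      + 2 * (k - j * j - j - a * a + u * w) ∎)
      where
      l₁ : ∀ u w → (u + w) * (u + w) ≡ u * u + w * w + + 2 * (u * w)
      l₁ = solve-∀
      l₂ : ∀ j a u w → + 2 * (u * u + w * w) ≡
        (+ 2 * j + 1ℤ) * (+ 2 * j + 1ℤ) + (+ 2 * a * (+ 2 * a) + (+ 2 * (u * u) + + 2 * (w * w))) -
        (+ 4 * (j * j + j + a * a) + 1ℤ)
      l₂ = solve-∀
      l₃ : ∀ k j a → + 4 * k + 1ℤ - (+ 4 * (j * j + j + a * a) + 1ℤ) ≡ + 2 * (+ 2 * (k - j * j - j - a * a))
      l₃ = solve-∀
      halved-eq : u * u + w * w ≡ + 2 * (k - j * j - j - a * a)
      halved-eq = ℤP.*-cancelˡ-≡ (+ 2) _ _ (trans (l₂ j a u w) (trans (cong (λ z → z - (+ 4 * (j * j + j + a * a) + 1ℤ))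
        (trans eq m≡)) (l₃ k j a)))
    halved : ∑[ Z⁴ N ∣ A? ] f ≡ ∑[ Z⁴ N ∣ Quaternary? m ] (λ (a , p , b , c) → sgn (b - c))
    halved = ∑-reindex (Z⁴ N) (Z⁴ N) A? (Quaternary? m)
      (λ (p , q , u , w) → half q , p , half (u + w) , half (u - w)) (λ (a , p , b , c) → p , + 2 * a , b + c , b - c)
      (λ v (eq , _) → Form⊆Z⁴ m≤N v eq) (Quaternary⊆Z⁴ m≤N)
      (λ (p , q , u , w) (eq , q-even) → let uw-even = sum-even {p} {q} {u} {w} eq q-even in
        to p q u w eq q-even uw-even , ,₄-cong refl (2*half q-even) (mean u w uw-even) (diff u w uw-even) ,
        cong sgn (sym (diff u w uw-even)))
      (λ (a , p , b , c) eq → (trans (l₂ a p b c) eq , a , refl) ,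
        ,₄-cong (half-2* a) refl (trans (cong half (l₃ b c)) (half-2* b)) (trans (cong half (l₄ b c)) (half-2* c)))
      where
      l₁ : ∀ a p b c → + 4 * (a * a) + (p * p + + 4 * (b * b + c * c)) ≡
        p * p + (+ 2 * a * (+ 2 * a) + (+ 2 * b * (+ 2 * b) + + 2 * c * (+ 2 * c)))
      l₁ = solve-∀
      l₁′ : ∀ u w → (u + w) * (u + w) + (u - w) * (u - w) ≡ + 2 * (u * u) + + 2 * (w * w)
      l₁′ = solve-∀
      l₂ : ∀ a p b c → p * p + (+ 2 * a * (+ 2 * a) + (+ 2 * ((b + c) * (b + c)) + + 2 * ((b - c) * (b - c)))) ≡
        + 4 * (a * a) + (p * p + + 4 * (b * b + c * c))
      l₂ = solve-∀
      l₃ : ∀ u w → u + w + (u - w) ≡ + 2 * u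
      l₃ = solve-∀
      l₄ : ∀ u w → u + w - (u - w) ≡ + 2 * w
      l₄ = solve-∀
      l₅ : ∀ a b → + 2 * (a + b) ≡ + 2 * a + + 2 * b
      l₅ = solve-∀
      l₆ : ∀ a b → + 2 * (a - b) ≡ + 2 * a - + 2 * b
      l₆ = solve-∀
      mean : ∀ u w → Even (u + w) → half (u + w) + half (u - w) ≡ u
      mean u w even = ℤP.*-cancelˡ-≡ (+ 2) _ u (trans (l₅ (half (u + w)) (half (u - w)))
        (trans (cong₂ _+_ (2*half even) (2*half (Even-minus {u} {w} even))) (l₃ u w)))
      diff : ∀ u w → Even (u + w) → half (u + w) - half (u - w) ≡ w
      diff u w even = ℤP.*-cancelˡ-≡ (+ 2) _ w (trans (l₆ (half (u + w)) (half (u - w)))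
        (trans (cong₂ _-_ (2*half even) (2*half (Even-minus {u} {w} even))) (l₄ u w)))
      to : ∀ p q u w → Form m (p , q , u , w) → Even q → Even (u + w) → Quaternary m (half q , p , half (u + w) , half (u - w))
      to p q u w eq q-even uw-even = trans (l₁ (half q) p (half (u + w)) (half (u - w)))
        (trans (cong₂ (λ x y → p * p + (x * x + y)) (2*half q-even)
          (trans (cong₂ (λ x y → x * x + y * y) (2*half uw-even) (2*half (Even-minus {u} {w} uw-even))) (l₁′ u w))) eq)

  ∑sgn-Form-0 : ∀ {m N} k → + m ≡ + 4 * k + + 3 → m ℕ.≤ N → ∑[ Z⁴ N ∣ Form? m ] (λ (p , q , u , w) → sgn w) ≡ 0ℤ
  ∑sgn-Form-0 {m} {N} k m≡ m≤N = ℤP.*-cancelˡ-≡ (+ 2) _ 0ℤ (begin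
    + 2 * ∑[ Z⁴ N ∣ Form? m ] f
      ≡⟨ l (∑[ Z⁴ N ∣ Form? m ] f) ⟩
    ∑[ Z⁴ N ∣ Form? m ] f + ∑[ Z⁴ N ∣ Form? m ] f
      ≡⟨ cong (_+_ (∑[ Z⁴ N ∣ Form? m ] f)) swapped ⟩
    ∑[ Z⁴ N ∣ Form? m ] f + ∑[ Z⁴ N ∣ Form? m ] (λ (p , q , u , w) → sgn u)
      ≡⟨ ∑[]-+ (Z⁴ N) (Form? m) f _ ⟨
    ∑[ Z⁴ N ∣ Form? m ] (λ (p , q , u , w) → sgn w + sgn u)
      ≡⟨ ∑[]-0 (Z⁴ N) (Form? m) (λ (p , q , u , w) eq → trans (ℤP.+-comm (sgn w) (sgn u))
           (trans (sgn+sgn u w) (cong (_*_ (+ 2)) (κ≡0 p q u w eq)))) ⟩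
    0ℤ ∎)
    where
    f : ℤ × ℤ × ℤ × ℤ → ℤ
    f (p , q , u , w) = sgn w
    l : ∀ x → + 2 * x ≡ x + x
    l = solve-∀
    l₁ : ∀ p q u w → p * p + (q * q + (+ 2 * (w * w) + + 2 * (u * u))) ≡ p * p + (q * q + (+ 2 * (u * u) + + 2 * (w * w)))
    l₁ = solve-∀
    swapped : ∑[ Z⁴ N ∣ Form? m ] f ≡ ∑[ Z⁴ N ∣ Form? m ] (λ (p , q , u , w) → sgn u)
    swapped = ∑-reindex (Z⁴ N) (Z⁴ N) (Form? m) (Form? m)
      (λ (p , q , u , w) → p , q , w , u) (λ (p , q , u , w) → p , q , w , u)
      (Form⊆Z⁴ m≤N) (Form⊆Z⁴ m≤N)
      (λ (p , q , u , w) eq → trans (l₁ p q u w) eq , refl , refl)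
      (λ (p , q , u , w) eq → trans (l₁ p q u w) eq , refl)
    -- A sum of two squares is never 3 mod 4, the class on which χ is -1.
    χ-sum : ∀ p q → χ (p * p + q * q) ≢ - 1ℤ
    χ-sum p q eq with trans (sym (trans (χ-+ (p * p) (q * q))
        (cong₂ _+_ (cong₂ _*_ (χ-sq p) (κ-sq q)) (cong₂ _*_ (κ-sq p) (χ-sq q))))) eq | ev-01 p | ev-01 q
      where
      ev-01 : ∀ x → ev x ≡ 0ℤ ⊎ ev x ≡ 1ℤ
      ev-01 x with parity x
      ... | inj₁ (j , refl) = inj₂ (ev-2* j)
      ... | inj₂ (j , refl) = inj₁ (ev-odd j)
    ... | eq′ | inj₁ p0 | inj₁ q0 rewrite p0 | q0 = contradiction eq′ λ ()
    ... | eq′ | inj₁ p0 | inj₂ q1 rewrite p0 | q1 = contradiction eq′ λ ()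
    ... | eq′ | inj₂ p1 | inj₁ q0 rewrite p1 | q0 = contradiction eq′ λ ()
    ... | eq′ | inj₂ p1 | inj₂ q1 rewrite p1 | q1 = contradiction eq′ λ ()
    -- If u² + w² were even, then p² + q² ≡ m ≡ 3 mod 4.
    κ≡0 : ∀ p q u w → Form m (p , q , u , w) → κ (u * u + w * w) ≡ 0ℤ
    κ≡0 p q u w eq with parity (u * u + w * w)
    ... | inj₂ (j , odd) = trans (cong κ odd) (κ-odd j)
    ... | inj₁ (j , even) = contradiction (begin
      χ (p * p + q * q)
        ≡⟨ cong χ (l₂ (p * p) (q * q) u w) ⟩
      χ (p * p + (q * q + (+ 2 * (u * u) + + 2 * (w * w))) - + 2 * (u * u + w * w))
        ≡⟨ cong₂ (λ x y → χ (x - + 2 * y)) (trans eq m≡) even ⟩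
      χ (+ 4 * k + + 3 - + 2 * (+ 2 * j))
        ≡⟨ cong χ (l₃ k j) ⟩
      χ (+ 2 * (+ 2 * (k - j)) + + 3)
        ≡⟨ χ-2*-+ (+ 2 * (k - j)) (+ 3) ⟩
      sgn (+ 2 * (k - j)) * - 1ℤ
        ≡⟨ cong (λ z → z * - 1ℤ) (sgn-2* (k - j)) ⟩
      - 1ℤ ∎) (χ-sum p q)
      where
      l₂ : ∀ x y u w → x + y ≡ x + (y + (+ 2 * (u * u) + + 2 * (w * w))) - + 2 * (u * u + w * w)
      l₂ = solve-∀
      l₃ : ∀ k j → + 4 * k + + 3 - + 2 * (+ 2 * j) ≡ + 2 * (+ 2 * (k - j)) + + 3
      l₃ = solve-∀

  -- Triangular numbers

  ∑-pairs : ∀ K (f : ℤ × ℤ → ℤ) → ∑ (pairs K) f ≡ ∑ (Box.elems (Z K ⊗ Z K)) f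
  ∑-pairs K f = begin
    ∑ (pairs K) f
      ≡⟨ ∑-concatMap (λ r → map (λ s → r , s) (range K)) (range K) f ⟩
    ∑ (range K) (λ r → ∑ (map (λ s → r , s) (range K)) f)
      ≡⟨ ∑-cong (range K) (λ r → ∑-map (λ s → r , s) (range K) f) ⟩
    ∑ (range K) (λ r → ∑ (range K) (λ s → f (r , s)))
      ≡⟨ ∑-cong (range K) (λ r → ∑-Z K (λ s → f (r , s))) ⟨
    ∑ (range K) (λ r → ∑ (Box.elems (Z K)) (λ s → f (r , s)))
      ≡⟨ ∑-Z K (λ r → ∑ (Box.elems (Z K)) (λ s → f (r , s))) ⟨
    ∑ (Box.elems (Z K)) (λ r → ∑ (Box.elems (Z K)) (λ s → f (r , s)))
      ≡⟨ ∑-⊗ (Z K) (Z K) f ⟨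
    ∑ (Box.elems (Z K ⊗ Z K)) f ∎

  -- The map `pair` remembers the coordinates already chosen, so that one lemma handles every layer
  -- of `quads`.
  ∑-concatMap-Z : ∀ {C : Set} K (X : Box A) (pair : ℤ → A → C) (k : ℤ → List C) (f : C → ℤ) →
    (∀ x → ∑ (k x) f ≡ ∑ (Box.elems X) (f ∘ pair x)) →
    ∑ (concatMap k (range K)) f ≡ ∑ (Box.elems (Z K ⊗ X)) (λ (x , v) → f (pair x v))
  ∑-concatMap-Z K X pair k f eq = begin
    ∑ (concatMap k (range K)) f
      ≡⟨ ∑-concatMap k (range K) f ⟩
    ∑ (range K) (λ x → ∑ (k x) f)
      ≡⟨ ∑-Z K (λ x → ∑ (k x) f) ⟨
    ∑ (Box.elems (Z K)) (λ x → ∑ (k x) f)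
      ≡⟨ ∑-cong (Box.elems (Z K)) eq ⟩
    ∑ (Box.elems (Z K)) (λ x → ∑ (Box.elems X) (f ∘ pair x))
      ≡⟨ ∑-⊗ (Z K) X (λ (x , v) → f (pair x v)) ⟨
    ∑ (Box.elems (Z K ⊗ X)) (λ (x , v) → f (pair x v)) ∎

  ∑-quads : ∀ K (f : ℤ × ℤ × ℤ × ℤ → ℤ) → ∑ (quads K) f ≡ ∑ (Box.elems (Z⁴ K)) f
  ∑-quads K f =
    ∑-concatMap-Z K (Z³ K) _,_ ys f (λ x →
    ∑-concatMap-Z K (Z K ⊗ Z K) (λ y v → x , y , v) (zs x) f (λ y →
    ∑-concatMap-Z K (Z K) (λ z w → x , y , z , w) (ws x y) f (λ z →
    trans (∑-map (λ w → x , y , z , w) R f) (sym (∑-Z K (λ w → f (x , y , z , w)))))))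
    where
    R : List ℤ
    R = range K
    ws : ℤ → ℤ → ℤ → List (ℤ × ℤ × ℤ × ℤ)
    ws x y z = map (λ w → x , y , z , w) R
    zs : ℤ → ℤ → List (ℤ × ℤ × ℤ × ℤ)
    zs x y = concatMap (ws x y) R
    ys : ℤ → List (ℤ × ℤ × ℤ × ℤ)
    ys x = concatMap (zs x) R

  x[x-1]-even : ∀ x → Even (x * (x - 1ℤ))
  x[x-1]-even x with parity x
  ... | inj₁ (k , refl) = k * (+ 2 * k - 1ℤ) , ℤP.*-assoc (+ 2) k _
  ... | inj₂ (k , refl) = (+ 2 * k + 1ℤ) * k , l k
    where
    l : ∀ k → (+ 2 * k + 1ℤ) * (+ 2 * k + 1ℤ - 1ℤ) ≡ + 2 * ((+ 2 * k + 1ℤ) * k)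
    l = solve-∀

  0≤x[x-1] : ∀ x → 0ℤ ≤ x * (x - 1ℤ)
  0≤x[x-1] (+ zero) = +≤+ ℕ.z≤n
  0≤x[x-1] (+ suc n) = subst (0ℤ ≤_) (ℤP.pos-* (suc n) n) (+≤+ ℕ.z≤n)
  0≤x[x-1] -[1+ n ] = +≤+ ℕ.z≤n

  2*tri : ∀ x → + 2 * + tri x ≡ x * (x - 1ℤ)
  2*tri x with x * (x - 1ℤ) | x[x-1]-even x | 0≤x[x-1] x
  ... | v | k , refl | 0≤v = begin
    + 2 * + (∣ + 2 * k ∣ / 2)        ≡⟨ cong (λ z → + 2 * + (z / 2)) (trans (ℤP.abs-* (+ 2) k) (ℕP.*-comm 2 ∣ k ∣)) ⟩
    + 2 * + (∣ k ∣ ℕ.* 2 / 2)        ≡⟨ cong (λ z → + 2 * + z) (m*n/n≡m ∣ k ∣ 2) ⟩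
    + 2 * + ∣ k ∣                    ≡⟨ ℤP.pos-* 2 ∣ k ∣ ⟨
    + (2 ℕ.* ∣ k ∣)                  ≡⟨ cong (λ z → + z) (ℤP.abs-* (+ 2) k) ⟨
    + ∣ + 2 * k ∣                    ≡⟨ ℤP.0≤i⇒+∣i∣≡i 0≤v ⟩
    + 2 * k ∎

  tri-reflect : ∀ x → tri (1ℤ - x) ≡ tri x
  tri-reflect x = cong (λ z → ∣ z ∣ / 2) (l x)
    where
    l : ∀ x → (1ℤ - x) * (1ℤ - x - 1ℤ) ≡ x * (x - 1ℤ)
    l = solve-∀

  tri-≤ : ∀ {n} x → tri x ℕ.≤ n → ∣ x ∣ ℕ.≤ suc n
  tri-≤ (+ 0) _ = ℕ.z≤n
  tri-≤ (+ 1) _ = ℕ.s≤s ℕ.z≤n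
  -- For x = k + 2 one has 2 `tri x` = (k + 2)(k + 1) ≥ 2(k + 1).
  tri-≤ (+ suc (suc k)) tri≤n = ℕ.s≤s (ℕP.≤-trans (ℕP.*-cancelˡ-≤ 2 (ℕP.≤-trans
    (ℕP.*-monoˡ-≤ (suc k) {2} {suc (suc k)} (ℕ.s≤s (ℕ.s≤s ℕ.z≤n))) (ℕP.≤-reflexive (ℤP.+-injective (begin
      + (suc (suc k) ℕ.* suc k)           ≡⟨ 2*tri (+ suc (suc k)) ⟨
      + 2 * + tri (+ suc (suc k))         ≡⟨ ℤP.pos-* 2 (tri (+ suc (suc k))) ⟨
      + (2 ℕ.* tri (+ suc (suc k))) ∎))))) tri≤n)
  -- The reflection x ↦ 1 - x sends -(k + 1) to k + 2, whose absolute value is larger.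
  tri-≤ {n} -[1+ k ] tri≤n = ℕP.≤-trans (ℕP.n≤1+n (suc k))
    (tri-≤ (+ suc (suc k)) (subst (ℕ._≤ n) (sym (tri-reflect -[1+ k ])) tri≤n))

  Triangular : ℕ → ℤ × ℤ × ℤ × ℤ → Set
  Triangular n (x , y , z , w) = n ≡ 1 ℕ.* tri x ℕ.+ 1 ℕ.* tri y ℕ.+ 2 ℕ.* tri z ℕ.+ 8 ℕ.* tri w

  Triangular? : ∀ n → Decidable (Triangular n)
  Triangular? n (x , y , z , w) = n ℕ.≟ 1 ℕ.* tri x ℕ.+ 1 ℕ.* tri y ℕ.+ 2 ℕ.* tri z ℕ.+ 8 ℕ.* tri w

  t≡∑ : ∀ n → + t 1 1 2 8 n ≡ ∑[ Z⁴ (suc n) ∣ Triangular? n ] (λ _ → 1ℤ)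
  t≡∑ n = begin
    + length (filter (Triangular? n) (quads (suc n)))
      ≡⟨ length≡∑ (filter (Triangular? n) (quads (suc n))) ⟩
    ∑ (filter (Triangular? n) (quads (suc n))) (λ _ → 1ℤ)
      ≡⟨ ∑-filter (Triangular? n) (quads (suc n)) (λ _ → 1ℤ) ⟩
    ∑ (quads (suc n)) (λ v → when (Triangular? n v) 1ℤ)
      ≡⟨ ∑-quads (suc n) (λ v → when (Triangular? n v) 1ℤ) ⟩
    ∑[ Z⁴ (suc n) ∣ Triangular? n ] (λ _ → 1ℤ) ∎

  Triangular⊆Z⁴ : ∀ n v → Triangular n v → v ∈ Z⁴ (suc n)
  Triangular⊆Z⁴ n (x , y , z , w) eq = ∈-Z⁴
    (tri-≤ x (below (ℕP.≤-trans (ℕP.m≤m+n (tri x) 0) (ℕP.≤-trans (ℕP.m≤m+n _ _) (ℕP.≤-trans (ℕP.m≤m+n _ _) (ℕP.m≤m+n _ _))))))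
    (tri-≤ y (below (ℕP.≤-trans (ℕP.m≤m+n (tri y) 0) (ℕP.≤-trans (ℕP.m≤n+m _ (1 ℕ.* tri x)) (ℕP.≤-trans (ℕP.m≤m+n _ _) (ℕP.m≤m+n _ _))))))
    (tri-≤ z (below (ℕP.≤-trans (ℕP.m≤n*m (tri z) 2) (ℕP.≤-trans (ℕP.m≤n+m _ (1 ℕ.* tri x ℕ.+ 1 ℕ.* tri y)) (ℕP.m≤m+n _ _)))))
    (tri-≤ w (below (ℕP.≤-trans (ℕP.m≤n*m (tri w) 8) (ℕP.m≤n+m _ (1 ℕ.* tri x ℕ.+ 1 ℕ.* tri y ℕ.+ 2 ℕ.* tri z)))))
    where
    below : ∀ {k} → k ℕ.≤ 1 ℕ.* tri x ℕ.+ 1 ℕ.* tri y ℕ.+ 2 ℕ.* tri z ℕ.+ 8 ℕ.* tri w → k ℕ.≤ n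
    below le = ℕP.≤-trans le (ℕP.≤-reflexive (sym eq))

  2*triangular : ∀ x y z w → + 2 * + (1 ℕ.* tri x ℕ.+ 1 ℕ.* tri y ℕ.+ 2 ℕ.* tri z ℕ.+ 8 ℕ.* tri w) ≡
    x * (x - 1ℤ) + y * (y - 1ℤ) + + 2 * (z * (z - 1ℤ)) + + 8 * (w * (w - 1ℤ))
  2*triangular x y z w = begin
    + 2 * (+ (1 ℕ.* tri x) + + (1 ℕ.* tri y) + + (2 ℕ.* tri z) + + (8 ℕ.* tri w))
      ≡⟨ cong (_*_ (+ 2)) (cong₂ _+_ (cong₂ _+_ (cong₂ _+_ (ℤP.pos-* 1 (tri x)) (ℤP.pos-* 1 (tri y))) (ℤP.pos-* 2 (tri z)))
           (ℤP.pos-* 8 (tri w))) ⟩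
    + 2 * (+ 1 * + tri x + + 1 * + tri y + + 2 * + tri z + + 8 * + tri w)
      ≡⟨ l (+ tri x) (+ tri y) (+ tri z) (+ tri w) ⟩
    + 2 * + tri x + + 2 * + tri y + + 2 * (+ 2 * + tri z) + + 8 * (+ 2 * + tri w)
      ≡⟨ cong₂ _+_ (cong₂ _+_ (cong₂ _+_ (2*tri x) (2*tri y)) (cong (_*_ (+ 2)) (2*tri z))) (cong (_*_ (+ 8)) (2*tri w)) ⟩
    x * (x - 1ℤ) + y * (y - 1ℤ) + + 2 * (z * (z - 1ℤ)) + + 8 * (w * (w - 1ℤ)) ∎
    where
    l : ∀ a b c d → + 2 * (+ 1 * a + + 1 * b + + 2 * c + + 8 * d) ≡ + 2 * a + + 2 * b + + 2 * (+ 2 * c) + + 8 * (+ 2 * d)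
    l = solve-∀

  -- Completing squares gives 8n + 12 = (2x - 1)² + (2y - 1)² + 2(2z - 1)² + 8(2w - 1)²; for x ≡ y mod 2 the identity
  -- a² + b² = 2((a + b)/2)² + 2((a - b)/2)², applied twice, halves this to 2n + 3 = p² + q² + 2u² + 2v².
  triangular-form : ∀ y u z w → let p = y + u + z - 1ℤ; q = y + u - z; v = + 2 * w - 1ℤ; x = y + + 2 * u in
    p * p + (q * q + (+ 2 * (u * u) + + 2 * (v * v))) ≡
    x * (x - 1ℤ) + y * (y - 1ℤ) + + 2 * (z * (z - 1ℤ)) + + 8 * (w * (w - 1ℤ)) + + 3
  triangular-form = solve-∀

  -- Replacing y by 1 - y keeps its triangular number and changes the parity of x - y, so t is twice
  -- the count with x ≡ y mod 2. Those quadruples correspond to the solutions of the form with odd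
  -- last entry.
  t≡Form : ∀ n {m N} → + m ≡ + 2 * + n + + 3 → m ℕ.≤ N →
    + t 1 1 2 8 n ≡ ∑[ Z⁴ N ∣ Form? m ] (λ _ → 1ℤ) - ∑[ Z⁴ N ∣ Form? m ] (λ (p , q , u , w) → sgn w)
  t≡Form n {m} {N} m≡ m≤N = begin
    + t 1 1 2 8 n
      ≡⟨ t≡∑ n ⟩
    ∑[ X ∣ Triangular? n ] (λ _ → 1ℤ)
      ≡⟨ ∑-split X (Triangular? n) Q? (λ _ → 1ℤ) ⟩
    ∑[ X ∣ A? ] (λ _ → 1ℤ) + ∑[ X ∣ (λ v → Triangular? n v ×-dec ¬? (Q? v)) ] (λ _ → 1ℤ)
      ≡⟨ cong (_+_ (∑[ X ∣ A? ] (λ _ → 1ℤ))) reflected ⟩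
    ∑[ X ∣ A? ] (λ _ → 1ℤ) + ∑[ X ∣ A? ] (λ _ → 1ℤ)
      ≡⟨ double (∑[ X ∣ A? ] (λ _ → 1ℤ)) ⟩
    -- The 0 stands for the solutions with even w: the weight 1 - (-1)ʷ is 0 on them and 2 on those
    -- with odd w.
    0ℤ + + 2 * ∑[ X ∣ A? ] (λ _ → 1ℤ)
      ≡⟨ cong₂ (λ a b → a + + 2 * b)
           (sym (∑[]-0 (Z⁴ N) (λ v → Form? m v ×-dec W? v) (λ (p , q , u , w) (_ , even) → 1-sgn-even even)))
           substituted ⟩
    ∑[ Z⁴ N ∣ (λ v → Form? m v ×-dec W? v) ] (λ v → 1ℤ + - 1ℤ * f v) + + 2 * ∑[ Z⁴ N ∣ B? ] (λ _ → 1ℤ)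
      ≡⟨ cong (_+_ (∑[ Z⁴ N ∣ (λ v → Form? m v ×-dec W? v) ] (λ v → 1ℤ + - 1ℤ * f v)))
           (trans (∑[]-*ˡ (Z⁴ N) B? (+ 2) (λ _ → 1ℤ)) (∑[]-map (Z⁴ N) B? (λ (p , q , u , w) (_ , odd) → sym (1-sgn-odd odd)))) ⟩
    ∑[ Z⁴ N ∣ (λ v → Form? m v ×-dec W? v) ] (λ v → 1ℤ + - 1ℤ * f v) + ∑[ Z⁴ N ∣ B? ] (λ v → 1ℤ + - 1ℤ * f v)
      ≡⟨ ∑-split (Z⁴ N) (Form? m) W? (λ v → 1ℤ + - 1ℤ * f v) ⟨
    ∑[ Z⁴ N ∣ Form? m ] (λ v → 1ℤ + - 1ℤ * f v)
      ≡⟨ ∑[]-+ (Z⁴ N) (Form? m) (λ _ → 1ℤ) (λ v → - 1ℤ * f v) ⟩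
    ∑[ Z⁴ N ∣ Form? m ] (λ _ → 1ℤ) + ∑[ Z⁴ N ∣ Form? m ] (λ v → - 1ℤ * f v)
      ≡⟨ cong (_+_ (∑[ Z⁴ N ∣ Form? m ] (λ _ → 1ℤ)))
           (trans (sym (∑[]-*ˡ (Z⁴ N) (Form? m) (- 1ℤ) f)) (ℤP.-1*i≡-i (∑[ Z⁴ N ∣ Form? m ] f))) ⟩
    ∑[ Z⁴ N ∣ Form? m ] (λ _ → 1ℤ) - ∑[ Z⁴ N ∣ Form? m ] f ∎
    where
    X : Box (ℤ × ℤ × ℤ × ℤ)
    X = Z⁴ (suc n)
    f : ℤ × ℤ × ℤ × ℤ → ℤ
    f (p , q , u , w) = sgn w
    Q? : Decidable (λ ((x , y , z , w) : ℤ × ℤ × ℤ × ℤ) → Even (x - y))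
    Q? (x , y , z , w) = Even? (x - y)
    A? : Decidable (λ (v : ℤ × ℤ × ℤ × ℤ) → Triangular n v × Even (proj₁ v - proj₁ (proj₂ v)))
    A? v = Triangular? n v ×-dec Q? v
    W? : Decidable (λ ((p , q , u , w) : ℤ × ℤ × ℤ × ℤ) → Even w)
    W? (p , q , u , w) = Even? w
    B? : Decidable (λ (v : ℤ × ℤ × ℤ × ℤ) → Form m v × ¬ Even (proj₂ (proj₂ (proj₂ v))))
    B? v = Form? m v ×-dec ¬? (W? v)
    double : ∀ x → x + x ≡ 0ℤ + + 2 * x
    double = solve-∀
    1-sgn-even : ∀ {w} → Even w → 1ℤ + - 1ℤ * sgn w ≡ 0ℤ
    1-sgn-even (k , refl) = cong (λ z → 1ℤ + - 1ℤ * z) (sgn-2* k)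
    1-sgn-odd : ∀ {w} → ¬ Even w → 1ℤ + - 1ℤ * sgn w ≡ + 2 * 1ℤ
    1-sgn-odd odd with ¬Even⇒odd odd
    ... | k , refl = cong (λ z → 1ℤ + - 1ℤ * z) (sgn-odd k)
    reflected : ∑[ X ∣ (λ v → Triangular? n v ×-dec ¬? (Q? v)) ] (λ _ → 1ℤ) ≡ ∑[ X ∣ A? ] (λ _ → 1ℤ)
    reflected = ∑-reindex X X (λ v → Triangular? n v ×-dec ¬? (Q? v)) A? reflect reflect
      (λ v (eq , _) → Triangular⊆Z⁴ n v eq) (λ v (eq , _) → Triangular⊆Z⁴ n v eq)
      (λ (x , y , z , w) (eq , odd) → (stable x y z w eq , to x y odd) , reflect² x y z w , refl)
      (λ (x , y , z , w) (eq , even) → (stable x y z w eq , from x y even) , reflect² x y z w)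
      where
      reflect : ℤ × ℤ × ℤ × ℤ → ℤ × ℤ × ℤ × ℤ
      reflect (x , y , z , w) = x , 1ℤ - y , z , w
      reflect² : ∀ x y z w → reflect (reflect (x , y , z , w)) ≡ (x , y , z , w)
      reflect² x y z w = ,₄-cong refl (l y) refl refl
        where
        l : ∀ y → 1ℤ - (1ℤ - y) ≡ y
        l = solve-∀
      stable : ∀ x y z w → Triangular n (x , y , z , w) → Triangular n (x , 1ℤ - y , z , w)
      stable x y z w eq = trans eq (cong (λ k → 1 ℕ.* tri x ℕ.+ 1 ℕ.* k ℕ.+ 2 ℕ.* tri z ℕ.+ 8 ℕ.* tri w) (sym (tri-reflect y)))
      to : ∀ x y → ¬ Even (x - y) → Even (x - (1ℤ - y))
      to x y odd with ¬Even⇒odd odd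
      ... | k , eq = k + y , trans (l x y) (trans (cong (λ z → z + + 2 * y - 1ℤ) eq) (l′ k y))
        where
        l : ∀ x y → x - (1ℤ - y) ≡ x - y + + 2 * y - 1ℤ
        l = solve-∀
        l′ : ∀ k y → + 2 * k + 1ℤ + + 2 * y - 1ℤ ≡ + 2 * (k + y)
        l′ = solve-∀
      from : ∀ x y → Even (x - y) → ¬ Even (x - (1ℤ - y))
      from x y (k , eq) = odd⇒¬Even (k + y - 1ℤ) (trans (l x y) (trans (cong (λ z → z + + 2 * y - 1ℤ) eq) (l′ k y)))
        where
        l : ∀ x y → x - (1ℤ - y) ≡ x - y + + 2 * y - 1ℤ
        l = solve-∀
        l′ : ∀ k y → + 2 * k + + 2 * y - 1ℤ ≡ + 2 * (k + y - 1ℤ) + 1ℤ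
        l′ = solve-∀
    forward : ∀ y u z w → Triangular n (y + + 2 * u , y , z , w) → Form m (y + u + z - 1ℤ , y + u - z , u , + 2 * w - 1ℤ)
    forward y u z w eq = trans (triangular-form y u z w)
      (trans (cong (λ z → z + + 3) (trans (sym (2*triangular (y + + 2 * u) y z w)) (cong (λ z → + 2 * + z) (sym eq)))) (sym m≡))
    backward : ∀ y u z w → Form m (y + u + z - 1ℤ , y + u - z , u , + 2 * w - 1ℤ) → Triangular n (y + + 2 * u , y , z , w)
    backward y u z w eq = ℤP.+-injective (ℤP.*-cancelˡ-≡ (+ 2) _ _ (+3-injective
      (trans (sym m≡) (trans (sym eq) (trans (triangular-form y u z w) (cong (λ z → z + + 3) (sym (2*triangular (y + + 2 * u) y z w))))))))
      where
      +3-injective : ∀ {x y} → x + + 3 ≡ y + + 3 → x ≡ y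
      +3-injective {x} {y} eq = trans (l x) (trans (cong (λ z → z - + 3) eq) (sym (l y)))
        where
        l : ∀ x → x ≡ x + + 3 - + 3
        l = solve-∀
    -- This makes p + q + 1 and p - q + 1 even, as the inverse substitution requires.
    sum-odd : ∀ {p q u w} → Form m (p , q , u , w) → ¬ Even (p + q)
    sum-odd {p} {q} {u} {w} eq (k , even) = 2k≢2j+1 {+ 2 * (k * k) - p * q + (u * u + w * w)} {+ n + 1ℤ}
      (trans (l₁ k (p * q) u w) (trans (cong (λ z → z * z - + 2 * (p * q) + (+ 2 * (u * u) + + 2 * (w * w))) (sym even))
        (trans (l₂ p q _) (trans eq (trans m≡ (l₃ (+ n)))))))
      where
      l₁ : ∀ k r u w → + 2 * (+ 2 * (k * k) - r + (u * u + w * w)) ≡ + 2 * k * (+ 2 * k) - + 2 * r + (+ 2 * (u * u) + + 2 * (w * w))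
      l₁ = solve-∀
      l₂ : ∀ p q r → (p + q) * (p + q) - + 2 * (p * q) + r ≡ p * p + (q * q + r)
      l₂ = solve-∀
      l₃ : ∀ n → + 2 * n + + 3 ≡ + 2 * (n + 1ℤ) + 1ℤ
      l₃ = solve-∀
    substituted : ∑[ X ∣ A? ] (λ _ → 1ℤ) ≡ ∑[ Z⁴ N ∣ B? ] (λ _ → 1ℤ)
    substituted = ∑-reindex X (Z⁴ N) A? B? to from
      (λ v (eq , _) → Triangular⊆Z⁴ n v eq) (λ v (eq , _) → Form⊆Z⁴ m≤N v eq) toB fromA
      where
      to from : ℤ × ℤ × ℤ × ℤ → ℤ × ℤ × ℤ × ℤ
      to (x , y , z , w) = y + half (x - y) + z - 1ℤ , y + half (x - y) - z , half (x - y) , + 2 * w - 1ℤ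
      -- Solves p + q + 1 = 2(y + u), p - q + 1 = 2z and v + 1 = 2w, with x = y + 2u.
      from (p , q , u , v) = half (p + q + 1ℤ) + u , half (p + q + 1ℤ) - u , half (p - q + 1ℤ) , half (v + 1ℤ)
      l₂ : ∀ y g z → y + g + z - 1ℤ + (y + g - z) + 1ℤ ≡ + 2 * (y + g)
      l₂ = solve-∀
      l₃ : ∀ y g z → y + g + z - 1ℤ - (y + g - z) + 1ℤ ≡ + 2 * z
      l₃ = solve-∀
      l₄ : ∀ w → + 2 * w - 1ℤ + 1ℤ ≡ + 2 * w
      l₄ = solve-∀
      l₅ : ∀ y g → y + g - g ≡ y
      l₅ = solve-∀
      l₆ : ∀ y g → y + g + g ≡ y + + 2 * g
      l₆ = solve-∀
      l₇ : ∀ x y → y + (x - y) ≡ x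
      l₇ = solve-∀
      v-odd : ∀ w → ¬ Even (+ 2 * w - 1ℤ)
      v-odd w = odd⇒¬Even (w - 1ℤ) (l w)
        where
        l : ∀ w → + 2 * w - 1ℤ ≡ + 2 * (w - 1ℤ) + 1ℤ
        l = solve-∀
      x≡ : ∀ x y → Even (x - y) → y + + 2 * half (x - y) ≡ x
      x≡ x y even = trans (cong (_+_ y) (2*half even)) (l₇ x y)
      toB : ∀ v → Triangular n v × Even (proj₁ v - proj₁ (proj₂ v)) →
        (Form m (to v) × ¬ Even (proj₂ (proj₂ (proj₂ (to v))))) × from (to v) ≡ v × 1ℤ ≡ 1ℤ
      toB (x , y , z , w) (eq , even) =
        (forward y g z w (subst (λ x → Triangular n (x , y , z , w)) (sym (x≡ x y even)) eq) , v-odd w) ,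
        ,₄-cong (trans (cong (λ k → k + g) k≡) (trans (l₆ y g) (x≡ x y even)))
                (trans (cong (λ k → k - g) k≡) (l₅ y g))
                (trans (cong half (l₃ y g z)) (half-2* z))
                (trans (cong half (l₄ w)) (half-2* w)) ,
        refl
        where
        g : ℤ
        g = half (x - y)
        k≡ : half (y + g + z - 1ℤ + (y + g - z) + 1ℤ) ≡ y + g
        k≡ = trans (cong half (l₂ y g z)) (half-2* (y + g))
      fromA : ∀ v → Form m v × ¬ Even (proj₂ (proj₂ (proj₂ v))) →
        (Triangular n (from v) × Even (proj₁ (from v) - proj₁ (proj₂ (from v)))) × to (from v) ≡ v
      fromA (p , q , u , v) (eq , odd) =
        (subst (λ x → Triangular n (x , g - u , z , w)) (l₈ g u)
          (backward (g - u) u z w (subst (Form m) (sym (,₄-cong p≡′ q≡′ (refl {x = u}) v≡)) eq)) , u , l₉ g u) ,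
        ,₄-cong (trans (cong (λ k → g - u + k + z - 1ℤ) u≡) p≡′) (trans (cong (λ k → g - u + k - z) u≡) q≡′) u≡ v≡
        where
        g z w : ℤ
        g = half (p + q + 1ℤ)
        z = half (p - q + 1ℤ)
        w = half (v + 1ℤ)
        pq-odd : ¬ Even (p + q)
        pq-odd = sum-odd {p} {q} {u} {v} eq
        2g : + 2 * g ≡ p + q + 1ℤ
        2g = 2*half (¬Even-suc pq-odd)
        2z : + 2 * z ≡ p - q + 1ℤ
        2z = 2*half (¬Even-suc (¬Even-minus {p} {q} pq-odd))
        l₈ : ∀ g u → g - u + + 2 * u ≡ g + u
        l₈ = solve-∀
        l₉ : ∀ g u → g + u - (g - u) ≡ + 2 * u
        l₉ = solve-∀
        p≡′ : g - u + u + z - 1ℤ ≡ p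
        p≡′ = ℤP.*-cancelˡ-≡ (+ 2) _ p (trans (l g u z) (trans (cong₂ (λ a b → a + b - + 2) 2g 2z) (l′ p q)))
          where
          l : ∀ g u z → + 2 * (g - u + u + z - 1ℤ) ≡ + 2 * g + + 2 * z - + 2
          l = solve-∀
          l′ : ∀ p q → p + q + 1ℤ + (p - q + 1ℤ) - + 2 ≡ + 2 * p
          l′ = solve-∀
        q≡′ : g - u + u - z ≡ q
        q≡′ = ℤP.*-cancelˡ-≡ (+ 2) _ q (trans (l g u z) (trans (cong₂ _-_ 2g 2z) (l′ p q)))
          where
          l : ∀ g u z → + 2 * (g - u + u - z) ≡ + 2 * g - + 2 * z
          l = solve-∀
          l′ : ∀ p q → p + q + 1ℤ - (p - q + 1ℤ) ≡ + 2 * q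
          l′ = solve-∀
        v≡ : + 2 * w - 1ℤ ≡ v
        v≡ = trans (cong (λ k → k - 1ℤ) (2*half (¬Even-suc odd))) (l v)
          where
          l : ∀ v → v + 1ℤ - 1ℤ ≡ v
          l = solve-∀
        u≡ : half (g + u - (g - u)) ≡ u
        u≡ = trans (cong half (l₉ g u)) (half-2* u)

  -- Representations by p² + 4a²

  χ-1mod4 : ∀ {p} → + 4 ℤD.∣ p - 1ℤ → χ p ≡ 1ℤ
  χ-1mod4 {p} (ℤD.divides q eq) = trans (cong χ (trans (l₁ p) (trans (cong (λ z → z + 1ℤ) eq) (l₂ q))))
    (trans (χ-odd (+ 2 * q)) (sgn-2* q))
    where
    l₁ : ∀ p → p ≡ p - 1ℤ + 1ℤ
    l₁ = solve-∀
    l₂ : ∀ q → q * + 4 + 1ℤ ≡ + 2 * (+ 2 * q) + 1ℤ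
    l₂ = solve-∀

  odd-1mod4 : ∀ p → ¬ Even p → ¬ (+ 4 ℤD.∣ p - 1ℤ) → + 4 ℤD.∣ - p - 1ℤ
  odd-1mod4 p odd ∤ with ¬Even⇒odd odd
  ... | j , refl with parity j
  ...   | inj₁ (i , refl) = contradiction (ℤD.divides i (l i)) ∤
    where
    l : ∀ i → + 2 * (+ 2 * i) + 1ℤ - 1ℤ ≡ i * + 4
    l = solve-∀
  ...   | inj₂ (i , refl) = ℤD.divides (- i - 1ℤ) (l i)
    where
    l : ∀ i → - (+ 2 * (+ 2 * i + 1ℤ) + 1ℤ) - 1ℤ ≡ (- i - 1ℤ) * + 4
    l = solve-∀

  -- p χ p is unchanged under p ↦ -p, and exactly one of p and -p is 1 mod 4, where χ is 1.
  ∑-Binary≡2repSum : ∀ {m N} k → + m ≡ + 2 * k + 1ℤ → m ℕ.≤ N →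
    ∑[ Z N ⊗ Z N ∣ Binary? m ] (λ (a , p) → p * χ p) ≡ + 2 * repSum m
  ∑-Binary≡2repSum {m} {N} k m≡ m≤N = begin
    ∑[ Z N ⊗ Z N ∣ Binary? m ] f
      ≡⟨ ∑-split (Z N ⊗ Z N) (Binary? m) Q? f ⟩
    ∑[ Z N ⊗ Z N ∣ (λ v → Binary? m v ×-dec Q? v) ] f + ∑[ Z N ⊗ Z N ∣ (λ v → Binary? m v ×-dec ¬? (Q? v)) ] f
      ≡⟨ cong₂ _+_ positive negative ⟩
    ∑[ Z m ⊗ Z m ∣ R? ] proj₁ + ∑[ Z m ⊗ Z m ∣ R? ] proj₁
      ≡⟨ cong₂ _+_ repSum≡ repSum≡ ⟨
    repSum m + repSum m
      ≡⟨ l (repSum m) ⟩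
    + 2 * repSum m ∎
    where
    f : ℤ × ℤ → ℤ
    f (a , p) = p * χ p
    Q? : Decidable (λ ((a , p) : ℤ × ℤ) → + 4 ℤD.∣ p - 1ℤ)
    Q? (a , p) = + 4 ℤD.∣? (p - 1ℤ)
    R? : Decidable (λ ((r , s) : ℤ × ℤ) → + 4 ℤD.∣ r - 1ℤ × + m ≡ r * r + + 4 * (s * s))
    R? (r , s) = (+ 4 ℤD.∣? (r - 1ℤ)) ×-dec (+ m ≟ r * r + + 4 * (s * s))
    l : ∀ x → x + x ≡ + 2 * x
    l = solve-∀
    neg-sq : ∀ a p → + 4 * (a * a) + - p * - p ≡ + 4 * (a * a) + p * p
    neg-sq = solve-∀
    repSum≡ : repSum m ≡ ∑[ Z m ⊗ Z m ∣ R? ] proj₁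
    repSum≡ = begin
      sumℤ (map proj₁ (filter R? (pairs m)))
        ≡⟨ sumℤ≡∑ proj₁ (filter R? (pairs m)) ⟩
      ∑ (filter R? (pairs m)) proj₁
        ≡⟨ ∑-filter R? (pairs m) proj₁ ⟩
      ∑ (pairs m) (λ v → when (R? v) (proj₁ v))
        ≡⟨ ∑-pairs m (λ v → when (R? v) (proj₁ v)) ⟩
      ∑[ Z m ⊗ Z m ∣ R? ] proj₁ ∎
    Binary-≤ : ∀ a p → + 4 * (a * a) + p * p ≡ + m → ∣ a ∣ ℕ.≤ m × ∣ p ∣ ℕ.≤ m
    Binary-≤ a p eq =
      sq-≤ a _ (ℤP.+-mono-≤ (0≤* 3 (0≤sq a)) (0≤sq p)) (trans (l₁ a p) eq) ,
      sq-≤ p _ (0≤* 4 (0≤sq a)) (trans (ℤP.+-comm (p * p) _) eq)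
      where
      l₁ : ∀ a p → a * a + (+ 3 * (a * a) + p * p) ≡ + 4 * (a * a) + p * p
      l₁ = solve-∀
    Binary⊆ : ∀ ((a , p) : ℤ × ℤ) → + 4 * (a * a) + p * p ≡ + m → (a , p) ∈ Z N ⊗ Z N
    Binary⊆ (a , p) eq with Binary-≤ a p eq
    ... | a≤ , p≤ = ∈-⊗ (Z N) (Z N) (∈-Z (ℕP.≤-trans a≤ m≤N)) (∈-Z (ℕP.≤-trans p≤ m≤N))
    R⇒Binary : ∀ {r s} → + m ≡ r * r + + 4 * (s * s) → + 4 * (s * s) + r * r ≡ + m
    R⇒Binary {r} {s} eq = trans (ℤP.+-comm (+ 4 * (s * s)) (r * r)) (sym eq)
    Binary⇒R : ∀ {a p} → + 4 * (a * a) + p * p ≡ + m → + m ≡ p * p + + 4 * (a * a)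
    Binary⇒R {a} {p} eq = trans (sym eq) (ℤP.+-comm (+ 4 * (a * a)) (p * p))
    R⊆ : ∀ ((r , s) : ℤ × ℤ) → + m ≡ r * r + + 4 * (s * s) → (r , s) ∈ Z m ⊗ Z m
    R⊆ (r , s) eq with Binary-≤ s r (R⇒Binary {r} {s} eq)
    ... | s≤ , r≤ = ∈-⊗ (Z m) (Z m) (∈-Z r≤) (∈-Z s≤)
    p-odd : ∀ {a p} → + 4 * (a * a) + p * p ≡ + m → ¬ Even p
    p-odd {a} eq (j , refl) = 2k≢2j+1 {+ 2 * (a * a + j * j)} {k} (trans (l₁ a j) (trans eq m≡))
      where
      l₁ : ∀ a j → + 2 * (+ 2 * (a * a + j * j)) ≡ + 4 * (a * a) + + 2 * j * (+ 2 * j)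
      l₁ = solve-∀
    positive : ∑[ Z N ⊗ Z N ∣ (λ v → Binary? m v ×-dec Q? v) ] f ≡ ∑[ Z m ⊗ Z m ∣ R? ] proj₁
    positive = ∑-reindex (Z N ⊗ Z N) (Z m ⊗ Z m) (λ v → Binary? m v ×-dec Q? v) R? (λ (a , p) → p , a) (λ (r , s) → s , r)
      (λ v (eq , _) → Binary⊆ v eq) (λ v (_ , eq) → R⊆ v eq)
      (λ (a , p) (eq , 4∣) → (4∣ , Binary⇒R {a} {p} eq) , refl ,
        trans (cong (_*_ p) (χ-1mod4 {p} 4∣)) (ℤP.*-identityʳ p))
      (λ (r , s) (4∣ , eq) → (R⇒Binary {r} {s} eq , 4∣) , refl)
    negative : ∑[ Z N ⊗ Z N ∣ (λ v → Binary? m v ×-dec ¬? (Q? v)) ] f ≡ ∑[ Z m ⊗ Z m ∣ R? ] proj₁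
    negative = ∑-reindex (Z N ⊗ Z N) (Z m ⊗ Z m) (λ v → Binary? m v ×-dec ¬? (Q? v)) R?
      (λ (a , p) → - p , a) (λ (r , s) → s , - r)
      (λ v (eq , _) → Binary⊆ v eq) (λ v (_ , eq) → R⊆ v eq)
      (λ (a , p) (eq , ∤) → let 4∣ = odd-1mod4 p (p-odd {a} {p} eq) ∤ in
        (4∣ , Binary⇒R {a} { - p} (trans (neg-sq a p) eq)) , cong (a ,_) (ℤP.neg-involutive p) ,
        trans (l₁ p (χ p)) (trans (cong (_*_ (- p)) (trans (sym (χ-neg p)) (χ-1mod4 { - p} 4∣))) (ℤP.*-identityʳ (- p))))
      (λ (r , s) (4∣ , eq) → (trans (neg-sq s r) (R⇒Binary {r} {s} eq) ,
        λ 4∣′ → contradiction (trans (sym (χ-1mod4 { - r} 4∣′)) (trans (χ-neg r) (cong -_ (χ-1mod4 {r} 4∣)))) (λ ())) ,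
        cong (_, s) (ℤP.neg-involutive r))
      where
      l₁ : ∀ p x → p * x ≡ - p * - x
      l₁ = solve-∀

  negOnePow≡sgn : ∀ k → negOnePow k ≡ sgn (+ k)
  negOnePow≡sgn zero = refl
  negOnePow≡sgn (suc k) = trans (cong -_ (negOnePow≡sgn k)) (sym (sgn-suc (+ k)))

  -- The two parities of n

  module _ (n : ℕ) where
    private
      m : ℕ
      m = 2 ℕ.* n ℕ.+ 3
      instance
        m≢0 : ℕ.NonZero m
        m≢0 = ℕ.>-nonZero (ℕP.≤-trans (ℕ.s≤s ℕ.z≤n) (ℕP.m≤n+m 3 (2 ℕ.* n)))
      m≤4m : m ℕ.≤ 4 ℕ.* m
      m≤4m = ℕP.m≤n*m m 4
      m≡ : + m ≡ + 2 * + n + + 3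
      m≡ = cong (λ z → z + + 3) (ℤP.pos-* 2 n)
      m-odd : + m ≡ + 2 * (+ n + 1ℤ) + 1ℤ
      m-odd = trans m≡ (l (+ n))
        where
        l : ∀ n → + 2 * n + + 3 ≡ + 2 * (n + 1ℤ) + 1ℤ
        l = solve-∀
      4σ : ∑[ Z⁴ (4 ℕ.* m) ∣ Form? m ] (λ _ → 1ℤ) ≡ + (4 ℕ.* σ m)
      4σ = trans (Form≡4σ m (+ n + 1ℤ) m-odd ℕP.≤-refl) (sym (ℤP.pos-* 4 (σ m)))

    t-even : ∀ k → n ≡ k ℕ.* 2 → t 1 1 2 8 n ≡ 4 ℕ.* σ m
    t-even k n≡ = ℤP.+-injective (trans (t≡Form n m≡ m≤4m)
      (trans (cong₂ _-_ 4σ (∑sgn-Form-0 (+ k) (trans m≡ (trans (cong (λ z → + 2 * z + + 3) (trans (cong (λ z → + z) n≡) (ℤP.pos-* k 2))) (l (+ k)))) m≤4m))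
             (ℤP.+-identityʳ (+ (4 ℕ.* σ m)))))
      where
      l : ∀ k → + 2 * (k * + 2) + + 3 ≡ + 4 * k + + 3
      l = solve-∀

    t-odd : ∀ k → n ≡ 1 ℕ.+ k ℕ.* 2 → + t 1 1 2 8 n ≡ + (4 ℕ.* σ m) + (+ 4 * negOnePow ((n ℕ.∸ 1) / 2)) * repSum m
    t-odd k n≡ = begin
      + t 1 1 2 8 n
        ≡⟨ t≡Form n m≡ m≤4m ⟩
      ∑[ Z⁴ (4 ℕ.* m) ∣ Form? m ] (λ _ → 1ℤ) - ∑[ Z⁴ (4 ℕ.* m) ∣ Form? m ] (λ (p , q , u , w) → sgn w)
        -- For n = 2k + 1 one has m = 4(k + 1) + 1, so the sign is (-1)ᵏ⁺¹ = -(-1)ᵏ. This cancels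
        -- the minus in front of the second sum, and the two factors 2 make the 4.
        ≡⟨ cong₂ _-_ 4σ (trans (∑sgn-Form (1ℤ + + k) m≡4k+5 m≤4m)
             (cong₂ (λ a b → + 2 * (a * b)) (trans (sgn-suc (+ k)) (cong -_ (sym (negOnePow≡sgn k))))
               (∑-Binary≡2repSum (+ n + 1ℤ) m-odd m≤4m))) ⟩
      + (4 ℕ.* σ m) - + 2 * (- negOnePow k * (+ 2 * repSum m))
        ≡⟨ l (+ (4 ℕ.* σ m)) (negOnePow k) (repSum m) ⟩
      + (4 ℕ.* σ m) + (+ 4 * negOnePow k) * repSum m
        ≡⟨ cong (λ z → + (4 ℕ.* σ m) + (+ 4 * negOnePow z) * repSum m) k≡ ⟨
      + (4 ℕ.* σ m) + (+ 4 * negOnePow ((n ℕ.∸ 1) / 2)) * repSum m ∎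
      where
      l : ∀ s e r → s - + 2 * (- e * (+ 2 * r)) ≡ s + (+ 4 * e) * r
      l = solve-∀
      l′ : ∀ k → + 2 * (1ℤ + k * + 2) + + 3 ≡ + 4 * (1ℤ + k) + 1ℤ
      l′ = solve-∀
      m≡4k+5 : + m ≡ + 4 * (1ℤ + + k) + 1ℤ
      m≡4k+5 = trans m≡ (trans (cong (λ z → + 2 * z + + 3) (trans (cong (λ z → + z) n≡) (cong (_+_ 1ℤ) (ℤP.pos-* k 2)))) (l′ (+ k)))
      k≡ : (n ℕ.∸ 1) / 2 ≡ k
      k≡ = trans (cong (λ z → (z ℕ.∸ 1) / 2) n≡) (m*n/n≡m k 2)

  ℕ-parity : ∀ n → (∃ λ k → n ≡ k ℕ.* 2) ⊎ (∃ λ k → n ≡ 1 ℕ.+ k ℕ.* 2)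
  ℕ-parity zero = inj₁ (0 , refl)
  ℕ-parity (suc n) with ℕ-parity n
  ... | inj₁ (k , eq) = inj₂ (k , cong suc eq)
  ... | inj₂ (k , eq) = inj₁ (suc k , cong suc eq)

open import Data.Nat using (ℕ; _≤_; _+_; _*_; _∸_)
open import Data.Nat.Divisibility using (_∣_)
open import Data.Integer using (ℤ; +_) renaming (_+_ to _+ℤ_; _*_ to _*ℤ_)

theorem3p1 : (n : ℕ) → 1 ≤ n →
    (2 ∣ n → t 1 1 2 8 n ≡ 4 * σ (2 * n + 3))
    × (¬ (2 ∣ n) → + t 1 1 2 8 n ≡ + (4 * σ (2 * n + 3)) +ℤ (+ 4 *ℤ negOnePow ((n ∸ 1) / 2)) *ℤ repSum (2 * n + 3))
theorem3p1 n _ = (λ { (ℕD.divides k n≡) → t-even n k n≡ }) , odd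
  where
  odd : ¬ (2 ∣ n) → + t 1 1 2 8 n ≡ + (4 * σ (2 * n + 3)) +ℤ (+ 4 *ℤ negOnePow ((n ∸ 1) / 2)) *ℤ repSum (2 * n + 3)
  odd 2∤n with ℕ-parity n
  ... | inj₁ (k , n≡) = contradiction (ℕD.divides k n≡) 2∤n
  ... | inj₂ (k , n≡) = t-odd n k n≡
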